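{- The class of MS-computable functions over $\omega^\omega$ coincides with the class of partial recursive functions over $\omega^\omega$. That is, a partial function $f:\mathbb{N}^p\times(\omega^\omega)^q\to Y$, with $p+q\ge1$ and $Y\in\{\mathbb{N},\omega^\omega\}$, is MS-computable over $\omega^\omega$ if and only if it is partial recursive over $\omega^\omega$.
   Context: Write $\mathbb{N}=\omega=\{0,1,2,\dots\}$, $\mathcal{N}=\omega^\omega$ (Baire space), and $0_{\mathcal{N}}$ for the constant zero sequence. All functions may be partial. Universal TTE-computable functions. Fix standard effective enumerations of oracle Turing machines with $q$ oracles from $\mathcal{N}$ ($q\ge 0$). $\Phi^{\vec x}(e,i)$ is the result of the $e$-th machine on input $i$ with oracles $\vec x=(x_1,\dots,x_q)$, and $\Phi^{\vec x}(e)$ is the sequence $y\in\mathcal{N}$ with $y(i)=\Phi^{\vec x}(e,i)$; it is defined iff $\Phi^{\vec x}(e,i)$ is defined for all $i$. Put $\Psi_q(e;\vec x)=\Phi^{\vec x}(e)$. Partial recursive functions over $\mathcal{N}$. This is the smallest class of partial functions from $\mathbb{N}^p\times\mathcal{N}^q$ ($p+q\ge1$) to $\mathbb{N}$ or $\mathcal{N}$ that contains: the zero function $\mathbb{N}\to\mathbb{N}$, the successor function $\mathbb{N}\to\mathbb{N}$, all projections $(n_1,\dots,n_p;x_1,\dots,x_q)\mapsto n_i$ or $x_j$, the universal functions $\Psi_q$, and $\chi:\mathcal{N}\to\mathbb{N}$ with $\chi(0_{\mathcal{N}})=1$ and $\chi(x)=0$ for $x\ne0_{\mathcal{N}}$;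 and that is closed under: composition $f(g_1(\vec m;\vec y),\dots,g_p(\vec m;\vec y);h_1(\vec m;\vec y),\dots,h_q(\vec m;\vec y))$ (with $g_i$ having codomain $\mathbb{N}$ and $h_j$ codomain $\mathcal{N}$; the value is defined only if all inner values are); primitive recursion on a numerical variable, $F(0,\vec n;\vec x)=G(\vec n;\vec x)$, $F(k+1,\vec n;\vec x)=H(k,\vec n;\vec x,F(k,\vec n;\vec x))$ for codomain $\mathcal{N}$, and analogously $F(k+1,\vec n;\vec x)=H(k,\vec n,F(k,\vec n;\vec x);\vec x)$ for codomain $\mathbb{N}$; and the $\mu$-operator on $\mathbb{N}$: from $G:\mathbb{N}^{p+1}\times\mathcal{N}^q\to\mathbb{N}$ one obtains $F(\vec n;\vec x)=$ the least $k$ such that $G(k,\vec n;\vec x)=0$ and $G(k',\vec n;\vec x)$ is defined and nonzero for all $k'<k$ (undefined if there is no such $k$). MS-machines over $\mathcal{N}$. A master-slave machine consists of a master, which is an ordinary deterministic Turing machine with a finite program handling natural numbers and equipped with a billboard (holding a natural number $p$) and a Boolean bit $k$ it can read, together with finitely many Baire tapes $t_1,\dots,t_r$, each holding an element of $\mathcal{N}$; these comprise the input tapes, working tapes, a zero-test tape and an output tape. Besides ordinary Turing machine commands, the master's program may contain: (i) slave-calling commands with a designated target tape $t_l$: if $p$ is on the billboard and $\vec y=(y_1,\dots,y_r)$ are the current contents of the Baire tapes, the content of $t_l$ is replaced by $\Phi^{\vec y}(p)$ and the master enters a specified next state, provided $\Phi^{\vec y}(p)$ is defined (otherwise the whole computation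 is undefined); (ii) zero-test commands: the bit $k$ is set to $1$ if the content of the zero-test tape is $0_{\mathcal{N}}$, and to $0$ otherwise, and the master enters a specified next state. On input $(\vec n;\vec x)\in\mathbb{N}^p\times\mathcal{N}^q$, $\vec n$ is put on the master's tape, $x_1,\dots,x_q$ on the input tapes, and all other Baire tapes hold $0_{\mathcal{N}}$. If the master reaches its halting state after finitely many steps, the output is the number on the master's output tape (codomain $\mathbb{N}$) or the content of the output Baire tape (codomain $\mathcal{N}$); if it never halts or some slave call is undefined, the result is undefined. A partial function is MS-computable over $\mathcal{N}$ if it is computed in this sense by some MS-machine. -}

module Defs where

open import Data.Bool using (Bool; true; false; _∧_)
open import Data.Bool.Properties using () renaming (_≟_ to _≟ᵇ_)
open import Data.Empty using (⊥-elim)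
open import Data.Fin using (Fin; zero; suc; fromℕ<)
open import Data.List using (List; []; _∷_; _++_; drop; findᵇ; mapMaybe; replicate)
open import Data.Maybe using (Maybe; just; nothing; zipWith)
  renaming (map to mapᵐ)
open import Data.Maybe.Properties using (just-injective)
open import Data.Nat using (ℕ; zero; suc; _+_; _≤_; _<_; _≡ᵇ_; _<?_)
open import Data.Nat.Properties using (<-cmp)
open import Data.Product using (Σ; ∃-syntax; _×_; _,_; proj₁; proj₂)
open import Data.Sum using (_⊎_; inj₁; inj₂)
open import Data.Vec using (Vec; []; _∷_; _∷ʳ_; head; lookup; toList; _[_]%=_; _[_]≔_)
  renaming (_++_ to _++ᵛ_; replicate to replicateᵛ)
open import Data.Vec.Properties using (tabulate∘lookup; tabulate-cong)
open import Data.Vec.Relation.Binary.Pointwise.Inductive as Pointwise using (Pointwise; []; _∷_)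
open import Function.Bundles using (_⇔_)
open import Relation.Binary.Construct.Closure.ReflexiveTransitive using (Star; ε; _◅_)
open import Relation.Binary.Definitions using (tri<; tri≈; tri>)
open import Relation.Binary.PropositionalEquality
  using (_≡_; refl; sym; trans; cong; subst; _≗_)
open import Relation.Nullary using (¬_; does; yes; no)

------------------------------------------------------------------------
-- Baire space and partial functions ℕᵖ × 𝒩^q ⇀ Y

𝒩 : Set
𝒩 = ℕ → ℕ

0𝒩 : 𝒩
0𝒩 _ = 0

data Codomain : Set where
  num seq : Codomain

⟦_⟧ : Codomain → Set
⟦ num ⟧ = ℕ
⟦ seq ⟧ = 𝒩

-- Equality of elements of 𝒩 is pointwise equality.

Eq : (Y : Codomain) → ⟦ Y ⟧ → ⟦ Y ⟧ → Set
Eq num = _≡_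
Eq seq = _≗_

infix 4 _≋_ _≐_

_≋_ : ∀ {q} → Vec 𝒩 q → Vec 𝒩 q → Set
_≋_ = Pointwise _≗_

-- A partial function is a single-valued relation; nothing is assumed
-- about decidability of its domain.

record PFun (p q : ℕ) (Y : Codomain) : Set₁ where
  field
    graph      : Vec ℕ p → Vec 𝒩 q → ⟦ Y ⟧ → Set
    functional : ∀ {n x y y′} → graph n x y → graph n x y′ → Eq Y y y′
    respects   : ∀ {n x x′ y y′} → x ≋ x′ → Eq Y y y′ →
                 graph n x y → graph n x′ y′

open PFun public

_≐_ : ∀ {p q Y} → PFun p q Y → PFun p q Y → Set
f ≐ g = ∀ n x y → graph f n x y ⇔ graph g n x y

------------------------------------------------------------------------
-- Turing machine tapes

-- A two-way infinite tape: the cells to the left of the head, nearest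
-- first, and the cells from the head rightwards; all others are blank.
-- Symbols are S₀, S₁, S₂, …, with S₀ the blank and S₁ the stroke.  A
-- machine has a finite list of rules, so only finitely many states and
-- symbols can play a role in it.

record Tape : Set where
  constructor tape
  field
    before after : List ℕ

open Tape public

first : List ℕ → ℕ
first []      = 0
first (s ∷ _) = s

scanned : Tape → ℕ
scanned t = first (after t)

data Action : Set where
  write      : ℕ → Action
  left right : Action

perform : Action → Tape → Tape
perform (write s) (tape l r)       = tape l (s ∷ drop 1 r)
perform left      (tape []      r) = tape [] (0 ∷ r)
perform left      (tape (s ∷ l) r) = tape l (s ∷ r)
perform right     (tape l r)       = tape (first r ∷ l) (drop 1 r)

-- n₁, …, nₚ are written as blocks of strokes, each followed by a blank.

strokes : List ℕ → List ℕ
strokes []       = []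
strokes (n ∷ ns) = replicate n 1 ++ 0 ∷ strokes ns

holding : List ℕ → Tape
holding ns = tape [] (strokes ns)

blank : Tape
blank = tape [] []

-- The number on a tape is the length of the block of strokes that
-- starts at the head and extends to the right.

block : List ℕ → ℕ
block (1 ∷ r) = suc (block r)
block _       = 0

number : Tape → ℕ
number t = block (after t)

------------------------------------------------------------------------
-- Rules: "in state `from`, if `test` succeeds, do `command` and enter
-- state `to`".  The first applicable rule is used.  State 0 is the
-- halting state and state 1 the initial state.

record Rule (Test Command : Set) : Set where
  constructor rule
  field
    from    : ℕ
    test    : Test
    command : Command
    to      : ℕ

open Rule public

applicable : ∀ {T C} → (T → Bool) → ℕ → List (Rule T C) → Maybe (Rule T C)
applicable holds zero    _  = nothing
applicable holds (suc s) rs = findᵇ (λ ρ → (from ρ ≡ᵇ suc s) ∧ holds (test ρ)) rs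

------------------------------------------------------------------------
-- Oracle Turing machines with q oracles from 𝒩 and k tapes

-- `ask j t` replaces the content n of tape t by the value at n of the
-- j-th oracle.

data OracleCommand (q k : ℕ) : Set where
  act : Fin k → Action → OracleCommand q k
  ask : Fin q → Fin k → OracleCommand q k

OracleRule : ℕ → ℕ → Set
OracleRule q k = Rule (Fin k × ℕ) (OracleCommand q k)

record OracleMachine (q : ℕ) : Set where
  constructor oracleMachine
  field
    extra : ℕ
    rules : List (OracleRule q (suc extra))

scans : ∀ {k} → Vec Tape k → Fin k × ℕ → Bool
scans ts (t , s) = scanned (lookup ts t) ≡ᵇ s

execute : ∀ {q k} → Vec 𝒩 q → OracleCommand q k → Vec Tape k → Vec Tape k
execute x (act t a) ts = ts [ t ]%= perform a
execute x (ask j t) ts = ts [ t ]%= λ u → holding (lookup x j (number u) ∷ [])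

OracleConfig : ℕ → Set
OracleConfig k = ℕ × Vec Tape k

oracleStep : ∀ {q k} → Vec 𝒩 q → List (OracleRule q k) →
             OracleConfig k → Maybe (OracleConfig k)
oracleStep x rs (s , ts) =
  mapᵐ (λ ρ → to ρ , execute x (command ρ) ts) (applicable (scans ts) s rs)

-- Input and output are on the first tape.

OracleMachineComputes : ∀ {q} → OracleMachine q → Vec 𝒩 q → ℕ → ℕ → Set
OracleMachineComputes (oracleMachine w rs) x i v =
  ∃[ ts ] Star (λ c d → oracleStep x rs c ≡ just d)
               (1 , holding (i ∷ []) ∷ replicateᵛ w blank) (0 , ts)
        × v ≡ number (head ts)

------------------------------------------------------------------------
-- The enumeration of oracle Turing machines

-- The inverse of Cantor's pairing function.

unpair : ℕ → ℕ × ℕ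
unpair zero    = 0 , 0
unpair (suc n) with unpair n
... | zero  , y = suc y , 0
... | suc x , y = x , suc y

decodeList : ℕ → ℕ → List ℕ
decodeList zero    c = []
decodeList (suc ℓ) c = proj₁ (unpair c) ∷ decodeList ℓ (proj₂ (unpair c))

decodeFin : ∀ n → ℕ → Maybe (Fin n)
decodeFin n m with m <? n
... | yes m<n = just (fromℕ< m<n)
... | no  _   = nothing

decodeCommand : ∀ q k → ℕ → Maybe (OracleCommand q k)
decodeCommand q k c = decode (proj₁ (unpair c)) (unpair (proj₂ (unpair c)))
  where
  decode : ℕ → ℕ × ℕ → Maybe (OracleCommand q k)
  decode 0 (t , s) = mapᵐ (λ u → act u (write s)) (decodeFin k t)
  decode 1 (t , _) = mapᵐ (λ u → act u left) (decodeFin k t)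
  decode 2 (t , _) = mapᵐ (λ u → act u right) (decodeFin k t)
  decode _ (j , t) = zipWith ask (decodeFin q j) (decodeFin k t)

decodeTest : ∀ k → ℕ → Maybe (Fin k × ℕ)
decodeTest k c = mapᵐ (_, proj₂ (unpair c)) (decodeFin k (proj₁ (unpair c)))

decodeRule : ∀ q k → ℕ → Maybe (OracleRule q k)
decodeRule q k c = decode (unpair (proj₁ (unpair c))) (unpair (proj₂ (unpair c)))
  where
  decode : ℕ × ℕ → ℕ × ℕ → Maybe (OracleRule q k)
  decode (s , s′) (t , a) =
    zipWith (λ t′ a′ → rule s t′ a′ s′) (decodeTest k t) (decodeCommand q k a)

-- e codes the number of extra tapes, the number of rules and the rules
-- themselves.  Codes of rules naming a tape or an oracle that the machine
-- does not have are skipped.  Every oracle machine is enumerated.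

machine : ∀ q → ℕ → OracleMachine q
machine q e = decode (proj₁ (unpair e)) (unpair (proj₂ (unpair e)))
  where
  decode : ℕ → ℕ × ℕ → OracleMachine q
  decode w (ℓ , c) = oracleMachine w (mapMaybe (decodeRule q (suc w)) (decodeList ℓ c))

-- Φ x e i v : the e-th machine on input i with oracles x yields v.

Φ : ∀ {q} → Vec 𝒩 q → ℕ → ℕ → ℕ → Set
Φ {q} x e = OracleMachineComputes (machine q e) x

-- Φω x e y : the sequence computed by the e-th machine with oracles x is
-- defined and equals y.

Φω : ∀ {q} → Vec 𝒩 q → ℕ → 𝒩 → Set
Φω x e y = ∀ i → Φ x e i (y i)

execute-cong : ∀ {q k} {x x′ : Vec 𝒩 q} → x ≋ x′ → (a : OracleCommand q k) →
               ∀ ts → execute x a ts ≡ execute x′ a ts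
execute-cong x≋x′ (act t a) ts = refl
execute-cong {x = x} {x′} x≋x′ (ask j t) ts = go t ts
  where
  go : ∀ {k} (t : Fin k) ts →
       ts [ t ]%= (λ u → holding (lookup x j (number u) ∷ [])) ≡
       ts [ t ]%= (λ u → holding (lookup x′ j (number u) ∷ []))
  go zero    (u ∷ ts) =
    cong (λ m → holding (m ∷ []) ∷ ts) (Pointwise.lookup x≋x′ j (number u))
  go (suc t) (u ∷ ts) = cong (u ∷_) (go t ts)

oracleStep-cong : ∀ {q k} {x x′ : Vec 𝒩 q} → x ≋ x′ →
                  ∀ (rs : List (OracleRule q k)) c →
                  oracleStep x rs c ≡ oracleStep x′ rs c
oracleStep-cong x≋x′ rs (s , ts) with applicable (scans ts) s rs
... | nothing = refl
... | just ρ  = cong (λ us → just (to ρ , us)) (execute-cong x≋x′ (command ρ) ts)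

runs-cong : ∀ {q k} {x x′ : Vec 𝒩 q} → x ≋ x′ →
            ∀ (rs : List (OracleRule q k)) {c d} →
            Star (λ c d → oracleStep x rs c ≡ just d) c d →
            Star (λ c d → oracleStep x′ rs c ≡ just d) c d
runs-cong x≋x′ rs ε = ε
runs-cong x≋x′ rs (_◅_ {c} st run) =
  trans (sym (oracleStep-cong x≋x′ rs c)) st ◅ runs-cong x≋x′ rs run

runs-unique : ∀ {q k} {x : Vec 𝒩 q} {rs : List (OracleRule q k)} {c ts us} →
              Star (λ c d → oracleStep x rs c ≡ just d) c (0 , ts) →
              Star (λ c d → oracleStep x rs c ≡ just d) c (0 , us) →
              ts ≡ us
runs-unique ε ε = refl
runs-unique ε (() ◅ _)
runs-unique (() ◅ _) ε
runs-unique (st ◅ run) (st′ ◅ run′)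
  with refl ← just-injective (trans (sym st) st′) = runs-unique run run′

Φ-cong : ∀ {q} {x x′ : Vec 𝒩 q} {e i v} → x ≋ x′ → Φ x e i v → Φ x′ e i v
Φ-cong {q} {e = e} x≋x′ (ts , run , eq) =
  ts , runs-cong x≋x′ (OracleMachine.rules (machine q e)) run , eq

Φ-unique : ∀ {q} {x : Vec 𝒩 q} {e i v v′} → Φ x e i v → Φ x e i v′ → v ≡ v′
Φ-unique (ts , run , eq) (ts′ , run′ , eq′) =
  trans eq (trans (cong (λ us → number (head us)) (runs-unique run run′)) (sym eq′))

------------------------------------------------------------------------
-- Initial functions and closure operations

eqRefl : ∀ Y {y} → Eq Y y y
eqRefl num   = refl
eqRefl seq _ = refl

≋-refl : ∀ {q} {x : Vec 𝒩 q} → x ≋ x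
≋-refl = Pointwise.refl λ _ → refl

≋-snoc : ∀ {q} {x x′ : Vec 𝒩 q} {y y′ : 𝒩} → x ≋ x′ → y ≗ y′ → (x ∷ʳ y) ≋ (x′ ∷ʳ y′)
≋-snoc []       f = f ∷ []
≋-snoc (e ∷ es) f = e ∷ ≋-snoc es f

lookup-ext : ∀ {p} {n n′ : Vec ℕ p} → (∀ i → lookup n i ≡ lookup n′ i) → n ≡ n′
lookup-ext {n = n} {n′} e =
  trans (sym (tabulate∘lookup n)) (trans (tabulate-cong e) (tabulate∘lookup n′))

lookup-≋ : ∀ {q} {x x′ : Vec 𝒩 q} → (∀ j → lookup x j ≗ lookup x′ j) → x ≋ x′
lookup-≋ {x = []}    {[]}     e = []
lookup-≋ {x = _ ∷ _} {_ ∷ _}  e = e zero ∷ lookup-≋ λ j → e (suc j)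

zeroFun : PFun 1 0 num
zeroFun .graph n x y = y ≡ 0
zeroFun .functional refl refl = refl
zeroFun .respects _ refl e = e

succFun : PFun 1 0 num
succFun .graph n x y = y ≡ suc (head n)
succFun .functional refl refl = refl
succFun .respects _ refl e = e

projNum : ∀ {p q} → Fin p → PFun p q num
projNum i .graph n x y = y ≡ lookup n i
projNum i .functional refl refl = refl
projNum i .respects _ refl e = e

projSeq : ∀ {p q} → Fin q → PFun p q seq
projSeq j .graph n x y = y ≗ lookup x j
projSeq j .functional e e′ i = trans (e i) (sym (e′ i))
projSeq j .respects x≋x′ y≗y′ e i =
  trans (sym (y≗y′ i)) (trans (e i) (Pointwise.lookup x≋x′ j i))

Ψ : ∀ q → PFun 1 q seq
Ψ q .graph n x y = Φω x (head n) y
Ψ q .functional {n} {x} e e′ i = Φ-unique {x = x} {head n} (e i) (e′ i)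
Ψ q .respects {n} {x} {x′} x≋x′ y≗y′ e i =
  subst (Φ x′ (head n) i) (y≗y′ i) (Φ-cong {x = x} {x′} {head n} x≋x′ (e i))

-- IsZeroTest x v : v is χ(x).

IsZeroTest : 𝒩 → ℕ → Set
IsZeroTest x v = (x ≗ 0𝒩 × v ≡ 1) ⊎ (¬ x ≗ 0𝒩 × v ≡ 0)

χ : PFun 0 1 num
χ .graph n x v = IsZeroTest (head x) v
χ .functional (inj₁ (_ , refl)) (inj₁ (_ , refl)) = refl
χ .functional (inj₁ (z , _))    (inj₂ (¬z , _))   = ⊥-elim (¬z z)
χ .functional (inj₂ (¬z , _))   (inj₁ (z , _))    = ⊥-elim (¬z z)
χ .functional (inj₂ (_ , refl)) (inj₂ (_ , refl)) = refl
χ .respects (e ∷ []) refl (inj₁ (z , r)) = inj₁ ((λ i → trans (sym (e i)) (z i)) , r)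
χ .respects (e ∷ []) refl (inj₂ (¬z , r)) =
  inj₂ ((λ z → ¬z λ i → trans (e i) (z i)) , r)

compose : ∀ {p q p′ q′ Y} → PFun p q Y →
          (Fin p → PFun p′ q′ num) → (Fin q → PFun p′ q′ seq) → PFun p′ q′ Y
compose f g h .graph m y z =
  ∃[ n ] ∃[ x ] (∀ i → graph (g i) m y (lookup n i))
              × (∀ j → graph (h j) m y (lookup x j))
              × graph f n x z
compose {Y = Y} f g h .functional (n , x , G , H , F) (n′ , x′ , G′ , H′ , F′)
  with refl ← lookup-ext {n = n} {n′} (λ i → functional (g i) (G i) (G′ i)) =
  functional f (respects f (lookup-≋ λ j → functional (h j) (H j) (H′ j)) (eqRefl Y) F) F′
compose f g h .respects e e′ (n , x , G , H , F) =
  n , x , (λ i → respects (g i) e refl (G i)) ,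
  (λ j → respects (h j) e (λ _ → refl) (H j)) , respects f ≋-refl e′ F

module PrimRecNum {p q} (G : PFun p q num) (H : PFun (2 + p) q num) where

  Rec : ℕ → Vec ℕ p → Vec 𝒩 q → ℕ → Set
  Rec zero    n x v = graph G n x v
  Rec (suc k) n x v = ∃[ u ] Rec k n x u × graph H (k ∷ (n ∷ʳ u)) x v

  Rec-functional : ∀ k {n x v v′} → Rec k n x v → Rec k n x v′ → v ≡ v′
  Rec-functional zero    e e′ = functional G e e′
  Rec-functional (suc k) (u , r , e) (u′ , r′ , e′)
    with refl ← Rec-functional k r r′ = functional H e e′

  Rec-respects : ∀ k {n x x′ v} → x ≋ x′ → Rec k n x v → Rec k n x′ v
  Rec-respects zero    x≋x′ e = respects G x≋x′ refl e
  Rec-respects (suc k) x≋x′ (u , r , e) =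
    u , Rec-respects k x≋x′ r , respects H x≋x′ refl e

primRecNum : ∀ {p q} → PFun p q num → PFun (2 + p) q num → PFun (suc p) q num
primRecNum G H .graph (k ∷ n) = PrimRecNum.Rec G H k n
primRecNum G H .functional {k ∷ _} = PrimRecNum.Rec-functional G H k
primRecNum G H .respects {k ∷ _} x≋x′ refl = PrimRecNum.Rec-respects G H k x≋x′

module PrimRecSeq {p q} (G : PFun p q seq) (H : PFun (suc p) (suc q) seq) where

  Rec : ℕ → Vec ℕ p → Vec 𝒩 q → 𝒩 → Set
  Rec zero    n x v = graph G n x v
  Rec (suc k) n x v = ∃[ u ] Rec k n x u × graph H (k ∷ n) (x ∷ʳ u) v

  Rec-functional : ∀ k {n x v v′} → Rec k n x v → Rec k n x v′ → v ≗ v′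
  Rec-functional zero    e e′ = functional G e e′
  Rec-functional (suc k) (u , r , e) (u′ , r′ , e′) =
    functional H (respects H (≋-snoc ≋-refl (Rec-functional k r r′)) (λ _ → refl) e) e′

  Rec-respects : ∀ k {n x x′ v v′} → x ≋ x′ → v ≗ v′ → Rec k n x v → Rec k n x′ v′
  Rec-respects zero    x≋x′ v≗v′ e = respects G x≋x′ v≗v′ e
  Rec-respects (suc k) x≋x′ v≗v′ (u , r , e) =
    u , Rec-respects k x≋x′ (λ _ → refl) r ,
    respects H (≋-snoc x≋x′ λ _ → refl) v≗v′ e

primRecSeq : ∀ {p q} → PFun p q seq → PFun (suc p) (suc q) seq → PFun (suc p) q seq
primRecSeq G H .graph (k ∷ n) = PrimRecSeq.Rec G H k n
primRecSeq G H .functional {k ∷ _} = PrimRecSeq.Rec-functional G H k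
primRecSeq G H .respects {k ∷ _} = PrimRecSeq.Rec-respects G H k

μ : ∀ {p q} → PFun (suc p) q num → PFun p q num
μ G .graph n x k =
  graph G (k ∷ n) x 0 × (∀ k′ → k′ < k → ∃[ v ] graph G (k′ ∷ n) x (suc v))
μ G .functional {y = k} {k′} (z , nz) (z′ , nz′) with <-cmp k k′
... | tri≈ _ k≡k′ _ = k≡k′
... | tri< k<k′ _ _ with () ← functional G z (proj₂ (nz′ k k<k′))
... | tri> _ _ k′<k with () ← functional G z′ (proj₂ (nz k′ k′<k))
μ G .respects x≋x′ refl (z , nz) =
  respects G x≋x′ refl z ,
  λ k′ lt → proj₁ (nz k′ lt) , respects G x≋x′ refl (proj₂ (nz k′ lt))

-- The smallest class with the stated closure properties.  All members
-- have p + q ≥ 1: this is automatic except for μ.  The first constructor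
-- makes membership depend only on the graph as a set.

data PartialRecursive : ∀ {p q Y} → PFun p q Y → Set₁ where
  extensional : ∀ {p q Y} {f g : PFun p q Y} →
                f ≐ g → PartialRecursive f → PartialRecursive g
  zeroʳ       : PartialRecursive zeroFun
  succʳ       : PartialRecursive succFun
  projNumʳ    : ∀ {p q} (i : Fin p) → PartialRecursive (projNum {p} {q} i)
  projSeqʳ    : ∀ {p q} (j : Fin q) → PartialRecursive (projSeq {p} {q} j)
  Ψʳ          : ∀ q → PartialRecursive (Ψ q)
  χʳ          : PartialRecursive χ
  composeʳ    : ∀ {p q p′ q′ Y} {f : PFun p q Y}
                {g : Fin p → PFun p′ q′ num} {h : Fin q → PFun p′ q′ seq} →
                PartialRecursive f →
                (∀ i → PartialRecursive (g i)) → (∀ j → PartialRecursive (h j)) →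
                PartialRecursive (compose f g h)
  primRecNumʳ : ∀ {p q} {G : PFun p q num} {H : PFun (2 + p) q num} →
                PartialRecursive G → PartialRecursive H →
                PartialRecursive (primRecNum G H)
  primRecSeqʳ : ∀ {p q} {G : PFun p q seq} {H : PFun (suc p) (suc q) seq} →
                PartialRecursive G → PartialRecursive H →
                PartialRecursive (primRecSeq G H)
  μʳ          : ∀ {p q} {G : PFun (suc p) q num} → 1 ≤ p + q →
                PartialRecursive G → PartialRecursive (μ G)

------------------------------------------------------------------------
-- Master-slave machines with q input tapes

data MasterTest (k : ℕ) : Set where
  scan : Fin k → ℕ → MasterTest k
  bit? : Bool → MasterTest k

data MasterCommand (k r : ℕ) : Set where
  act      : Fin k → Action → MasterCommand k r
  call     : Fin r → MasterCommand k r
  zeroTest : MasterCommand k r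

-- The master has an input tape, an output tape, a billboard and `extra`
-- further tapes.  The Baire tapes are the zero-test tape, the output
-- tape, the q input tapes and `working` working tapes.

record MSMachine (q : ℕ) : Set where
  field
    extra working : ℕ

    program : List (Rule (MasterTest (3 + extra))
                         (MasterCommand (3 + extra) (2 + (q + working))))

  #tapes #baire : ℕ
  #tapes = 3 + extra
  #baire = 2 + (q + working)

module MS {q : ℕ} (M : MSMachine q) where
  open MSMachine M public

  outputTape billboard : Fin #tapes
  outputTape = suc zero
  billboard  = suc (suc zero)

  zeroTestBaire outputBaire : Fin #baire
  zeroTestBaire = zero
  outputBaire   = suc zero

  record Memory : Set where
    constructor memory
    field
      tapes : Vec Tape #tapes
      baire : Vec 𝒩 #baire
      bit   : Bool

  open Memory public

  Config : Set
  Config = ℕ × Memory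

  holds : Memory → MasterTest #tapes → Bool
  holds m (scan t s) = scans (tapes m) (t , s)
  holds m (bit? b)   = does (bit m ≟ᵇ b)

  data Executes : MasterCommand #tapes #baire → Memory → Memory → Set where
    act         : ∀ {t a ts ys b} →
                  Executes (act t a) (memory ts ys b)
                           (memory (ts [ t ]%= perform a) ys b)
    call        : ∀ {l ts ys b z} → Φω ys (number (lookup ts billboard)) z →
                  Executes (call l) (memory ts ys b) (memory ts (ys [ l ]≔ z) b)
    zeroTestYes : ∀ {ts ys b} → lookup ys zeroTestBaire ≗ 0𝒩 →
                  Executes zeroTest (memory ts ys b) (memory ts ys true)
    zeroTestNo  : ∀ {ts ys b} → ¬ lookup ys zeroTestBaire ≗ 0𝒩 →
                  Executes zeroTest (memory ts ys b) (memory ts ys false)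

  data _⟶_ : Config → Config → Set where
    step : ∀ {s m m′ ρ} → applicable (holds m) s program ≡ just ρ →
           Executes (command ρ) m m′ → (s , m) ⟶ (to ρ , m′)

  initial : ∀ {p} → Vec ℕ p → Vec 𝒩 q → Config
  initial n x =
    1 , memory (holding (toList n) ∷ replicateᵛ (2 + extra) blank)
               (0𝒩 ∷ 0𝒩 ∷ (x ++ᵛ replicateᵛ working 0𝒩))
               false

  output : ∀ Y → Memory → ⟦ Y ⟧
  output num m = number (lookup (tapes m) outputTape)
  output seq m = lookup (baire m) outputBaire

  -- On input (n ; x) the halting state is reached with output y.

  Computes : ∀ {p} Y → Vec ℕ p → Vec 𝒩 q → ⟦ Y ⟧ → Set
  Computes Y n x y = ∃[ m ] Star _⟶_ (initial n x) (0 , m) × Eq Y (output Y m) y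

MSComputable : ∀ {p q Y} → PFun p q Y → Set
MSComputable {q = q} {Y} f =
  Σ (MSMachine q) λ M → ∀ n x y → graph f n x y ⇔ MS.Computes M Y n x y

{-# OPTIONS --safe #-}

-- Both directions rest on primitive recursive terms with oracles.  The tapes
-- of an oracle machine serve as unary counters, so every such term is computed
-- by a slave with a constant program.
--
-- From recursive functions to machines: numbers and sequences are kept on Baire
-- tapes, and each closure operation becomes a loop of slave calls with constant
-- programs and zero tests.  Only Ψ needs a program computed at run time.  As a
-- slave sees all Baire tapes of the machine, the index is first changed, by a
-- primitive recursive function, into one whose oracles are renamed accordingly.
--
-- From machines to recursive functions: a configuration is packed into one
-- sequence, and a step is a composition of Ψ, χ and one term.  Primitive
-- recursion with values in 𝒩 iterates the step and μ finds the halting time.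
-- Composition is strict, so Ψ and χ get harmless arguments in the steps that do
-- not use them.

module Submission where

open import Defs
open import Data.Bool using (Bool; true; false; _∧_; if_then_else_; T)
open import Data.Bool.Properties using () renaming (_≟_ to _≟ᵇ_)
open import Data.Empty using (⊥-elim)
open import Data.Fin using (Fin; zero; suc; toℕ; fromℕ; fromℕ<; splitAt; _↑ˡ_; _↑ʳ_)
open import Data.Fin.Properties using
  (toℕ<n; fromℕ<-toℕ; toℕ-↑ˡ; splitAt-↑ˡ; splitAt-↑ʳ) renaming (suc-injective to sucᶠ-injective)
open import Data.List using (List; []; _∷_; _++_; drop; replicate; mapMaybe; map) renaming (length to lengthᴸ)
open import Data.List.Relation.Unary.All as All using (All; []; _∷_)
open import Data.List.Relation.Unary.All.Properties using (++⁺)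
open import Data.Maybe using (Maybe; just; nothing) renaming (map to mapᵐ)
open import Data.Maybe.Properties using (just-injective)
open import Data.Nat
open import Data.Nat.Properties
open import Data.Product using (Σ; ∃-syntax; _×_; _,_; proj₁; proj₂)
open import Data.Sum using (inj₁; inj₂)
open import Data.Unit using (⊤)
open import Data.Vec using
  (Vec; []; _∷_; _∷ʳ_; head; lookup; tabulate; toList; _[_]%=_; _[_]≔_)
  renaming (replicate to replicateᵛ; map to mapᵛ; _++_ to _++ᵛ_)
open import Data.Vec.Properties using
  (lookup∘updateAt; lookup∘updateAt′; updateAt-updateAt; lookup∘update; lookup∘update′; lookup-replicate;
   lookup-map; map-∘; map-∷ʳ; lookup-++ˡ; lookup∘tabulate; tabulate∘lookup; tabulate-cong)
open import Data.Vec.Relation.Binary.Pointwise.Inductive as Pointwise using ([]; _∷_)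
open import Function using (_∘_; id; case_of_)
open import Function.Bundles using (_⇔_; mk⇔; Equivalence)
open import Relation.Binary.Construct.Closure.ReflexiveTransitive using (Star; ε; _◅_; _◅◅_; gmap)
open import Relation.Binary.Definitions using (tri<; tri≈; tri>)
open import Relation.Binary.PropositionalEquality
open import Relation.Nullary using (¬_; does; yes; no)

-- Structured programs and their rule lists

-- Whether a sequence is zero is not decidable constructively, so `χ` has to be treated as partial,
-- just like `Ψ` and `μ`. Programs of a master therefore get two specifications: whatever a halting
-- run leaves lies in the graph, and a run halts wherever a value is given. These become the two
-- directions of the equivalence in `MSComputable`. Primitive recursive terms suit slaves because
-- they are total: a slave that runs one always answers, so divergence enters only with indices
-- found at run time, with loops and with zero tests. Sequences are equal only pointwise, and a
-- slave call fixes the new tape no further than that. Hence postconditions give values up to `≗`,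
-- and relations stand where functions would call for extensionality. Numbers and sequences do not
-- convert freely. A master learns of a Baire tape only whether it is zero, and among the initial
-- functions only `χ` extracts a number from a sequence. So a number is held as the value of a
-- sequence at 0, and it is recovered by counting down or by searching.

infixr 20 _⨾_

data Prog (T C : Set) : Set where
  skip  : Prog T C
  cmd   : C → Prog T C
  _⨾_   : Prog T C → Prog T C → Prog T C
  while : T → Prog T C → Prog T C

≢⇒≡ᵇ-false : ∀ {m n} → m ≢ n → (m ≡ᵇ n) ≡ false
≢⇒≡ᵇ-false {m} {n} m≢n with m ≡ᵇ n in eq
... | false = refl
... | true  = ⊥-elim (m≢n (≡ᵇ⇒≡ m n (subst T (sym eq) _)))

≡ᵇ-refl : ∀ n → (n ≡ᵇ n) ≡ true
≡ᵇ-refl zero    = refl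
≡ᵇ-refl (suc n) = ≡ᵇ-refl n

module _ {T C : Set} where

  FromNot : ℕ → List (Rule T C) → Set
  FromNot s = All λ ρ → from ρ ≢ s

  applicable-++ʳ : ∀ {s} (h : T → Bool) {ρs} σs → FromNot s ρs →
                   applicable h s (ρs ++ σs) ≡ applicable h s σs
  applicable-++ʳ {zero}  h σs _  = refl
  applicable-++ʳ {suc s} h σs [] = refl
  applicable-++ʳ {suc s} h σs (_∷_ {ρ} ≢s ps)
    rewrite ≢⇒≡ᵇ-false ≢s = applicable-++ʳ h σs ps

  applicable-none : ∀ {s} (h : T → Bool) {ρs} → FromNot s ρs → applicable h s ρs ≡ nothing
  applicable-none {zero}  h _  = refl
  applicable-none {suc s} h [] = refl
  applicable-none {suc s} h (_∷_ {ρ} ≢s ps)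
    rewrite ≢⇒≡ᵇ-false ≢s = applicable-none h ps

  applicable-++ˡ : ∀ {s} (h : T → Bool) ρs {σs} → FromNot s σs →
                   applicable h s (ρs ++ σs) ≡ applicable h s ρs
  applicable-++ˡ {zero}  h ρs _ = refl
  applicable-++ˡ {suc s} h [] ps = applicable-none h ps
  applicable-++ˡ {suc s} h (ρ ∷ ρs) ps with (from ρ ≡ᵇ suc s) ∧ h (test ρ)
  ... | true  = refl
  ... | false = applicable-++ˡ h ρs ps

-- Since only the first applicable rule is used, `always` serves as the
-- "otherwise" branch; `nop` is a command executed on pure jumps.

module Code {T C : Set} (always : T) (nop : C) where

  exit : Prog T C → ℕ → ℕ
  exit skip        s = s
  exit (cmd c)     s = suc s
  exit (P ⨾ Q)     s = exit Q (exit P s)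
  exit (while t P) s = suc (exit P (suc s))

  rulesOf : Prog T C → ℕ → List (Rule T C)
  rulesOf skip        s = []
  rulesOf (cmd c)     s = rule s always c (suc s) ∷ []
  rulesOf (P ⨾ Q)     s = rulesOf P s ++ rulesOf Q (exit P s)
  -- State `s` is the loop head; its second rule is reached only when the test fails. The exit state
  -- of the body belongs to the loop and jumps back, so the loop itself ends one state later.
  rulesOf (while t P) s =
    rule s t nop (suc s) ∷ rule s always nop (exit (while t P) s) ∷
    (rulesOf P (suc s) ++ rule (exit P (suc s)) always nop s ∷ [])

  programOf : Prog T C → List (Rule T C)
  programOf P = rulesOf P 1 ++ rule (exit P 1) always nop 0 ∷ []

-- Runs of compiled rule lists

module Compilation {T C M : Set} (holds : M → T → Bool) (Exec : C → M → M → Set)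
                   (always : T) (nop : C) where

  open Code always nop public

  -- `always` is an ordinary test, which can fail on a memory in disorder, so each use of it appears
  -- as a premise. The representation invariants of both kinds of machine discharge these premises,
  -- as they keep a spare tape blank.
  data Run : Prog T C → M → M → Set where
    skip : ∀ {m} → Run skip m m
    cmd  : ∀ {c m m′} → holds m always ≡ true → Exec c m m′ → Run (cmd c) m m′
    _⨾_  : ∀ {P Q m m₁ m₂} → Run P m m₁ → Run Q m₁ m₂ → Run (P ⨾ Q) m m₂
    stop : ∀ {t P m m′} → holds m t ≡ false → holds m always ≡ true → Exec nop m m′ →
           Run (while t P) m m′
    go   : ∀ {t P m m₁ m₂ m₃ m₄} → holds m t ≡ true → Exec nop m m₁ → Run P m₁ m₂ →
           holds m₂ always ≡ true → Exec nop m₂ m₃ → Run (while t P) m₃ m₄ →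
           Run (while t P) m m₄

  -- Steps of oracle machines and transitions of masters are both instances, so compilation is
  -- verified once for the two.
  data Step (ρs : List (Rule T C)) : ℕ × M → ℕ × M → Set where
    step : ∀ {s m m′ ρ} → applicable (holds m) s ρs ≡ just ρ → Exec (command ρ) m m′ →
           Step ρs (s , m) (to ρ , m′)

  exit-≥ : ∀ P s → s ≤ exit P s
  exit-≥ skip        s = ≤-refl
  exit-≥ (cmd c)     s = n≤1+n s
  exit-≥ (P ⨾ Q)     s = ≤-trans (exit-≥ P s) (exit-≥ Q (exit P s))
  exit-≥ (while t P) s = ≤-trans (n≤1+n s) (≤-trans (exit-≥ P (suc s)) (n≤1+n _))

  FromIn : ℕ → ℕ → List (Rule T C) → Set
  FromIn s e = All λ ρ → s ≤ from ρ × from ρ < e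

  widen : ∀ {s s′ e e′ ρs} → s′ ≤ s → e ≤ e′ → FromIn s e ρs → FromIn s′ e′ ρs
  widen s′≤s e≤e′ = All.map λ (a , b) → ≤-trans s′≤s a , ≤-trans b e≤e′

  rulesOf-from : ∀ P s → FromIn s (exit P s) (rulesOf P s)
  rulesOf-from skip        s = []
  rulesOf-from (cmd c)     s = (≤-refl , ≤-refl) ∷ []
  rulesOf-from (P ⨾ Q)     s =
    ++⁺ (widen ≤-refl (exit-≥ Q _) (rulesOf-from P s))
        (widen (exit-≥ P s) ≤-refl (rulesOf-from Q (exit P s)))
  rulesOf-from (while t P) s = (≤-refl , lt) ∷ (≤-refl , lt) ∷
    ++⁺ (widen (n≤1+n s) (n≤1+n _) (rulesOf-from P (suc s)))
        ((≤-trans (n≤1+n s) (exit-≥ P (suc s)) , ≤-refl) ∷ [])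
    where lt = ≤-trans (exit-≥ P (suc s)) (n≤1+n _)

  below : ∀ {s e u ρs} → FromIn s e ρs → u < s → FromNot u ρs
  below ps u<s = All.map (λ { (s≤u , _) refl → <-irrefl refl (<-≤-trans u<s s≤u) }) ps

  above : ∀ {s e u ρs} → FromIn s e ρs → e ≤ u → FromNot u ρs
  above ps e≤u = All.map (λ { (_ , u<e) refl → <-irrefl refl (<-≤-trans u<e e≤u) }) ps

  -- Comparing lookups state by state, rather than splitting the list, makes the property pass to
  -- subprograms whatever rules surround them.
  Located : Prog T C → ℕ → List (Rule T C) → Set
  Located P s ρs = ∀ u → s ≤ u → u < exit P s → ∀ h →
                   applicable h u ρs ≡ applicable h u (rulesOf P s)

  located-ˡ : ∀ {P Q s ρs} → Located (P ⨾ Q) s ρs → Located P s ρs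
  located-ˡ {P} {Q} {s} loc u s≤u u<e h =
    trans (loc u s≤u (<-≤-trans u<e (exit-≥ Q _)) h)
          (applicable-++ˡ h (rulesOf P s) (below (rulesOf-from Q (exit P s)) u<e))

  located-ʳ : ∀ {P Q s ρs} → Located (P ⨾ Q) s ρs → Located Q (exit P s) ρs
  located-ʳ {P} {Q} {s} loc u e≤u u<e h =
    trans (loc u (≤-trans (exit-≥ P s) e≤u) u<e h)
          (applicable-++ʳ h (rulesOf Q (exit P s)) (above (rulesOf-from P s) e≤u))

  located-body : ∀ {t P s ρs} → Located (while t P) s ρs → Located P (suc s) ρs
  located-body {t} {P} {s} loc u s<u u<e h =
    trans (loc u (<⇒≤ s<u) (<-trans u<e ≤-refl) h)
      (trans (applicable-++ʳ h _ (<⇒≢ s<u ∷ <⇒≢ s<u ∷ []))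
             (applicable-++ˡ {s = u} h (rulesOf P (suc s)) ((λ { refl → <-irrefl refl u<e }) ∷ [])))

  module _ {t P s ρs} (loc : Located (while t P) (suc s) ρs) where

    private
      s<e : suc s < exit (while t P) (suc s)
      s<e = ≤-trans (exit-≥ P (suc (suc s))) (n≤1+n _)

    located-go : ∀ h → h t ≡ true →
                 applicable h (suc s) ρs ≡ just (rule (suc s) t nop (suc (suc s)))
    located-go h ht rewrite loc (suc s) ≤-refl s<e h | ≡ᵇ-refl s | ht = refl

    located-stop : ∀ h → h t ≡ false → h always ≡ true →
                   applicable h (suc s) ρs ≡
                   just (rule (suc s) always nop (exit (while t P) (suc s)))
    located-stop h ht ha
      rewrite loc (suc s) ≤-refl s<e h | ≡ᵇ-refl s | ht | ha = refl

    located-stuck : ∀ h → h t ≡ false → h always ≡ false → applicable h (suc s) ρs ≡ nothing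
    located-stuck h ht ha
      rewrite loc (suc s) ≤-refl s<e h | ≡ᵇ-refl s | ht | ha =
      applicable-none h (++⁺ (below (rulesOf-from P (suc (suc s))) ≤-refl)
        (≢-sym (<⇒≢ (exit-≥ P (suc (suc s)))) ∷ []))

    located-back : ∀ h → applicable h (exit P (suc (suc s))) ρs ≡
                   applicable h (exit P (suc (suc s)))
                     (rule (exit P (suc (suc s))) always nop (suc s) ∷ [])
    located-back h = trans (loc _ (<⇒≤ (exit-≥ P (suc (suc s)))) ≤-refl h)
      (trans (applicable-++ʳ h _ (<⇒≢ (exit-≥ P _) ∷ <⇒≢ (exit-≥ P _) ∷ []))
             (applicable-++ʳ h _ (above (rulesOf-from P (suc (suc s))) ≤-refl)))

  applicable-single : ∀ {e u v} {h : T → Bool} {c : C} → e ≡ suc u → h always ≡ true →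
    applicable h e (rule e always c v ∷ []) ≡ just (rule e always c v)
  applicable-single {u = u} refl ha rewrite ≡ᵇ-refl u | ha = refl

  applicable-single⁻ : ∀ s {h : T → Bool} {c : C} {u ρ} →
    applicable h (suc s) (rule (suc s) always c u ∷ []) ≡ just ρ →
    h always ≡ true × ρ ≡ rule (suc s) always c u
  applicable-single⁻ s {h} eq with h always | eq
  ... | true  | eq′ rewrite ≡ᵇ-refl s = refl , sym (just-injective eq′)
  ... | false | eq′ rewrite ≡ᵇ-refl s with () ← eq′

  -- `applicable` computes only at a visible successor, since state 0 has no rules. The exit of a
  -- block that starts above 0 is brought into that form.
  positive : ∀ P s → ∃[ u ] exit P (suc s) ≡ suc u
  positive P s with exit P (suc s) | exit-≥ P (suc s)
  ... | suc u | _ = u , refl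

  module _ {ρs : List (Rule T C)} where

    forward : ∀ {P s m m′} → Located P (suc s) ρs → Run P m m′ →
              Star (Step ρs) (suc s , m) (exit P (suc s) , m′)
    forward loc skip = ε
    forward {s = s} {m} loc (cmd ha ex) =
      step (trans (loc _ ≤-refl ≤-refl _) (applicable-single {h = holds m} refl ha)) ex ◅ ε
    forward {s = s} loc (_⨾_ {P} {Q} r r′)
      with positive P s | located-ʳ {P} {Q} loc | forward (located-ˡ {P} {Q} loc) r
    ... | u , eq | locQ | rP rewrite eq = rP ◅◅ forward locQ r′
    forward loc (stop {t} {P} ht ha ex) =
      step (located-stop {t} {P} loc _ ht ha) ex ◅ ε
    forward {s = s} loc (go {t} {P} ht ex r ha ex′ r′) =
      step (located-go {t} {P} loc _ ht) ex ◅
      (forward (located-body {t} {P} loc) r ◅◅ (back ◅ forward loc r′))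
      where
      back : Step ρs (exit P (suc (suc s)) , _) (suc s , _)
      back = step (trans (located-back {t} {P} loc _)
                         (applicable-single (proj₂ (positive P (suc s))) ha)) ex′

    length : ∀ {c d} → Star (Step ρs) c d → ℕ
    length ε       = 0
    length (_ ◅ r) = suc (length r)

    -- Inverts a halting run at a state that offers nothing but an unconditional jump: the way back
    -- from a loop body, and the last step into the halting state.
    jump : ∀ {e u v m m′ n} → e ≡ suc u →
           applicable (holds m) e ρs ≡ applicable (holds m) e (rule e always nop v ∷ []) →
           (r : Star (Step ρs) (e , m) (0 , m′)) → length r ≤ n →
           ∃[ m₁ ] holds m always ≡ true × Exec nop m m₁ ×
           Σ (Star (Step ρs) (v , m₁) (0 , m′)) λ r → length r ≤ n
    jump {u = u} {m = m} refl eq (step ap ex ◅ r) r≤n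
      with ha , refl ← applicable-single⁻ u {holds m} (trans (sym eq) ap) =
      _ , ha , ex , r , <⇒≤ r≤n

    record Split (P : Prog T C) (s : ℕ) (m m′ : M) (n : ℕ) : Set where
      constructor split
      field
        {middle} : M
        run      : Run P m middle
        rest     : Star (Step ρs) (exit P s , middle) (0 , m′)
        shorter  : length rest ≤ n

    -- The halting state lies outside the block of `P`, so a halting run must leave the block by its
    -- exit. A loop is entered again with a run that is no subterm of the given one; hence the
    -- recursion on a bound `n` for the length.
    backward : ∀ P n {s m m′} → Located P (suc s) ρs →
               (r : Star (Step ρs) (suc s , m) (0 , m′)) → length r ≤ n →
               Split P (suc s) m m′ n
    backward skip n loc r r≤n = split skip r r≤n
    backward (cmd c) (suc n) {s} {m} loc (step ap ex ◅ r) (s≤s r≤n)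
      with ha , refl ← applicable-single⁻ s {holds m} (trans (sym (loc _ ≤-refl ≤-refl _)) ap) =
      split (cmd ha ex) r (≤-trans r≤n (n≤1+n n))
    backward (P ⨾ Q) n {s} {m} {m′} loc r r≤n with backward P n (located-ˡ {P} {Q} loc) r r≤n
    ... | split {m₁} rp rest ≤n
      with next (proj₂ (positive P s)) (located-ʳ {P} {Q} loc) rest ≤n
      where
      next : ∀ {e u} → e ≡ suc u → Located Q e ρs →
             (r : Star (Step ρs) (e , m₁) (0 , m′)) → length r ≤ n → Split Q e m₁ m′ n
      next refl locQ r r≤n = backward Q n locQ r r≤n
    ... | split rq rest′ ≤n′ = split (rp ⨾ rq) rest′ ≤n′
    backward (while t P) (suc n) {s} {m} loc (step ap ex ◅ r) (s≤s r≤n)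
      with holds m t in ht | holds m always in ha
    ... | false | false with () ← trans (sym ap) (located-stuck {t} {P} loc _ ht ha)
    ... | false | true
      with refl ← just-injective (trans (sym ap) (located-stop {t} {P} loc _ ht ha)) =
      split (stop ht ha ex) r (≤-trans r≤n (n≤1+n n))
    ... | true | _
      with refl ← just-injective (trans (sym ap) (located-go {t} {P} loc _ ht))
      with backward P n (located-body {t} {P} loc) r r≤n
    ... | split rp rest ≤n
      with jump (proj₂ (positive P (suc s))) (located-back {t} {P} loc _) rest ≤n
    ... | m₃ , ha′ , ex′ , r′ , ≤n′ with backward (while t P) n loc r′ ≤n′
    ... | split rw rest′ ≤n″ = split (go ht ex rp ha′ ex′ rw) rest′ (≤-trans ≤n″ (n≤1+n n))

  located-program : ∀ P → Located P 1 (programOf P)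
  located-program P u _ u<e h =
    applicable-++ˡ {s = u} h (rulesOf P 1) ((λ { refl → <-irrefl refl u<e }) ∷ [])

  final : ∀ P h → applicable h (exit P 1) (programOf P) ≡
          applicable h (exit P 1) (rule (exit P 1) always nop 0 ∷ [])
  final P h = applicable-++ʳ h _ (above (rulesOf-from P 1) ≤-refl)

  run⇒halts : ∀ {P m m₁ m′} → Run P m m₁ → holds m₁ always ≡ true → Exec nop m₁ m′ →
              Star (Step (programOf P)) (1 , m) (0 , m′)
  run⇒halts {P} r ha ex = forward (located-program P) r ◅◅ (last ◅ ε)
    where
    last : Step (programOf P) (exit P 1 , _) (0 , _)
    last = step (trans (final P _) (applicable-single (proj₂ (positive P 0)) ha)) ex

  halts⇒run : ∀ {P m m′} → Star (Step (programOf P)) (1 , m) (0 , m′) →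
              ∃[ m₁ ] Run P m m₁ × holds m₁ always ≡ true × Exec nop m₁ m′
  halts⇒run {P} r with backward P _ (located-program P) r ≤-refl
  ... | split rp rest _ with jump (proj₂ (positive P 0)) (final P _) rest ≤-refl
  ... | _ , ha , ex , ε , _ = _ , rp , ha , ex
  ... | _ , _ , _ , step () _ ◅ _ , _

-- Primitive recursive terms with oracles

data PR (q : ℕ) : ℕ → Set where
  var  : ∀ {n} → Fin n → PR q n
  zero : ∀ {n} → PR q n
  suc  : ∀ {n} → PR q n → PR q n
  ask  : ∀ {n} → Fin q → PR q n → PR q n
  app  : ∀ {m n} → PR q m → Vec (PR q n) m → PR q n
  rec  : ∀ {n} → PR q n → PR q (2 + n) → PR q (suc n)

natrec : ℕ → (ℕ → ℕ → ℕ) → ℕ → ℕ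
natrec b s zero    = b
natrec b s (suc k) = s k (natrec b s k)

eval  : ∀ {q n} → PR q n → Vec 𝒩 q → Vec ℕ n → ℕ
evals : ∀ {q m n} → Vec (PR q n) m → Vec 𝒩 q → Vec ℕ n → Vec ℕ m

eval (var i)    x ρ       = lookup ρ i
eval zero       x ρ       = 0
eval (suc t)    x ρ       = suc (eval t x ρ)
eval (ask j t)  x ρ       = lookup x j (eval t x ρ)
eval (app t ts) x ρ       = eval t x (evals ts x ρ)
eval (rec b s)  x (k ∷ ρ) = natrec (eval b x ρ) (λ i a → eval s x (i ∷ a ∷ ρ)) k

evals []       x ρ = []
evals (t ∷ ts) x ρ = eval t x ρ ∷ evals ts x ρ

-- Tapes as counters

-- A counter is increased by moving left and writing a stroke, so the
-- contents to the left of the head do not matter.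

Counts : Tape → ℕ → Set
Counts t n = ∃[ r ] after t ≡ replicate n 1 ++ r × first r ≡ 0

Counts-number : ∀ {t n} → Counts t n → number t ≡ n
Counts-number {tape l _} (r , refl , e) = go _ r e
  where
  go : ∀ n r → first r ≡ 0 → block (replicate n 1 ++ r) ≡ n
  go zero    []      e    = refl
  go zero    (_ ∷ _) refl = refl
  go (suc n) r       e    = cong suc (go n r e)

Counts-holding : ∀ n ns → Counts (holding (n ∷ ns)) n
Counts-holding n ns = _ , refl , refl

Counts-blank : Counts blank 0
Counts-blank = [] , refl , refl

Counts-inc : ∀ {t n} → Counts t n → Counts (perform (write 1) (perform left t)) (suc n)
Counts-inc {tape []      _} (r , refl , e) = r , refl , e
Counts-inc {tape (_ ∷ _) _} (r , refl , e) = r , refl , e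

Counts-dec : ∀ {t n} → Counts t (suc n) → Counts (perform right t) n
Counts-dec {tape _ _} (r , refl , e) = r , refl , e

Counts-write0 : ∀ {t} → Counts t 0 → Counts (perform (write 0) t) 0
Counts-write0 {tape _ r} _ = 0 ∷ drop 1 r , refl , refl

scanned-zero : ∀ {t} → Counts t 0 → scanned t ≡ 0
scanned-zero {tape _ _} (r , refl , e) = e

scanned-suc : ∀ {t n} → Counts t (suc n) → scanned t ≡ 1
scanned-suc {tape _ _} (r , refl , e) = refl

-- clamp w r is the index r, or w if r is too large.

clamp : ∀ w → ℕ → Fin (suc w)
clamp zero    _       = zero
clamp (suc w) zero    = zero
clamp (suc w) (suc r) = suc (clamp w r)

clamp-injective : ∀ w {r s} → r ≤ w → s ≤ w → clamp w r ≡ clamp w s → r ≡ s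
clamp-injective zero    z≤n       z≤n       _ = refl
clamp-injective (suc w) z≤n       z≤n       _ = refl
clamp-injective (suc w) (s≤s r≤w) (s≤s s≤w) e =
  cong suc (clamp-injective w r≤w s≤w (sucᶠ-injective e))

infix 30 _[_↦_]

opaque
  _[_↦_] : ∀ {A : Set} → (ℕ → A) → ℕ → A → ℕ → A
  (σ [ r ↦ v ]) s = if s ≡ᵇ r then v else σ s

  ↦-same : ∀ {A : Set} (σ : ℕ → A) r {v} → (σ [ r ↦ v ]) r ≡ v
  ↦-same σ r rewrite ≡ᵇ-refl r = refl

  ↦-other : ∀ {A : Set} (σ : ℕ → A) {r s v} → s ≢ r → (σ [ r ↦ v ]) s ≡ σ s
  ↦-other σ s≢r rewrite ≢⇒≡ᵇ-false s≢r = refl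

-- Counter programs for an oracle machine with w counters and a blank tape

module CounterCode (q w : ℕ) where

  Command = OracleCommand q (suc w)
  Test = Fin (suc w) × ℕ

  always : Test
  always = clamp w w , 0

  nop : Command
  nop = act (clamp w w) (write 0)

  inc : ℕ → Prog Test Command
  inc r = cmd (act (clamp w r) left) ⨾ cmd (act (clamp w r) (write 1))

  query : Fin q → ℕ → Prog Test Command
  query j r = cmd (ask j (clamp w r))

  loop : ℕ → Prog Test Command → Prog Test Command
  loop r P = while (clamp w r , 1) (cmd (act (clamp w r) right) ⨾ P)

  clear : ℕ → Prog Test Command
  clear r = loop r skip

  move : ℕ → ℕ → Prog Test Command
  move a b = clear b ⨾ loop a (inc b)

  -- copy a b uses b + 1 as a temporary.

  copy : ℕ → ℕ → Prog Test Command
  copy a b = clear b ⨾ clear (suc b) ⨾ loop a (inc b ⨾ inc (suc b)) ⨾ move (suc b) a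

module Counter {q : ℕ} (x : Vec 𝒩 q) (w : ℕ) where

  open CounterCode q w public

  Exec : Command → Vec Tape (suc w) → Vec Tape (suc w) → Set
  Exec c ts ts′ = ts′ ≡ execute x c ts

  open Compilation {Test} {Command} scans Exec always nop public

  State : Set
  State = ℕ → ℕ

  record Rep (σ : State) (ts : Vec Tape (suc w)) : Set where
    field
      counts : ∀ r → r < w → Counts (lookup ts (clamp w r)) (σ r)
      spare  : Counts (lookup ts (clamp w w)) 0

  open Rep

  always-holds : ∀ {σ ts} → Rep σ ts → scans ts always ≡ true
  always-holds {ts = ts} R rewrite scanned-zero {lookup ts (clamp w w)} (spare R) = refl

  Rep-update : ∀ {σ ts r v} f → r < w → Rep σ ts → Counts (f (lookup ts (clamp w r))) v →
               Rep (σ [ r ↦ v ]) (ts [ clamp w r ]%= f)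
  Rep-update {σ} {ts} {r} {v} f r<w R c .counts s s<w with s ≟ r
  ... | yes refl rewrite ↦-same σ r {v} | lookup∘updateAt (clamp w r) {f} ts = c
  ... | no s≢r
    rewrite ↦-other σ {v = v} s≢r
          | lookup∘updateAt′ (clamp w s) (clamp w r) {f}
              (λ e → s≢r (clamp-injective w (<⇒≤ s<w) (<⇒≤ r<w) e)) ts = counts R s s<w
  Rep-update {σ} {ts} {r} f r<w R c .spare
    rewrite lookup∘updateAt′ (clamp w w) (clamp w r) {f}
      (λ e → <⇒≢ r<w (sym (clamp-injective w ≤-refl (<⇒≤ r<w) e))) ts = spare R

  Rep-nop : ∀ {σ ts} → Rep σ ts → Rep σ (execute x nop ts)
  Rep-nop {σ} {ts} R .counts s s<w
    rewrite lookup∘updateAt′ (clamp w s) (clamp w w) {perform (write 0)}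
      (λ e → <⇒≢ s<w (clamp-injective w (<⇒≤ s<w) ≤-refl e)) ts = counts R s s<w
  Rep-nop {σ} {ts} R .spare
    rewrite lookup∘updateAt (clamp w w) {perform (write 0)} ts =
      Counts-write0 {lookup ts (clamp w w)} (spare R)

  infix 4 _⟨_⟩_

  -- Only the existence of a run is claimed. For oracle machines that is enough, because `Φ-unique`
  -- forces the same value on every other run.
  record _⟨_⟩_ (σ : State) (P : Prog Test Command) (τ : State) : Set where
    field
      runs : ∀ {ts} → Rep σ ts → ∃[ us ] Run P ts us × Rep τ us

  open _⟨_⟩_ public

  ⟨skip⟩ : ∀ {σ} → σ ⟨ skip ⟩ σ
  ⟨skip⟩ .runs R = _ , skip , R

  infixr 20 _⟨⨾⟩_

  _⟨⨾⟩_ : ∀ {σ τ υ P Q} → σ ⟨ P ⟩ τ → τ ⟨ Q ⟩ υ → σ ⟨ P ⨾ Q ⟩ υ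
  (p ⟨⨾⟩ q) .runs R with runs p R
  ... | _ , r , R₁ with runs q R₁
  ... | _ , r′ , R₂ = _ , r ⨾ r′ , R₂

  ⟨inc⟩ : ∀ {σ r} → r < w → σ ⟨ inc r ⟩ σ [ r ↦ suc (σ r) ]
  ⟨inc⟩ {σ} {r} r<w .runs {ts} R =
    _ , cmd (always-holds R) refl ⨾ cmd ah refl , subst (Rep _) eq R′
    where
    f = perform (write 1) ∘ perform left
    R′ = Rep-update f r<w R (Counts-inc {lookup ts (clamp w r)} (counts R r r<w))
    us = ts [ clamp w r ]%= perform left
    -- Between the two commands an arbitrary old symbol is under the head of tape `r`, so `Rep` may
    -- fail there; only the spare tape is looked at.
    ah : scans us always ≡ true
    ah rewrite lookup∘updateAt′ (clamp w w) (clamp w r) {perform left}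
      (λ e → <⇒≢ r<w (sym (clamp-injective w ≤-refl (<⇒≤ r<w) e))) ts = always-holds R
    eq : ts [ clamp w r ]%= f ≡ us [ clamp w r ]%= perform (write 1)
    eq = sym (updateAt-updateAt (clamp w r) ts)

  ⟨query⟩ : ∀ {σ r} j → r < w → σ ⟨ query j r ⟩ σ [ r ↦ lookup x j (σ r) ]
  ⟨query⟩ {σ} {r} j r<w .runs {ts} R =
    _ , cmd (always-holds R) refl ,
    Rep-update (λ u → holding (lookup x j (number u) ∷ [])) r<w R
      (subst (λ n → Counts (holding (lookup x j n ∷ [])) (lookup x j (σ r)))
        (sym (Counts-number {lookup ts (clamp w r)} (counts R r r<w)))
        (Counts-holding (lookup x j (σ r)) []))

  ⟨loop⟩-stop : ∀ {σ r P} → r < w → σ r ≡ 0 → σ ⟨ loop r P ⟩ σ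
  ⟨loop⟩-stop {σ} {r} r<w σr≡0 .runs {ts} R =
    _ , stop no-stroke (always-holds R) refl , Rep-nop R
    where
    no-stroke : scans ts (clamp w r , 1) ≡ false
    no-stroke rewrite scanned-zero {lookup ts (clamp w r)}
      (subst (Counts (lookup ts (clamp w r))) σr≡0 (counts R r r<w)) = refl

  ⟨loop⟩-go : ∀ {σ τ υ r n P} → r < w → σ r ≡ suc n → σ [ r ↦ n ] ⟨ P ⟩ τ →
              τ ⟨ loop r P ⟩ υ → σ ⟨ loop r P ⟩ υ
  ⟨loop⟩-go {σ} {r = r} {n} r<w σr≡ p l .runs {ts} R
    with runs p (Rep-update (perform right) r<w (Rep-nop R) dec)
    where
    t = lookup (execute x nop ts) (clamp w r)
    dec : Counts (perform right t) n
    dec = Counts-dec {t} (subst (Counts t) σr≡ (counts (Rep-nop R) r r<w))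
  ... | _ , run , R₁ with runs l (Rep-nop R₁)
  ... | _ , run′ , R₂ =
    _ , go stroke refl (cmd (always-holds (Rep-nop R)) refl ⨾ run) (always-holds R₁) refl run′ , R₂
    where
    stroke : scans ts (clamp w r , 1) ≡ true
    stroke rewrite scanned-suc {lookup ts (clamp w r)}
      (subst (Counts (lookup ts (clamp w r))) σr≡ (counts R r r<w)) = refl

  ⟨loop⟩ : ∀ {r P} (I : ℕ → State → Set) → r < w → (∀ {n σ} → I n σ → σ r ≡ n) →
           (∀ {n σ} → I (suc n) σ → ∃[ τ ] σ [ r ↦ n ] ⟨ P ⟩ τ × I n τ) →
           ∀ {n σ} → I n σ → ∃[ τ ] σ ⟨ loop r P ⟩ τ × I 0 τ
  ⟨loop⟩ I r<w Ir body {zero}  i = _ , ⟨loop⟩-stop r<w (Ir i) , i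
  ⟨loop⟩ I r<w Ir body {suc n} i with body i
  ... | _ , p , i′ with ⟨loop⟩ I r<w Ir body i′
  ... | _ , l , i″ = _ , ⟨loop⟩-go r<w (Ir i) p l , i″

  ⟨clear⟩ : ∀ {σ r} → r < w →
            ∃[ τ ] σ ⟨ clear r ⟩ τ × τ r ≡ 0 × (∀ s → s ≢ r → τ s ≡ σ s)
  ⟨clear⟩ {σ} {r} r<w = ⟨loop⟩ I r<w proj₁ body (refl , λ _ _ → refl)
    where
    I : ℕ → State → Set
    I n τ = τ r ≡ n × (∀ s → s ≢ r → τ s ≡ σ s)
    body : ∀ {n τ} → I (suc n) τ → ∃[ υ ] τ [ r ↦ n ] ⟨ skip ⟩ υ × I n υ
    body {n} {τ} (_ , fr) = _ , ⟨skip⟩ , ↦-same τ r , λ s s≢r → trans (↦-other τ s≢r) (fr s s≢r)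

  ⟨move⟩ : ∀ {σ a b} → a < w → b < w → a ≢ b →
           ∃[ τ ] σ ⟨ move a b ⟩ τ × τ b ≡ σ a × (∀ s → s ≢ a → s ≢ b → τ s ≡ σ s)
  ⟨move⟩ {σ} {a} {b} a<w b<w a≢b with ⟨clear⟩ {σ} b<w
  ... | σ′ , clr , σ′b , fr
    with ⟨loop⟩ I a<w proj₁ body {σ a} {σ′} (fr a a≢b , cong (_+ σ a) σ′b , λ s _ s≢b → fr s s≢b)
    where
    I : ℕ → State → Set
    I n τ = τ a ≡ n × τ b + n ≡ σ a × (∀ s → s ≢ a → s ≢ b → τ s ≡ σ s)
    body : ∀ {n τ} → I (suc n) τ → ∃[ υ ] τ [ a ↦ n ] ⟨ inc b ⟩ υ × I n υ
    body {n} {τ} (_ , s , fr) = _ , ⟨inc⟩ b<w ,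
      trans (↦-other _ a≢b) (↦-same τ a) ,
      trans (cong (_+ n) (trans (↦-same _ b) (cong suc (↦-other τ (≢-sym a≢b)))))
            (trans (sym (+-suc (τ b) n)) s) ,
      λ s s≢a s≢b → trans (↦-other _ s≢b) (trans (↦-other τ s≢a) (fr s s≢a s≢b))
  ... | τ , lp , _ , τb , fr′ = τ , clr ⟨⨾⟩ lp , trans (sym (+-identityʳ (τ b))) τb , fr′

  ⟨copy⟩ : ∀ {σ a b} → a < b → suc b < w →
           ∃[ τ ] σ ⟨ copy a b ⟩ τ × τ b ≡ σ a × (∀ s → s < b → τ s ≡ σ s)
  ⟨copy⟩ {σ} {a} {b} a<b b<w with ⟨clear⟩ {σ} {b} (<⇒≤ b<w)
  ... | σ₁ , c₁ , z₁ , f₁ with ⟨clear⟩ {σ₁} {suc b} b<w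
  ... | σ₂ , c₂ , z₂ , f₂
    with ⟨loop⟩ I (<-trans a<b (<⇒≤ b<w)) proj₁ body {σ a} {σ₂} start
    where
    a≢b : a ≢ b
    a≢b = <⇒≢ a<b
    a≢b′ : a ≢ suc b
    a≢b′ = <⇒≢ (<-trans a<b (n<1+n b))
    I : ℕ → State → Set
    I n τ = τ a ≡ n × τ b + n ≡ σ a × τ (suc b) + n ≡ σ a × (∀ s → s < b → s ≢ a → τ s ≡ σ s)
    start : I (σ a) σ₂
    start = trans (f₂ a a≢b′) (f₁ a a≢b) ,
      cong (_+ σ a) (trans (f₂ b (<⇒≢ (n<1+n b))) z₁) , cong (_+ σ a) z₂ ,
      λ s s<b _ → trans (f₂ s (<⇒≢ (<-trans s<b (n<1+n b)))) (f₁ s (<⇒≢ s<b))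
    body : ∀ {n τ} → I (suc n) τ → ∃[ υ ] τ [ a ↦ n ] ⟨ inc b ⨾ inc (suc b) ⟩ υ × I n υ
    body {n} {τ} (_ , s , s′ , fr) = _ , ⟨inc⟩ (<⇒≤ b<w) ⟨⨾⟩ ⟨inc⟩ b<w ,
      trans (↦-other _ a≢b′) (trans (↦-other _ a≢b) (↦-same τ a)) ,
      trans (cong (_+ n) (trans (↦-other _ (<⇒≢ (n<1+n b))) (trans (↦-same _ b)
              (cong suc (↦-other τ (≢-sym a≢b))))))
            (trans (sym (+-suc (τ b) n)) s) ,
      trans (cong (_+ n) (trans (↦-same _ (suc b)) (cong suc
              (trans (↦-other _ (≢-sym (<⇒≢ (n<1+n b)))) (↦-other τ (≢-sym a≢b′))))))
            (trans (sym (+-suc (τ (suc b)) n)) s′) ,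
      λ s s<b s≢a → trans (↦-other _ (<⇒≢ (<-trans s<b (n<1+n b))))
        (trans (↦-other _ (<⇒≢ s<b)) (trans (↦-other τ s≢a) (fr s s<b s≢a)))
  ... | σ₃ , lp , _ , τb , τb′ , f₃
    with ⟨move⟩ {σ₃} {suc b} {a} b<w (<-trans a<b (<⇒≤ b<w)) (≢-sym (<⇒≢ (<-trans a<b (n<1+n b))))
  ... | σ₄ , mv , σ₄a , f₄ =
    σ₄ , c₁ ⟨⨾⟩ c₂ ⟨⨾⟩ lp ⟨⨾⟩ mv ,
    trans (f₄ b (<⇒≢ (n<1+n b)) (≢-sym (<⇒≢ a<b))) (trans (sym (+-identityʳ _)) τb) , frame
    where
    frame : ∀ s → s < b → σ₄ s ≡ σ s
    -- Register `a` was emptied by the loop and is refilled from `b + 1`.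
    frame s s<b with s ≟ a
    ... | yes refl = trans σ₄a (trans (sym (+-identityʳ _)) τb′)
    ... | no s≢a   = trans (f₄ s (<⇒≢ (<-trans s<b (n<1+n b))) s≢a) (f₃ s s<b s≢a)

-- A term is compiled with its arguments in registers below f, its result in
-- register f and scratch registers from f + 1 up to top t f.

top  : ∀ {q n} → PR q n → ℕ → ℕ
tops : ∀ {q m n} → Vec (PR q n) m → ℕ → ℕ

-- Copying into `f` uses `f + 1` as its temporary.
top (var i)          f = 2 + f
top zero             f = suc f
top (suc t)          f = top t f
top (ask j t)        f = top t f
top (app {m} t ts)   f = tops ts (suc f) ⊔ top t (m + suc f)
top (rec b s)        f = top b f ⊔ top s (3 + f)

tops []       f = f
tops (t ∷ ts) f = top t f ⊔ tops ts (suc f)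

top-> : ∀ {q n} (t : PR q n) f → f < top t f
top-> (var i)   f = n≤1+n _
top-> zero      f = ≤-refl
top-> (suc t)   f = top-> t f
top-> (ask j t) f = top-> t f
top-> (app {m} t ts) f =
  ≤-trans (s≤s (≤-trans (n≤1+n f) (m≤n+m (suc f) m)))
          (≤-trans (top-> t (m + suc f)) (m≤n⊔m (tops ts (suc f)) _))
top-> (rec b s) f = ≤-trans (top-> b f) (m≤m⊔n _ _)

regs : ℕ → ∀ m → Vec ℕ m
regs f zero    = []
regs f (suc m) = f ∷ regs (suc f) m

regs-< : ∀ f m i → lookup (regs f m) i < m + f
regs-< f (suc m) zero    = s≤s (m≤n+m f m)
regs-< f (suc m) (suc i) = subst (lookup (regs (suc f) m) i <_) (+-suc m f) (regs-< (suc f) m i)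

map-cong-lookup : ∀ {A B : Set} {n} (f g : A → B) (as : Vec A n) →
                  (∀ i → f (lookup as i) ≡ g (lookup as i)) → mapᵛ f as ≡ mapᵛ g as
map-cong-lookup f g []       e = refl
map-cong-lookup f g (a ∷ as) e = cong₂ _∷_ (e zero) (map-cong-lookup f g as (e ∘ suc))

module TermCode (q w : ℕ) where

  open CounterCode q w

  compile  : ∀ {n} → PR q n → Vec ℕ n → ℕ → Prog Test Command
  compiles : ∀ {m n} → Vec (PR q n) m → Vec ℕ n → ℕ → Prog Test Command

  compile (var i)        as       f = copy (lookup as i) f
  compile zero           as       f = clear f
  compile (suc t)        as       f = compile t as f ⨾ inc f
  compile (ask j t)      as       f = compile t as f ⨾ query j f
  compile (app {m} t ts) as       f =
    compiles ts as (suc f) ⨾ compile t (regs (suc f) m) (m + suc f) ⨾ move (m + suc f) f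
  -- Register `f` accumulates, `f + 1` holds the rounds left and `f + 2` the number of the round;
  -- the step is evaluated into `f + 3`. The clearing comes after the copy, whose temporary is
  -- `f + 2`.
  compile (rec b s)      (a ∷ as) f =
    compile b as f ⨾ copy a (1 + f) ⨾ clear (2 + f) ⨾
    loop (1 + f) (compile s (2 + f ∷ f ∷ as) (3 + f) ⨾ move (3 + f) f ⨾ inc (2 + f))

  compiles []       as f = skip
  compiles (t ∷ ts) as f = compile t as f ⨾ compiles ts as (suc f)

module TermCompilation {q : ℕ} (x : Vec 𝒩 q) (w : ℕ) where

  open Counter x w
  open TermCode q w public

  frame-map : ∀ {n} {σ τ : State} (as : Vec ℕ n) {f} → (∀ i → lookup as i < f) →
              (∀ r → r < f → τ r ≡ σ r) → mapᵛ τ as ≡ mapᵛ σ as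
  frame-map as as<f fr = map-cong-lookup _ _ as λ i → fr _ (as<f i)

  Outcome : ∀ {n} → PR q n → Vec ℕ n → ℕ → State → Set
  Outcome t as f σ = ∃[ τ ] σ ⟨ compile t as f ⟩ τ × τ f ≡ eval t x (mapᵛ σ as) ×
                            (∀ r → r < f → τ r ≡ σ r)

  module _ {n} (b : PR q n) (s : PR q (2 + n)) (a : ℕ) (as : Vec ℕ n) (f : ℕ)
           (as<f : ∀ i → lookup (a ∷ as) i < f) (3+f<w : 3 + f < w) where

    private
      f₁ f₂ f₃ : ℕ
      f₁ = suc f
      f₂ = suc f₁
      f₃ = suc f₂
      0<1 : f < f₁
      0<1 = n<1+n f
      1<2 : f₁ < f₂
      1<2 = n<1+n f₁
      2<3 : f₂ < f₃
      2<3 = n<1+n f₂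
      0<2 : f < f₂
      0<2 = <-trans 0<1 1<2
      1<3 : f₁ < f₃
      1<3 = <-trans 1<2 2<3
      0<3 : f < f₃
      0<3 = <-trans 0<2 2<3
      2<w : f₂ < w
      2<w = <-trans 2<3 3+f<w
      1<w : f₁ < w
      1<w = <-trans 1<2 2<w
      0<w : f < w
      0<w = <-trans 0<1 1<w

      recBody : Prog Test Command
      recBody = compile s (f₂ ∷ f ∷ as) f₃ ⨾ move f₃ f ⨾ inc f₂

      F : State → ℕ → ℕ
      F σ = natrec (eval b x (mapᵛ σ as)) (λ i acc → eval s x (i ∷ acc ∷ mapᵛ σ as))

      Inv : State → ℕ → State → Set
      Inv σ n τ = τ f₁ ≡ n × τ f₂ + n ≡ σ a × τ f ≡ F σ (τ f₂) × (∀ r → r < f → τ r ≡ σ r)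

      rec-body : (∀ σ → Outcome s (f₂ ∷ f ∷ as) f₃ σ) →
                 ∀ σ {n τ} → Inv σ (suc n) τ →
                 ∃[ υ ] τ [ f₁ ↦ n ] ⟨ recBody ⟩ υ × Inv σ n υ
      rec-body outcome σ {n} {τ} (_ , e , eF , fr) with outcome (τ [ f₁ ↦ n ])
      ... | τ₁ , q₁ , u₁ , g₁ with ⟨move⟩ {τ₁} {f₃} {f} 3+f<w 0<w (≢-sym (<⇒≢ 0<3))
      ... | τ₂ , q₂ , u₂ , g₂ = τ₃ , q₁ ⟨⨾⟩ q₂ ⟨⨾⟩ ⟨inc⟩ 2<w ,
        trans (↦-other τ₂ (<⇒≢ 1<2))
          (trans (g₂ f₁ (<⇒≢ 1<3) (≢-sym (<⇒≢ 0<1))) (trans (g₁ f₁ 1<3) (↦-same τ f₁))) ,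
        trans (cong (_+ n) k′) (trans (sym (+-suc (τ f₂) n)) e) ,
        trans (↦-other τ₂ (<⇒≢ 0<2)) (trans u₂ (trans u₁ (trans step-F (cong (F σ) (sym k′))))) ,
        frame
        where
        τ₃ : State
        τ₃ = τ₂ [ f₂ ↦ suc (τ₂ f₂) ]
        k≡ : (τ [ f₁ ↦ n ]) f₂ ≡ τ f₂
        k≡ = ↦-other τ (≢-sym (<⇒≢ 1<2))
        k′ : τ₃ f₂ ≡ suc (τ f₂)
        k′ = trans (↦-same τ₂ f₂) (cong suc
          (trans (g₂ f₂ (<⇒≢ 2<3) (≢-sym (<⇒≢ 0<2))) (trans (g₁ f₂ 2<3) k≡)))
        frame₁ : ∀ r → r < f → (τ [ f₁ ↦ n ]) r ≡ σ r
        frame₁ r r<f = trans (↦-other τ (<⇒≢ (<-trans r<f 0<1))) (fr r r<f)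
        frame : ∀ r → r < f → τ₃ r ≡ σ r
        frame r r<f = trans (↦-other τ₂ (<⇒≢ (<-trans r<f 0<2)))
          (trans (g₂ r (<⇒≢ (<-trans r<f 0<3)) (<⇒≢ r<f))
            (trans (g₁ r (<-trans r<f 0<3)) (frame₁ r r<f)))
        step-F : eval s x (mapᵛ (τ [ f₁ ↦ n ]) (f₂ ∷ f ∷ as)) ≡ F σ (suc (τ f₂))
        step-F = cong (eval s x) (cong₂ _∷_ k≡ (cong₂ _∷_
          (trans (↦-other τ (<⇒≢ 0<1)) eF)
          (frame-map as (as<f ∘ suc) frame₁)))

    private
      rec-loop : (∀ σ → Outcome s (f₂ ∷ f ∷ as) f₃ σ) → ∀ σ {τ} → Inv σ (σ a) τ →
                 ∃[ υ ] τ ⟨ loop f₁ recBody ⟩ υ × Inv σ 0 υ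
      rec-loop outcome σ = ⟨loop⟩ {f₁} {recBody} (Inv σ) 1<w (λ i → proj₁ i)
                             (λ {n} {τ} → rec-body outcome σ {n} {τ})

    ⟨rec⟩ : ∀ {σ} → Outcome b as f σ → (∀ τ → Outcome s (f₂ ∷ f ∷ as) f₃ τ) →
            Outcome (rec b s) (a ∷ as) f σ
    ⟨rec⟩ {σ} (σ₁ , p₁ , e₁ , g₁) outcome =
      copied (⟨copy⟩ {σ₁} {a} {f₁} (<-trans (as<f zero) 0<1) 2<w)
      where
      cleared : ∀ {σ₂} → σ₁ ⟨ copy a f₁ ⟩ σ₂ → σ₂ f₁ ≡ σ₁ a → (∀ r → r < f₁ → σ₂ r ≡ σ₁ r) →
                ∃[ τ ] σ₂ ⟨ clear f₂ ⟩ τ × τ f₂ ≡ 0 × (∀ r → r ≢ f₂ → τ r ≡ σ₂ r) →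
                Outcome (rec b s) (a ∷ as) f σ
      cleared {σ₂} p₂ e₂ g₂ (σ₃ , p₃ , e₃ , g₃) = looped (rec-loop outcome σ {σ₃} start)
        where
        start : Inv σ (σ a) σ₃
        start = trans (g₃ f₁ (<⇒≢ 1<2)) (trans e₂ (g₁ a (as<f zero))) ,
          cong (_+ σ a) e₃ ,
          trans (g₃ f (<⇒≢ 0<2)) (trans (g₂ f 0<1) (trans e₁ (cong (F σ) (sym e₃)))) ,
          λ r r<f → trans (g₃ r (<⇒≢ (<-trans r<f 0<2))) (trans (g₂ r (<-trans r<f 0<1)) (g₁ r r<f))
        looped : ∃[ υ ] σ₃ ⟨ loop f₁ recBody ⟩ υ × Inv σ 0 υ → Outcome (rec b s) (a ∷ as) f σ
        looped (σ₄ , p₄ , _ , e₄ , eF , g₄) = σ₄ , p₁ ⟨⨾⟩ p₂ ⟨⨾⟩ p₃ ⟨⨾⟩ p₄ ,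
          trans eF (cong (F σ) (trans (sym (+-identityʳ (σ₄ f₂))) e₄)) , g₄
      copied : (∃[ τ ] σ₁ ⟨ copy a f₁ ⟩ τ × τ f₁ ≡ σ₁ a × (∀ r → r < f₁ → τ r ≡ σ₁ r)) →
               Outcome (rec b s) (a ∷ as) f σ
      copied (σ₂ , p₂ , e₂ , g₂) = cleared p₂ e₂ g₂ (⟨clear⟩ {σ₂} {f₂} 2<w)

  ⟨compile⟩ : ∀ {n σ} (t : PR q n) as f → (∀ i → lookup as i < f) → top t f ≤ w →
              Outcome t as f σ
  ⟨compiles⟩ : ∀ {m n σ} (ts : Vec (PR q n) m) as f → (∀ i → lookup as i < f) → tops ts f ≤ w →
               ∃[ τ ] σ ⟨ compiles ts as f ⟩ τ ×
                      mapᵛ τ (regs f m) ≡ evals ts x (mapᵛ σ as) × (∀ r → r < f → τ r ≡ σ r)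

  ⟨compile⟩ {σ = σ} (var i) as f as<f f≤w =
    case ⟨copy⟩ {σ} (as<f i) f≤w of λ where
      (τ , p , τf , fr) → τ , p , trans τf (sym (lookup-map i σ as)) , fr
  ⟨compile⟩ {σ = σ} zero as f as<f f≤w =
    case ⟨clear⟩ {σ} f≤w of λ where
      (τ , p , τf , fr) → τ , p , τf , λ r r<f → fr r (<⇒≢ r<f)
  ⟨compile⟩ {σ = σ} (suc t) as f as<f f≤w =
    case ⟨compile⟩ {σ = σ} t as f as<f f≤w of λ where
      (τ , p , τf , fr) → _ , p ⟨⨾⟩ ⟨inc⟩ (≤-trans (top-> t f) f≤w) ,
        trans (↦-same τ f) (cong suc τf) , λ r r<f → trans (↦-other τ (<⇒≢ r<f)) (fr r r<f)
  ⟨compile⟩ {σ = σ} (ask j t) as f as<f f≤w =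
    case ⟨compile⟩ {σ = σ} t as f as<f f≤w of λ where
      (τ , p , τf , fr) → _ , p ⟨⨾⟩ ⟨query⟩ j (≤-trans (top-> t f) f≤w) ,
        trans (↦-same τ f) (cong (lookup x j) τf) ,
        λ r r<f → trans (↦-other τ (<⇒≢ r<f)) (fr r r<f)
  ⟨compile⟩ {σ = σ} (app {m} t ts) as f as<f f≤w =
    case ⟨compiles⟩ {σ = σ} ts as (suc f) (λ i → <-trans (as<f i) (n<1+n f))
           (m⊔n≤o⇒m≤o _ _ f≤w) of λ where
      (σ₁ , p₁ , e₁ , f₁) →
        case ⟨compile⟩ {σ = σ₁} t (regs (suc f) m) (m + suc f) (regs-< (suc f) m) t≤w of λ where
          (σ₂ , p₂ , e₂ , f₂) →
            case ⟨move⟩ {σ₂} {m + suc f} {f} (≤-trans (top-> t _) t≤w)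
                   (≤-trans (top-> (app t ts) f) f≤w) (≢-sym (<⇒≢ (m≤n+m (suc f) m))) of λ where
              (σ₃ , p₃ , e₃ , f₃) → σ₃ , p₁ ⟨⨾⟩ p₂ ⟨⨾⟩ p₃ ,
                trans e₃ (trans e₂ (cong (eval t x) e₁)) ,
                λ r r<f → trans (f₃ r (<⇒≢ (r<′ r<f)) (<⇒≢ r<f))
                  (trans (f₂ r (r<′ r<f)) (f₁ r (<-trans r<f (n<1+n f))))
    where
    t≤w : top t (m + suc f) ≤ w
    t≤w = m⊔n≤o⇒n≤o (tops ts (suc f)) _ f≤w
    r<′ : ∀ {r} → r < f → r < m + suc f
    r<′ r<f = <-≤-trans (<-trans r<f (n<1+n f)) (m≤n+m (suc f) m)
  ⟨compile⟩ {σ = σ} (rec b s) (a ∷ as) f as<f f≤w =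
    ⟨rec⟩ b s a as f as<f (≤-trans (top-> s (3 + f)) s≤w)
      (⟨compile⟩ {σ = σ} b as f (as<f ∘ suc) (m⊔n≤o⇒m≤o _ _ f≤w))
      (λ τ → ⟨compile⟩ {σ = τ} s (2 + f ∷ f ∷ as) (3 + f)
        (λ { zero → n<1+n (2 + f) ; (suc zero) → m≤n+m (suc f) 2
           ; (suc (suc i)) → ≤-trans (as<f (suc i)) (m≤n+m f 3) }) s≤w)
    where
    s≤w : top s (3 + f) ≤ w
    s≤w = m⊔n≤o⇒n≤o (top b f) _ f≤w

  ⟨compiles⟩ [] as f as<f f≤w = _ , ⟨skip⟩ , refl , λ _ _ → refl
  ⟨compiles⟩ {suc m} {σ = σ} (t ∷ ts) as f as<f f≤w =
    case ⟨compile⟩ {σ = σ} t as f as<f (m⊔n≤o⇒m≤o _ _ f≤w) of λ where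
      (σ₁ , p₁ , e₁ , f₁) →
        case ⟨compiles⟩ {σ = σ₁} ts as (suc f) (λ i → <-trans (as<f i) (n<1+n f))
               (m⊔n≤o⇒n≤o (top t f) _ f≤w) of λ where
          (σ₂ , p₂ , e₂ , f₂) → σ₂ , p₁ ⟨⨾⟩ p₂ ,
            cong₂ _∷_ (trans (f₂ f (n<1+n f)) e₁)
                      (trans e₂ (cong (evals ts x) (frame-map as as<f f₁))) ,
            λ r r<f → trans (f₂ r (<-trans r<f (n<1+n f))) (f₁ r r<f)

module _ {q : ℕ} (t : PR q 1) where

  private
    w = top t 1

  open CounterCode q w
  open TermCode q w
  open Code {Fin (suc w) × ℕ} {OracleCommand q (suc w)} always nop using (programOf)

  -- The first tape, register 0, carries both the input and the output, so the result is formed in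
  -- register 1 and moved back.
  termProgram : Prog Test Command
  termProgram = compile t (0 ∷ []) 1 ⨾ move 1 0

  termMachine : OracleMachine q
  termMachine = oracleMachine w (programOf termProgram)

  termMachine-computes : ∀ x i → OracleMachineComputes termMachine x i (eval t x (i ∷ []))
  termMachine-computes x i =
    case ⟨compile⟩ {σ = σ} t (0 ∷ []) 1 (λ { zero → s≤s z≤n }) ≤-refl of λ where
      (σ₁ , p₁ , e₁ , _) →
        case ⟨move⟩ {σ₁} {1} {0} (top-> t 1) 0<w (λ ()) of λ where
          (σ₂ , p₂ , e₂ , _) → finish (σ₂ , p₁ ⟨⨾⟩ p₂ , trans e₂ e₁)
    where
    open Counter x w using (State; Rep; _⟨_⟩_; runs; _⟨⨾⟩_; ⟨move⟩; Step; step; run⇒halts;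
                            always-holds; Rep-nop)
    open TermCompilation x w using (⟨compile⟩)
    0<w : 0 < w
    0<w = <-trans (n<1+n 0) (top-> t 1)
    σ : State
    σ zero    = i
    σ (suc _) = 0
    ts : Vec Tape (suc w)
    ts = holding (i ∷ []) ∷ replicateᵛ w blank
    clamp-0 : ∀ w → clamp w 0 ≡ zero
    clamp-0 zero    = refl
    clamp-0 (suc w) = refl
    blanks : ∀ {w} r → 0 < r → 0 < w →
             lookup (holding (i ∷ []) ∷ replicateᵛ w blank) (clamp w r) ≡ blank
    blanks {suc w} (suc r) _ _ = lookup-replicate (clamp w r) blank
    rep : Rep σ ts
    rep .Rep.counts zero    _ rewrite clamp-0 w = Counts-holding i []
    rep .Rep.counts (suc r) _ rewrite blanks (suc r) (s≤s z≤n) 0<w = Counts-blank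
    rep .Rep.spare rewrite blanks w 0<w 0<w = Counts-blank
    oracle-step : ∀ {ρs c d} → Step ρs c d → oracleStep x ρs c ≡ just d
    oracle-step (step ap refl) rewrite ap = refl
    finish : (∃[ τ ] σ ⟨ termProgram ⟩ τ × τ 0 ≡ eval t x (i ∷ [])) →
             OracleMachineComputes termMachine x i (eval t x (i ∷ []))
    finish (τ , p , e) = case runs p rep of λ where
        (us , run , R) → execute x nop us ,
          gmap id oracle-step (run⇒halts {termProgram} run (always-holds R) refl) ,
          trans (sym e) (sym (number-head (Rep-nop R)))
      where
      number-head : ∀ {us} → Rep τ us → number (head us) ≡ τ 0
      number-head {u ∷ us} R =
        Counts-number {u} (subst (λ j → Counts (lookup (u ∷ us) j) (τ 0)) (clamp-0 w)
          (Rep.counts R 0 0<w))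

-- The enumeration of oracle machines

-- `unpair` walks along the antidiagonals x + y = s, with y ascending from 0 to s. The walk enters
-- the antidiagonal s at the triangular number of s, which gives the closed form `pair` for its
-- inverse.
triangle : ℕ → ℕ
triangle zero    = 0
triangle (suc s) = suc s + triangle s

opaque
  pair : ℕ → ℕ → ℕ
  pair x y = y + triangle (x + y)

  pair-≡ : ∀ x y → pair x y ≡ y + triangle (x + y)
  pair-≡ x y = refl

  unpair-pair : ∀ x y → unpair (pair x y) ≡ (x , y)
  unpair-pair x y = go (x + y) x y refl
    where
    go : ∀ s x y → x + y ≡ s → unpair (y + triangle s) ≡ (x , y)
    go zero    zero    zero    refl = refl
    -- The first point of an antidiagonal follows (0, s), the last point of the one before.
    go (suc s) (suc x) zero    eq
      rewrite go s zero s refl | suc-injective (trans (sym (+-identityʳ (suc x))) eq) = refl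
    go s       x       (suc y) eq rewrite go s (suc x) y (trans (sym (+-suc x y)) eq) = refl

  pair-unpair : ∀ n → pair (proj₁ (unpair n)) (proj₂ (unpair n)) ≡ n
  pair-unpair zero = refl
  pair-unpair (suc n) with unpair n | pair-unpair n
  ... | zero  , y | eq = trans (cong (λ z → suc (z + triangle z)) (+-identityʳ y)) (cong suc eq)
  ... | suc x , y | eq = cong suc (trans (cong (λ s → y + triangle s) (+-suc x y)) eq)

encodeList : List ℕ → ℕ
encodeList []       = 0
encodeList (n ∷ ns) = pair n (encodeList ns)

decodeList-encodeList : ∀ ns → decodeList (lengthᴸ ns) (encodeList ns) ≡ ns
decodeList-encodeList []       = refl
decodeList-encodeList (n ∷ ns) rewrite unpair-pair n (encodeList ns) =
  cong (n ∷_) (decodeList-encodeList ns)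

decodeFin-toℕ : ∀ {n} (i : Fin n) → decodeFin n (toℕ i) ≡ just i
decodeFin-toℕ {n} i with toℕ i <? n
... | yes i<n = cong just (fromℕ<-toℕ i i<n)
... | no ¬i<n = ⊥-elim (¬i<n (toℕ<n i))

module _ {q k : ℕ} where

  encodeCommand : OracleCommand q k → ℕ
  encodeCommand (act t (write s)) = pair 0 (pair (toℕ t) s)
  encodeCommand (act t left)      = pair 1 (pair (toℕ t) 0)
  encodeCommand (act t right)     = pair 2 (pair (toℕ t) 0)
  encodeCommand (ask j t)         = pair 3 (pair (toℕ j) (toℕ t))

  decode-encodeCommand : ∀ c → decodeCommand q k (encodeCommand c) ≡ just c
  decode-encodeCommand (act t (write s))
    rewrite unpair-pair 0 (pair (toℕ t) s) | unpair-pair (toℕ t) s | decodeFin-toℕ t = refl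
  decode-encodeCommand (act t left)
    rewrite unpair-pair 1 (pair (toℕ t) 0) | unpair-pair (toℕ t) 0 | decodeFin-toℕ t = refl
  decode-encodeCommand (act t right)
    rewrite unpair-pair 2 (pair (toℕ t) 0) | unpair-pair (toℕ t) 0 | decodeFin-toℕ t = refl
  decode-encodeCommand (ask j t)
    rewrite unpair-pair 3 (pair (toℕ j) (toℕ t)) | unpair-pair (toℕ j) (toℕ t)
          | decodeFin-toℕ j | decodeFin-toℕ t = refl

  encodeRule : OracleRule q k → ℕ
  encodeRule (rule s (t , u) c s′) =
    pair (pair s s′) (pair (pair (toℕ t) u) (encodeCommand c))

  decode-encodeRule : ∀ ρ → decodeRule q k (encodeRule ρ) ≡ just ρ
  decode-encodeRule (rule s (t , u) c s′)
    rewrite unpair-pair (pair s s′) (pair (pair (toℕ t) u) (encodeCommand c))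
          | unpair-pair s s′ | unpair-pair (pair (toℕ t) u) (encodeCommand c)
          | unpair-pair (toℕ t) u | decodeFin-toℕ t | decode-encodeCommand c = refl

encodeMachine : ∀ {q} → OracleMachine q → ℕ
encodeMachine (oracleMachine w ρs) =
  pair w (pair (lengthᴸ (map encodeRule ρs)) (encodeList (map encodeRule ρs)))

machine-encodeMachine : ∀ {q} (M : OracleMachine q) → machine q (encodeMachine M) ≡ M
machine-encodeMachine (oracleMachine w ρs)
  rewrite unpair-pair w (pair (lengthᴸ (map encodeRule ρs)) (encodeList (map encodeRule ρs)))
        | unpair-pair (lengthᴸ (map encodeRule ρs)) (encodeList (map encodeRule ρs))
        | decodeList-encodeList (map encodeRule ρs) = cong (oracleMachine w) (go ρs)
  where
  go : ∀ {q} (ρs : List (OracleRule q (suc w))) →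
       mapMaybe (decodeRule q (suc w)) (map encodeRule ρs) ≡ ρs
  go []       = refl
  go (ρ ∷ ρs) rewrite decode-encodeRule ρ = cong (ρ ∷_) (go ρs)

-- Opaque, because these codes are far too large to be computed.

opaque
  index : ∀ {q} → PR q 1 → ℕ
  index t = encodeMachine (termMachine t)

  Φ-index : ∀ {q} (t : PR q 1) x → Φω x (index t) (λ i → eval t x (i ∷ []))
  Φ-index t x i = subst (λ M → OracleMachineComputes M x i (eval t x (i ∷ [])))
    (sym (machine-encodeMachine (termMachine t))) (termMachine-computes t x i)

-- Arithmetic terms

bit : Bool → ℕ
bit b = if b then 1 else 0

pattern #0 = zero
pattern #1 = suc zero
pattern #2 = suc (suc zero)
pattern #3 = suc (suc (suc zero))

infixl 25 _+ᵗ_ _∸ᵗ_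
infix  24 _≡ᵗ_
infixr 23 _∧ᵗ_

opaque

  numᵗ : ∀ {q n} → ℕ → PR q n
  numᵗ zero    = zero
  numᵗ (suc k) = suc (numᵗ k)

  _+ᵗ_ _∸ᵗ_ _≡ᵗ_ _∧ᵗ_ : ∀ {q n} → PR q n → PR q n → PR q n
  ifᵗ_then_else_ : ∀ {q n} → PR q n → PR q n → PR q n → PR q n
  a +ᵗ b = app (rec (var #0) (suc (var #1))) (a ∷ b ∷ [])
  a ∸ᵗ b = app (rec (var #0) (app (rec zero (var #0)) (var #1 ∷ []))) (b ∷ a ∷ [])
  ifᵗ c then a else b = app (rec (var #1) (var #2)) (c ∷ a ∷ b ∷ [])
  a ≡ᵗ b = ifᵗ (a ∸ᵗ b) +ᵗ (b ∸ᵗ a) then numᵗ 0 else numᵗ 1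
  a ∧ᵗ b = ifᵗ a then b else numᵗ 0

module _ {q n} (x : Vec 𝒩 q) (ρ : Vec ℕ n) where

  opaque
    unfolding numᵗ _+ᵗ_ _∸ᵗ_ _≡ᵗ_ _∧ᵗ_ ifᵗ_then_else_

    eval-num : ∀ k → eval (numᵗ k) x ρ ≡ k
    eval-num zero    = refl
    eval-num (suc k) = cong suc (eval-num k)

    eval-+ : ∀ a b → eval (a +ᵗ b) x ρ ≡ eval a x ρ + eval b x ρ
    eval-+ a b = go (eval a x ρ)
      where
      go : ∀ k → natrec (eval b x ρ) (λ _ → suc) k ≡ k + eval b x ρ
      go zero    = refl
      go (suc k) = cong suc (go k)

    eval-∸ : ∀ a b → eval (a ∸ᵗ b) x ρ ≡ eval a x ρ ∸ eval b x ρ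
    eval-∸ a b = go (eval b x ρ)
      where
      pred-≡ : ∀ m → natrec 0 (λ i _ → i) m ≡ pred m
      pred-≡ zero    = refl
      pred-≡ (suc m) = refl
      go : ∀ k → natrec (eval a x ρ) (λ _ v → natrec 0 (λ i _ → i) v) k ≡ eval a x ρ ∸ k
      go zero    = refl
      go (suc k) = trans (pred-≡ (natrec (eval a x ρ) (λ _ v → natrec 0 (λ i _ → i) v) k))
        (trans (cong pred (go k)) (pred[m∸n]≡m∸[1+n] _ k))

    eval-if-zero : ∀ c a b → eval c x ρ ≡ 0 → eval (ifᵗ c then a else b) x ρ ≡ eval b x ρ
    eval-if-zero c a b e rewrite e = refl

    eval-if-suc : ∀ {k} c a b → eval c x ρ ≡ suc k →
                  eval (ifᵗ c then a else b) x ρ ≡ eval a x ρ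
    eval-if-suc c a b e rewrite e = refl

    eval-if-natrec : ∀ c a b → eval (ifᵗ c then a else b) x ρ ≡
                     natrec (eval b x ρ) (λ _ _ → eval a x ρ) (eval c x ρ)
    eval-if-natrec c a b = refl

    eval-if : ∀ c a b {β} → eval c x ρ ≡ bit β →
              eval (ifᵗ c then a else b) x ρ ≡ (if β then eval a x ρ else eval b x ρ)
    eval-if c a b {true}  e = eval-if-suc c a b e
    eval-if c a b {false} e = eval-if-zero c a b e

    eval-∧ : ∀ a b {α β} → eval a x ρ ≡ bit α → eval b x ρ ≡ bit β →
             eval (a ∧ᵗ b) x ρ ≡ bit (α ∧ β)
    eval-∧ a b {true}  e e′ = trans (eval-if-suc a b (numᵗ 0) e) e′
    eval-∧ a b {false} e e′ = eval-if-zero a b (numᵗ 0) e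

    eval-≡ : ∀ a b → eval (a ≡ᵗ b) x ρ ≡ bit (eval a x ρ ≡ᵇ eval b x ρ)
    eval-≡ a b = go (eval a x ρ) (eval b x ρ) (trans (eval-+ (a ∸ᵗ b) (b ∸ᵗ a))
        (cong₂ _+_ (eval-∸ a b) (eval-∸ b a)))
      where
      go : ∀ m n → eval ((a ∸ᵗ b) +ᵗ (b ∸ᵗ a)) x ρ ≡ (m ∸ n) + (n ∸ m) →
           eval (a ≡ᵗ b) x ρ ≡ bit (m ≡ᵇ n)
      go zero    zero    e = eval-if-zero ((a ∸ᵗ b) +ᵗ (b ∸ᵗ a)) (numᵗ 0) (numᵗ 1) e
      go zero    (suc n) e = eval-if-suc ((a ∸ᵗ b) +ᵗ (b ∸ᵗ a)) (numᵗ 0) (numᵗ 1) e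
      go (suc m) zero    e = eval-if-suc ((a ∸ᵗ b) +ᵗ (b ∸ᵗ a)) (numᵗ 0) (numᵗ 1) e
      go (suc m) (suc n) e = go m n e

natrec-cong : ∀ {b b′ s s′} → b ≡ b′ → (∀ k a → s k a ≡ s′ k a) →
              ∀ k → natrec b s k ≡ natrec b′ s′ k
natrec-cong b≡ s≡ zero    = b≡
natrec-cong {s′ = s′} b≡ s≡ (suc k) = trans (s≡ k _) (cong (s′ k) (natrec-cong b≡ s≡ k))

fst snd : ℕ → ℕ
fst n = proj₁ (unpair n)
snd n = proj₂ (unpair n)

-- `unpair` recurses on pairs of numbers, which a term cannot do directly. The number of the
-- antidiagonal can be carried along as one number, and it determines both components.
root : ℕ → ℕ
root = natrec 0 λ i s → if triangle (suc s) ≡ᵇ suc i then suc s else s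

root-unpair : ∀ n → root n ≡ fst n + snd n
root-unpair zero = refl
root-unpair (suc n) with unpair n | trans (sym (pair-≡ (fst n) (snd n)))
  (pair-unpair n) | root-unpair n
-- Here the antidiagonal ends, and `suc n` is the next triangular number.
... | zero  , y | eq | e rewrite e | eq | ≡ᵇ-refl n = cong suc (sym (+-identityʳ y))
-- The antidiagonal continues: y is below its number, so `suc n` falls short of the next triangular
-- number.
... | suc x , y | eq | e
  rewrite e | ≢⇒≡ᵇ-false {suc (suc (x + y) + triangle (suc (x + y)))} {suc n}
                (λ e′ → <⇒≢ (+-monoˡ-< (triangle (suc (x + y))) (s≤s (m≤n+m y x)))
                          (trans eq (suc-injective (sym e′)))) = sym (+-suc x y)

snd-root : ∀ n → n ∸ triangle (root n) ≡ snd n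
snd-root n = trans (cong₂ (λ m s → m ∸ triangle s)
                    (trans (sym (pair-unpair n)) (pair-≡ (fst n) (snd n))) (root-unpair n))
                   (m+n∸n≡m (snd n) (triangle (fst n + snd n)))

fst-root : ∀ n → root n ∸ snd n ≡ fst n
fst-root n = trans (cong (_∸ snd n) (root-unpair n)) (m+n∸n≡m (fst n) (snd n))

opaque

  triangleᵗ rootᵗ : ∀ {q n} → PR q n → PR q n
  triangleᵗ t = app (rec zero (suc (var #0) +ᵗ var #1)) (t ∷ [])
  rootᵗ t = app (rec zero (ifᵗ triangleᵗ (suc (var #1)) ≡ᵗ suc (var #0)
                           then suc (var #1) else var #1)) (t ∷ [])

  pairᵗ : ∀ {q n} → PR q n → PR q n → PR q n
  pairᵗ a b = b +ᵗ triangleᵗ (a +ᵗ b)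

  sndᵗ fstᵗ : ∀ {q n} → PR q n → PR q n
  sndᵗ t = t ∸ᵗ triangleᵗ (rootᵗ t)
  fstᵗ t = rootᵗ t ∸ᵗ sndᵗ t

module _ {q n} (x : Vec 𝒩 q) (ρ : Vec ℕ n) where

  opaque
    unfolding triangleᵗ pairᵗ

    eval-triangle : ∀ t → eval (triangleᵗ t) x ρ ≡ triangle (eval t x ρ)
    eval-triangle t = go (eval t x ρ)
      where
      go : ∀ k → natrec 0 (λ i a → eval (suc (var #0) +ᵗ var #1) x (i ∷ a ∷ [])) k ≡ triangle k
      go zero    = refl
      go (suc k) = trans (eval-+ x (k ∷ _ ∷ []) (suc (var #0)) (var #1)) (cong (suc k +_) (go k))

    eval-pair : ∀ a b → eval (pairᵗ a b) x ρ ≡ pair (eval a x ρ) (eval b x ρ)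
    eval-pair a b = trans (eval-+ x ρ b (triangleᵗ (a +ᵗ b)))
      (trans (cong (eval b x ρ +_) (trans (eval-triangle (a +ᵗ b))
        (cong triangle (eval-+ x ρ a b))))
             (sym (pair-≡ (eval a x ρ) (eval b x ρ))))

module _ {q n} (x : Vec 𝒩 q) (ρ : Vec ℕ n) where

  opaque
    unfolding rootᵗ sndᵗ fstᵗ

    eval-root : ∀ t → eval (rootᵗ t) x ρ ≡ root (eval t x ρ)
    eval-root t = go (eval t x ρ)
      where
      c : PR q 2
      c = triangleᵗ (suc (var #1)) ≡ᵗ suc (var #0)
      body : PR q 2
      body = ifᵗ c then suc (var #1) else var #1
      go : ∀ k → natrec 0 (λ i a → eval body x (i ∷ a ∷ [])) k ≡ root k
      go zero    = refl
      go (suc k) = trans (cong (λ s → eval body x (k ∷ s ∷ [])) (go k))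
        (eval-if x ρ′ c (suc (var #1)) (var #1)
          (trans (eval-≡ x ρ′ (triangleᵗ (suc (var #1))) (suc (var #0)))
                 (cong (λ m → bit (m ≡ᵇ suc k)) (eval-triangle x ρ′ (suc (var #1))))))
        where
        ρ′ : Vec ℕ 2
        ρ′ = k ∷ root k ∷ []

    eval-snd : ∀ t → eval (sndᵗ t) x ρ ≡ snd (eval t x ρ)
    eval-snd t = trans (eval-∸ x ρ t (triangleᵗ (rootᵗ t)))
      (trans (cong (eval t x ρ ∸_) (trans (eval-triangle x ρ (rootᵗ t))
        (cong triangle (eval-root t))))
             (snd-root (eval t x ρ)))

    eval-fst : ∀ t → eval (fstᵗ t) x ρ ≡ fst (eval t x ρ)
    eval-fst t = trans (eval-∸ x ρ (rootᵗ t) (sndᵗ t))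
      (trans (cong₂ _∸_ (eval-root t) (eval-snd t)) (fst-root (eval t x ρ)))

-- Renaming the oracles of an enumerated machine

renameCommand : ∀ {q r k} → Vec (Fin r) q → OracleCommand q k → OracleCommand r k
renameCommand js (act t a) = act t a
renameCommand js (ask j t) = ask (lookup js j) t

renameRule : ∀ {q r k} → Vec (Fin r) q → OracleRule q k → OracleRule r k
renameRule js (rule s t c s′) = rule s t (renameCommand js c) s′

lookupOr : ∀ {n} → ℕ → Vec ℕ n → ℕ → ℕ
lookupOr d []       j       = d
lookupOr d (a ∷ as) zero    = a
lookupOr d (a ∷ as) (suc j) = lookupOr d as j

lookupOrᵗ : ∀ {q m n} → ℕ → Vec ℕ m → PR q n → PR q n
lookupOrᵗ d []       t = numᵗ d
lookupOrᵗ d (a ∷ as) t = ifᵗ t then lookupOrᵗ d as (t ∸ᵗ numᵗ 1) else numᵗ a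

eval-lookupOr : ∀ {q m n} d (as : Vec ℕ m) (x : Vec 𝒩 q) (ρ : Vec ℕ n) t →
                eval (lookupOrᵗ d as t) x ρ ≡ lookupOr d as (eval t x ρ)
eval-lookupOr d [] x ρ t = eval-num x ρ d
eval-lookupOr d (a ∷ as) x ρ t with eval t x ρ in e
... | zero  = trans (eval-if-zero x ρ t _ (numᵗ a) e) (eval-num x ρ a)
... | suc k = trans (eval-if-suc x ρ t _ (numᵗ a) e)
  (trans (eval-lookupOr d as x ρ (t ∸ᵗ numᵗ 1))
    (cong (lookupOr d as) (trans (eval-∸ x ρ t (numᵗ 1)) (cong₂ _∸_ e (eval-num x ρ 1)))))

-- Oracles that the old machine does not have are sent to r, which the new
-- machine does not have either.

module Renaming {q r : ℕ} (js : Vec (Fin r) q) where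

  newOracle : ℕ → ℕ
  newOracle = lookupOr r (mapᵛ toℕ js)

  -- Every tag from 3 on decodes to `ask`, so `3 ∸ fst c` vanishes exactly at oracle questions.
  -- These are rebuilt with the tag 3; all other codes pass unchanged.
  newCommand : ℕ → ℕ
  newCommand c =
    natrec (pair 3 (pair (newOracle (fst (snd c))) (snd (snd c)))) (λ _ _ → c) (3 ∸ fst c)

  newRule : ℕ → ℕ
  newRule ρ = pair (fst ρ) (pair (fst (snd ρ)) (newCommand (snd (snd ρ))))

  -- Primitive recursion builds the list from its last entry: round `k` prepends the entry with
  -- index `ℓ ∸ suc k`, reached by dropping that many entries from `c`.
  newRules : ℕ → ℕ → ℕ
  newRules ℓ c =
    natrec 0 (λ k → pair (newRule (fst (natrec c (λ _ → snd) (ℓ ∸ suc k))))) ℓ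

  newMachine : ℕ → ℕ
  newMachine e = pair (fst e) (pair (fst (snd e)) (newRules (fst (snd e)) (snd (snd e))))

  decodeFin-large : ∀ n → decodeFin n n ≡ nothing
  decodeFin-large n with n <? n
  ... | yes n<n = ⊥-elim (<-irrefl refl n<n)
  ... | no _    = refl

  decodeFin-suc : ∀ n m → decodeFin (suc n) (suc m) ≡ mapᵐ suc (decodeFin n m)
  decodeFin-suc n m with m <? n | suc m <? suc n
  ... | yes m<n | yes (s≤s m<n′) = cong (λ p → just (suc (fromℕ< p))) (<-irrelevant m<n′ m<n)
  ... | yes m<n | no m≮n         = ⊥-elim (m≮n (s≤s m<n))
  ... | no m≮n  | yes (s≤s m<n)  = ⊥-elim (m≮n m<n)
  ... | no _    | no _           = refl

  decodeFin-newOracle : ∀ j → decodeFin r (newOracle j) ≡ mapᵐ (lookup js) (decodeFin q j)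
  decodeFin-newOracle = go js
    where
    go : ∀ {q} (js : Vec (Fin r) q) j →
         decodeFin r (lookupOr r (mapᵛ toℕ js) j) ≡ mapᵐ (lookup js) (decodeFin q j)
    go []               j       = decodeFin-large r
    go {suc q} (i ∷ js) zero    = decodeFin-toℕ i
    go {suc q} (i ∷ js) (suc j) rewrite decodeFin-suc q j | go js j with decodeFin q j
    ... | just _  = refl
    ... | nothing = refl

  module _ {k : ℕ} where

    decode-newCommand : ∀ c → decodeCommand r k (newCommand c) ≡
                        mapᵐ (renameCommand js) (decodeCommand q k c)
    decode-newCommand c with unpair c in eq
    ... | 0 , d rewrite eq with decodeFin k (fst d)
    ...   | just _  = refl
    ...   | nothing = refl
    decode-newCommand c | 1 , d rewrite eq with decodeFin k (fst d)
    ...   | just _  = refl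
    ...   | nothing = refl
    decode-newCommand c | 2 , d rewrite eq with decodeFin k (fst d)
    ...   | just _  = refl
    ...   | nothing = refl
    decode-newCommand c | suc (suc (suc n)) , d
      rewrite 0∸n≡0 n | unpair-pair 3 (pair (newOracle (fst d)) (snd d))
            | unpair-pair (newOracle (fst d)) (snd d)
            | decodeFin-newOracle (fst d)
      with decodeFin q (fst d) | decodeFin k (snd d)
    ...   | just _  | just _  = refl
    ...   | just _  | nothing = refl
    ...   | nothing | _       = refl

    decode-newRule : ∀ ρ → decodeRule r k (newRule ρ) ≡ mapᵐ (renameRule js) (decodeRule q k ρ)
    decode-newRule ρ
      rewrite unpair-pair (fst ρ) (pair (fst (snd ρ)) (newCommand (snd (snd ρ))))
            | unpair-pair (fst (snd ρ)) (newCommand (snd (snd ρ)))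
            | decode-newCommand (snd (snd ρ))
      with decodeTest k (fst (snd ρ)) | decodeCommand q k (snd (snd ρ))
    ... | just _  | just _  = refl
    ... | just _  | nothing = refl
    ... | nothing | _       = refl

  decodeList-newRules : ∀ ℓ c → decodeList ℓ (newRules ℓ c) ≡ map newRule (decodeList ℓ c)
  decodeList-newRules ℓ c =
    trans (go ℓ ≤-refl) (cong (λ i → map newRule (decodeList ℓ (natrec c (λ _ → snd) i))) (n∸n≡0 ℓ))
    where
    -- The first `j` rounds have produced the last `j` entries.
    go : ∀ j → j ≤ ℓ →
         decodeList j (natrec 0 (λ k → pair (newRule (fst (natrec c (λ _ → snd) (ℓ ∸ suc k))))) j)
         ≡ map newRule (decodeList j (natrec c (λ _ → snd) (ℓ ∸ j)))
    go zero    _   = refl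
    go (suc j) j<ℓ
      rewrite unpair-pair (newRule (fst (natrec c (λ _ → snd) (ℓ ∸ suc j))))
        (natrec 0 (λ k → pair (newRule (fst (natrec c (λ _ → snd) (ℓ ∸ suc k))))) j) =
      cong (newRule (fst (natrec c (λ _ → snd) (ℓ ∸ suc j))) ∷_)
        (trans (go j (<⇒≤ j<ℓ))
          (cong (λ i → map newRule (decodeList j (natrec c (λ _ → snd) i))) (+-∸-assoc 1 j<ℓ)))

  renameMachine : OracleMachine q → OracleMachine r
  renameMachine (oracleMachine w ρs) = oracleMachine w (map (renameRule js) ρs)

  -- The index arrives at run time, so `e` is arbitrary and need not come from `encodeMachine`.
  -- Rules that decoding skips must therefore stay skipped after renaming.
  machine-newMachine : ∀ e → machine r (newMachine e) ≡ renameMachine (machine q e)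
  machine-newMachine e
    rewrite unpair-pair (fst e) (pair (fst (snd e)) (newRules (fst (snd e)) (snd (snd e))))
          | unpair-pair (fst (snd e)) (newRules (fst (snd e)) (snd (snd e)))
          | decodeList-newRules (fst (snd e)) (snd (snd e)) =
    cong (oracleMachine (fst e)) (go (decodeList (fst (snd e)) (snd (snd e))))
    where
    go : ∀ {k} cs → mapMaybe (decodeRule r k) (map newRule cs) ≡
                    map (renameRule js) (mapMaybe (decodeRule q k) cs)
    go []       = refl
    go {k} (c ∷ cs) rewrite decode-newRule {k} c with decodeRule q k c
    ... | just ρ  = cong (renameRule js ρ ∷_) (go cs)
    ... | nothing = go cs

  module _ (y : Vec 𝒩 r) where

    private
      x : Vec 𝒩 q
      x = mapᵛ (lookup y) js

    applicable-rename : ∀ {k} (h : Fin k × ℕ → Bool) s ρs →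
      applicable h s (map (renameRule js) ρs) ≡ mapᵐ (renameRule js) (applicable h s ρs)
    applicable-rename h zero    ρs = refl
    applicable-rename h (suc s) [] = refl
    applicable-rename h (suc s) (ρ ∷ ρs) with (from ρ ≡ᵇ suc s) ∧ h (test ρ)
    ... | true  = refl
    ... | false = applicable-rename h (suc s) ρs

    execute-rename : ∀ {k} c (ts : Vec Tape k) → execute y (renameCommand js c) ts ≡ execute x c ts
    execute-rename (act t a) ts = refl
    execute-rename (ask j t) ts rewrite lookup-map j (lookup y) js = refl

    step-rename : ∀ {k} ρs (c : OracleConfig k) →
                  oracleStep y (map (renameRule js) ρs) c ≡ oracleStep x ρs c
    step-rename ρs (s , ts) rewrite applicable-rename (scans ts) s ρs with applicable
      (scans ts) s ρs
    ... | nothing = refl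
    ... | just ρ  = cong (λ us → just (to ρ , us)) (execute-rename (command ρ) ts)

    Φ-rename : ∀ {e i v} → Φ x e i v → Φ y (newMachine e) i v
    Φ-rename {e} {i} {v} (ts , run , eq) =
      subst (λ M → OracleMachineComputes M y i v) (sym (machine-newMachine e))
        (ts , gmap id (λ {c} st → trans
          (step-rename (OracleMachine.rules (machine q e)) c) st) run , eq)

    Φ-rename⁻ : ∀ {e i v} → Φ y (newMachine e) i v → Φ x e i v
    Φ-rename⁻ {e} {i} {v} c
      with subst (λ M → OracleMachineComputes M y i v) (machine-newMachine e) c
    ... | ts , run , eq =
      ts , gmap id (λ {c} st → trans
        (sym (step-rename (OracleMachine.rules (machine q e)) c)) st) run , eq

module _ {q r : ℕ} (js : Vec (Fin r) q) where

  open Renaming js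

  opaque

    newCommandᵗ newRuleᵗ newMachineᵗ : ∀ {q n} → PR q n → PR q n
    newRulesᵗ : ∀ {q n} → PR q n → PR q n → PR q n
    newCommandᵗ t = ifᵗ numᵗ 3 ∸ᵗ fstᵗ t then t else
      pairᵗ (numᵗ 3) (pairᵗ (lookupOrᵗ r (mapᵛ toℕ js) (fstᵗ (sndᵗ t))) (sndᵗ (sndᵗ t)))
    newRuleᵗ t = pairᵗ (fstᵗ t) (pairᵗ (fstᵗ (sndᵗ t)) (newCommandᵗ (sndᵗ (sndᵗ t))))
    newRulesᵗ ℓ c =
      app (rec zero (pairᵗ (newRuleᵗ (fstᵗ (app (rec (var #0) (sndᵗ (var #1)))
                             (var #2 ∸ᵗ suc (var #0) ∷ var #3 ∷ [])))) (var #1)))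
          -- The length enters twice, as the number of rounds and as a parameter for locating the
          -- entry.
          (ℓ ∷ ℓ ∷ c ∷ [])
    newMachineᵗ t =
      pairᵗ (fstᵗ t) (pairᵗ (fstᵗ (sndᵗ t)) (newRulesᵗ (fstᵗ (sndᵗ t)) (sndᵗ (sndᵗ t))))

  module _ {q n} (x : Vec 𝒩 q) (ρ : Vec ℕ n) where

    fst-snd : ∀ t → eval (fstᵗ (sndᵗ t)) x ρ ≡ fst (snd (eval t x ρ))
    fst-snd t = trans (eval-fst x ρ (sndᵗ t)) (cong fst (eval-snd x ρ t))

    snd-snd : ∀ t → eval (sndᵗ (sndᵗ t)) x ρ ≡ snd (snd (eval t x ρ))
    snd-snd t = trans (eval-snd x ρ (sndᵗ t)) (cong snd (eval-snd x ρ t))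

    eval-pair-≡ : ∀ a b {m k} → eval a x ρ ≡ m → eval b x ρ ≡ k →
                  eval (pairᵗ a b) x ρ ≡ pair m k
    eval-pair-≡ a b e e′ = trans (eval-pair x ρ a b) (cong₂ pair e e′)

    opaque
      unfolding newCommandᵗ newRuleᵗ

      eval-newCommand : ∀ t → eval (newCommandᵗ t) x ρ ≡ newCommand (eval t x ρ)
      eval-newCommand t = trans (eval-if-natrec x ρ c t new)
        (trans (cong (natrec (eval new x ρ) (λ _ _ → eval t x ρ))
                 (trans (eval-∸ x ρ (numᵗ 3) (fstᵗ t))
                   (cong₂ _∸_ (eval-num x ρ 3) (eval-fst x ρ t))))
          (natrec-cong (eval-pair-≡ (numᵗ 3) (pairᵗ j (sndᵗ (sndᵗ t))) (eval-num x ρ 3)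
            (eval-pair-≡ j (sndᵗ (sndᵗ t))
              (trans (eval-lookupOr r (mapᵛ toℕ js) x ρ (fstᵗ (sndᵗ t)))
                (cong newOracle (fst-snd t)))
              (snd-snd t))) (λ _ _ → refl) (3 ∸ fst (eval t x ρ))))
        where
        c j new : PR q n
        c = numᵗ 3 ∸ᵗ fstᵗ t
        j = lookupOrᵗ r (mapᵛ toℕ js) (fstᵗ (sndᵗ t))
        new = pairᵗ (numᵗ 3) (pairᵗ j (sndᵗ (sndᵗ t)))

      eval-newRule : ∀ t → eval (newRuleᵗ t) x ρ ≡ newRule (eval t x ρ)
      eval-newRule t = eval-pair-≡ (fstᵗ t) (pairᵗ (fstᵗ (sndᵗ t)) (newCommandᵗ (sndᵗ (sndᵗ t))))
        (eval-fst x ρ t)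
        (eval-pair-≡ (fstᵗ (sndᵗ t)) (newCommandᵗ (sndᵗ (sndᵗ t))) (fst-snd t)
          (trans (eval-newCommand (sndᵗ (sndᵗ t))) (cong newCommand (snd-snd t))))

  module _ {q n} (x : Vec 𝒩 q) (ρ : Vec ℕ n) where

    private
      tailᵗ : PR q 4
      tailᵗ = app (rec (var #0) (sndᵗ (var #1))) (var #2 ∸ᵗ suc (var #0) ∷ var #3 ∷ [])

      eval-tail : ∀ k a ℓ c → eval tailᵗ x (k ∷ a ∷ ℓ ∷ c ∷ []) ≡ natrec c (λ _ → snd) (ℓ ∸ suc k)
      eval-tail k a ℓ c = trans
        (cong (natrec c (λ i b → eval (sndᵗ (var #1)) x (i ∷ b ∷ c ∷ [])))
          (eval-∸ x (k ∷ a ∷ ℓ ∷ c ∷ []) (var #2) (suc (var #0))))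
        (natrec-cong refl (λ i b → eval-snd x (i ∷ b ∷ c ∷ []) (var #1)) (ℓ ∸ suc k))

      eval-body : ∀ k a ℓ c → eval (pairᵗ (newRuleᵗ (fstᵗ tailᵗ)) (var #1)) x (k ∷ a ∷ ℓ ∷ c ∷ []) ≡
                  pair (newRule (fst (natrec c (λ _ → snd) (ℓ ∸ suc k)))) a
      eval-body k a ℓ c = eval-pair-≡ x ρ′ (newRuleᵗ (fstᵗ tailᵗ)) (var #1)
        (trans (eval-newRule x ρ′ (fstᵗ tailᵗ))
          (cong newRule (trans (eval-fst x ρ′ tailᵗ) (cong fst (eval-tail k a ℓ c))))) refl
        where
        ρ′ : Vec ℕ 4
        ρ′ = k ∷ a ∷ ℓ ∷ c ∷ []

    opaque
      unfolding newRulesᵗ newMachineᵗ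

      eval-newRules : ∀ ℓ c → eval (newRulesᵗ ℓ c) x ρ ≡ newRules (eval ℓ x ρ) (eval c x ρ)
      eval-newRules ℓ c =
        natrec-cong refl (λ k a → eval-body k a (eval ℓ x ρ) (eval c x ρ)) (eval ℓ x ρ)

      eval-newMachine : ∀ t → eval (newMachineᵗ t) x ρ ≡ newMachine (eval t x ρ)
      eval-newMachine t = eval-pair-≡ x ρ (fstᵗ t) (pairᵗ ℓ (newRulesᵗ ℓ c)) (eval-fst x ρ t)
        (eval-pair-≡ x ρ ℓ (newRulesᵗ ℓ c) (fst-snd x ρ t)
          (trans (eval-newRules ℓ c) (cong₂ newRules (fst-snd x ρ t) (snd-snd x ρ t))))
        where
        ℓ c : PR q n
        ℓ = fstᵗ (sndᵗ t)
        c = sndᵗ (sndᵗ t)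

-- Master-slave machines

-- The counters are the output tape, the billboard and an accumulator for
-- programs computed on the fly.

data Register : Set where
  out bb acc : Register

data Instr : Set where
  skip advance           : Instr
  _⨾_                    : Instr → Instr → Instr
  inc                    : Register → Instr
  loop                   : Register → Instr → Instr
  call                   : ℕ → Instr
  whileInput whileNonzero : Instr → Instr

-- A move to the right on the unary input takes away one stroke, or the blank behind an exhausted
-- block.
advanceInput : List ℕ → List ℕ
advanceInput []           = []
advanceInput (zero ∷ ns)  = ns
advanceInput (suc n ∷ ns) = n ∷ ns

record Store (w : ℕ) : Set where
  constructor store
  field
    input     : List ℕ
    `out `bb `acc : ℕ
    baire     : Vec 𝒩 (suc w)

open Store

get : ∀ {w} → Register → Store w → ℕ
get out = `out
get bb  = `bb
get acc = `acc

set : ∀ {w} → Register → ℕ → Store w → Store w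
set out v s = record s { `out = v }
set bb  v s = record s { `bb = v }
set acc v s = record s { `acc = v }

-- A relation, because `call` determines the new tape only up to pointwise equality and a zero test
-- proceeds only with evidence for its outcome.
data Exec {w : ℕ} : Instr → Store w → Store w → Set where
  skip       : ∀ {s} → Exec skip s s
  advance    : ∀ {s} → Exec advance s (record s { input = advanceInput (input s) })
  _⨾_        : ∀ {P Q s s₁ s₂} → Exec P s s₁ → Exec Q s₁ s₂ → Exec (P ⨾ Q) s s₂
  inc        : ∀ {c s} → Exec (inc c) s (set c (suc (get c s)) s)
  loop-stop  : ∀ {c P s} → get c s ≡ 0 → Exec (loop c P) s s
  loop-go    : ∀ {c P n s s₁ s₂} → get c s ≡ suc n → Exec P (set c n s) s₁ →
               Exec (loop c P) s₁ s₂ → Exec (loop c P) s s₂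
  input-stop : ∀ {P s} → first (input s) ≡ 0 → Exec (whileInput P) s s
  input-go   : ∀ {P n s s₁ s₂} → first (input s) ≡ suc n →
               Exec P (record s { input = advanceInput (input s) }) s₁ →
               Exec (whileInput P) s₁ s₂ → Exec (whileInput P) s s₂
  call       : ∀ {l s z} → Φω (baire s) (`bb s) z →
               Exec (call l) s (record s { baire = baire s [ clamp w l ]≔ z })
  zero-stop  : ∀ {P s} → lookup (baire s) zero ≗ 0𝒩 → Exec (whileNonzero P) s s
  zero-go    : ∀ {P s s₁ s₂} → ¬ lookup (baire s) zero ≗ 0𝒩 → Exec P s s₁ →
               Exec (whileNonzero P) s₁ s₂ → Exec (whileNonzero P) s s₂

strokes-advance : ∀ ns → drop 1 (strokes ns) ≡ strokes (advanceInput ns)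
strokes-advance []           = refl
strokes-advance (zero ∷ ns)  = refl
strokes-advance (suc n ∷ ns) = refl

-- Compiling instructions into master programs

module MasterCode (q working : ℕ) where

  w : ℕ
  w = suc (q + working)

  Command = MasterCommand 5 (suc w)
  Test = MasterTest 5

  pattern spareTape = suc (suc (suc (suc zero)))

  tapeOf : Register → Fin 5
  tapeOf out = suc zero
  tapeOf bb  = suc (suc zero)
  tapeOf acc = suc (suc (suc zero))

  always : Test
  always = scan spareTape 0

  nop : Command
  nop = act spareTape (write 0)

  toProg : Instr → Prog Test Command
  toProg skip             = skip
  toProg advance          = cmd (act zero right)
  toProg (P ⨾ Q)          = toProg P ⨾ toProg Q
  toProg (inc c)          = cmd (act (tapeOf c) left) ⨾ cmd (act (tapeOf c) (write 1))
  toProg (loop c P)       = while (scan (tapeOf c) 1) (cmd (act (tapeOf c) right) ⨾ toProg P)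
  toProg (call l)         = cmd (call (clamp w l))
  toProg (whileInput P)   = while (scan zero 1) (cmd (act zero right) ⨾ toProg P)
  toProg (whileNonzero P) = cmd zeroTest ⨾ while (bit? false) (toProg P ⨾ cmd zeroTest)

  machineOf : Instr → MSMachine q
  machineOf P = record
    { extra = 2 ; working = working ; program = Code.programOf always nop (toProg P) }

module Master (q working : ℕ) (P₀ : Instr) where

  open MasterCode q working public
  open MS (machineOf P₀) using (Memory; memory; holds; Executes; act; call; zeroTestYes; zeroTestNo;
                                initial; output; Computes; _⟶_)
  open Compilation {Test} {Command} {Memory} holds Executes always nop

  -- The bit is left open: every `whileNonzero` sets it before reading it, so stores need not record
  -- it.
  data Rep : Store w → Memory → Set where
    rep : ∀ {ns o b a ys t₀ t₁ t₂ t₃ t₄ β} → after t₀ ≡ strokes ns →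
          Counts t₁ o → Counts t₂ b → Counts t₃ a → Counts t₄ 0 →
          Rep (store ns o b a ys) (memory (t₀ ∷ t₁ ∷ t₂ ∷ t₃ ∷ t₄ ∷ []) ys β)

  always-holds : ∀ {s m} → Rep s m → holds m always ≡ true
  always-holds (rep {t₄ = t} _ _ _ _ c) rewrite scanned-zero {t} c = refl

  Rep-nop : ∀ {s m m′} → Rep s m → Executes nop m m′ → Rep s m′
  Rep-nop (rep {t₄ = t} e c₁ c₂ c₃ c₄) act = rep e c₁ c₂ c₃ (Counts-write0 {t} c₄)

  do-nop : ∀ {s m} → Rep s m → ∃[ m′ ] Executes nop m m′
  do-nop (rep _ _ _ _ _) = _ , act

  Rep-advance : ∀ {s m m′} → Rep s m → Executes (act zero right) m m′ →
                Rep (record s { input = advanceInput (input s) }) m′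
  Rep-advance (rep {ns = ns} {t₀ = tape _ _} refl c₁ c₂ c₃ c₄) act =
    rep (strokes-advance ns) c₁ c₂ c₃ c₄

  do-advance : ∀ {s m} → Rep s m → ∃[ m′ ] Executes (act zero right) m m′
  do-advance (rep _ _ _ _ _) = _ , act

  Rep-dec : ∀ c {n s m m′} → get c s ≡ suc n → Rep s m → Executes (act (tapeOf c) right) m m′ →
            Rep (set c n s) m′
  Rep-dec out refl (rep {t₁ = t} e c₁ c₂ c₃ c₄) act = rep e (Counts-dec {t} c₁) c₂ c₃ c₄
  Rep-dec bb  refl (rep {t₂ = t} e c₁ c₂ c₃ c₄) act = rep e c₁ (Counts-dec {t} c₂) c₃ c₄
  Rep-dec acc refl (rep {t₃ = t} e c₁ c₂ c₃ c₄) act = rep e c₁ c₂ (Counts-dec {t} c₃) c₄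

  do-act : ∀ {i a m} → ∃[ m′ ] Executes (act i a) m m′
  do-act {m = memory _ _ _} = _ , act

  scan-counter : ∀ c {s m} → Rep s m → holds m (scan (tapeOf c) 1) ≡ (1 ≤ᵇ get c s)
  scan-counter out {store _ zero    _ _ _} (rep {t₁ = t} _ c _ _ _) rewrite scanned-zero {t} c =
    refl
  scan-counter out {store _ (suc _) _ _ _} (rep {t₁ = t} _ c _ _ _) rewrite scanned-suc {t} c = refl
  scan-counter bb  {store _ _ zero    _ _} (rep {t₂ = t} _ _ c _ _) rewrite scanned-zero {t} c =
    refl
  scan-counter bb  {store _ _ (suc _) _ _} (rep {t₂ = t} _ _ c _ _) rewrite scanned-suc {t} c = refl
  scan-counter acc {store _ _ _ zero    _} (rep {t₃ = t} _ _ _ c _) rewrite scanned-zero {t} c =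
    refl
  scan-counter acc {store _ _ _ (suc _) _} (rep {t₃ = t} _ _ _ c _) rewrite scanned-suc {t} c = refl

  scan-input : ∀ {s m} → Rep s m → holds m (scan zero 1) ≡ (1 ≤ᵇ first (input s))
  scan-input {store []           _ _ _ _} (rep e _ _ _ _) rewrite e = refl
  scan-input {store (zero ∷ ns)  _ _ _ _} (rep e _ _ _ _) rewrite e = refl
  scan-input {store (suc n ∷ ns) _ _ _ _} (rep e _ _ _ _) rewrite e = refl

  Rep-inc : ∀ c {s m m₁ m₂} → Rep s m → Executes (act (tapeOf c) left) m m₁ →
            Executes (act (tapeOf c) (write 1)) m₁ m₂ → Rep (set c (suc (get c s)) s) m₂
  Rep-inc out (rep {t₁ = t} e c₁ c₂ c₃ c₄) act act = rep e (Counts-inc {t} c₁) c₂ c₃ c₄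
  Rep-inc bb  (rep {t₂ = t} e c₁ c₂ c₃ c₄) act act = rep e c₁ (Counts-inc {t} c₂) c₃ c₄
  Rep-inc acc (rep {t₃ = t} e c₁ c₂ c₃ c₄) act act = rep e c₁ c₂ (Counts-inc {t} c₃) c₄

  always-left : ∀ c {s m m₁} → Rep s m → Executes (act (tapeOf c) left) m m₁ →
                holds m₁ always ≡ true
  always-left out R@(rep _ _ _ _ _) act = always-holds R
  always-left bb  R@(rep _ _ _ _ _) act = always-holds R
  always-left acc R@(rep _ _ _ _ _) act = always-holds R

  Rep-zeroTest : ∀ {s m m′} → Rep s m → Executes zeroTest m m′ → Rep s m′
  Rep-zeroTest (rep e c₁ c₂ c₃ c₄) (zeroTestYes _) = rep e c₁ c₂ c₃ c₄
  Rep-zeroTest (rep e c₁ c₂ c₃ c₄) (zeroTestNo _)  = rep e c₁ c₂ c₃ c₄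

  -- For `complete` the outcome of the test is known and the bit must follow from it; for `sound`
  -- the bit is known and `decided` recovers the outcome.
  Tested : Store w → Memory → Set
  Tested s m = (lookup (baire s) zero ≗ 0𝒩 → holds m (bit? false) ≡ false) ×
               (¬ lookup (baire s) zero ≗ 0𝒩 → holds m (bit? false) ≡ true)

  tested : ∀ {s m m′} → Rep s m → Executes zeroTest m m′ → Tested s m′
  tested (rep _ _ _ _ _) (zeroTestYes z)  = (λ _ → refl) , λ nz → ⊥-elim (nz z)
  tested (rep _ _ _ _ _) (zeroTestNo nz) = (λ z → ⊥-elim (nz z)) , λ _ → refl

  tested-nop : ∀ {s m m′} → Tested s m → Executes nop m m′ → Tested s m′
  tested-nop t act = t

  decided : ∀ {s m m′} → Rep s m → Executes zeroTest m m′ →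
            (holds m′ (bit? false) ≡ false → lookup (baire s) zero ≗ 0𝒩) ×
            (holds m′ (bit? false) ≡ true → ¬ lookup (baire s) zero ≗ 0𝒩)
  decided (rep _ _ _ _ _) (zeroTestYes z)  = (λ _ → z) , λ ()
  decided (rep _ _ _ _ _) (zeroTestNo nz) = (λ ()) , λ _ → nz

  -- A zero test can be carried out only where the tape is known to be zero or known not to be. The
  -- given execution of the loop supplies this knowledge.
  do-zeroTest : ∀ {P s s′ m} → Exec (whileNonzero P) s s′ → Rep s m →
                ∃[ m′ ] Executes zeroTest m m′
  do-zeroTest (zero-stop z)    (rep _ _ _ _ _) = _ , zeroTestYes z
  do-zeroTest (zero-go nz _ _) (rep _ _ _ _ _) = _ , zeroTestNo nz

  positive-≤ᵇ : ∀ {n k} → n ≡ suc k → (1 ≤ᵇ n) ≡ true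
  positive-≤ᵇ refl = refl

  zero-≤ᵇ : ∀ {n} → n ≡ 0 → (1 ≤ᵇ n) ≡ false
  zero-≤ᵇ refl = refl

  complete : ∀ {P s s′ m} → Exec P s s′ → Rep s m → ∃[ m′ ] Run (toProg P) m m′ × Rep s′ m′
  -- The zero test in front of the loop and the one at the end of its body play the same part: each
  -- decides the round that follows. So the induction starts from a memory just tested.
  complete-while : ∀ {P s s′ m} → Exec (whileNonzero P) s s′ → Rep s m → Tested s m →
    ∃[ m′ ] Run (while (bit? false) (toProg P ⨾ cmd zeroTest)) m m′ × Rep s′ m′

  complete {whileNonzero P} e R with do-zeroTest e R
  ... | _ , ex with complete-while e (Rep-zeroTest R ex) (tested R ex)
  ... | _ , r , R′ = _ , cmd (always-holds R) ex ⨾ r , R′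
  complete skip R = _ , skip , R
  complete {m = m} advance R with do-advance R
  ... | _ , ex = _ , cmd (always-holds R) ex , Rep-advance R ex
  complete (e ⨾ e′) R with complete e R
  ... | _ , r , R₁ with complete e′ R₁
  ... | _ , r′ , R₂ = _ , r ⨾ r′ , R₂
  complete (inc {c}) R with do-act
  ... | _ , ex with do-act
  ... | _ , ex′ = _ , cmd (always-holds R) ex ⨾ cmd (always-left c R ex) ex′ , Rep-inc c R ex ex′
  complete (loop-stop {c} z) R with do-nop R
  ... | _ , ex = _ , stop (trans (scan-counter c R) (zero-≤ᵇ z)) (always-holds R) ex , Rep-nop R ex
  complete (loop-go {c} p e e′) R with do-nop R
  ... | _ , ex with Rep-nop R ex | do-act
  ... | R₁ | _ , ex′ with complete e (Rep-dec c p R₁ ex′)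
  ... | _ , r , R₂ with do-nop R₂
  ... | _ , ex″ with complete e′ (Rep-nop R₂ ex″)
  ... | _ , r′ , R₃ =
    _ , go (trans (scan-counter c R) (positive-≤ᵇ p)) ex (cmd (always-holds R₁) ex′ ⨾ r)
           (always-holds R₂) ex″ r′ , R₃
  complete (input-stop z) R with do-nop R
  ... | _ , ex = _ , stop (trans (scan-input R) (zero-≤ᵇ z)) (always-holds R) ex , Rep-nop R ex
  complete (input-go p e e′) R with do-nop R
  ... | _ , ex with Rep-nop R ex
  ... | R₁ with do-advance R₁
  ... | _ , ex′ with complete e (Rep-advance R₁ ex′)
  ... | _ , r , R₂ with do-nop R₂
  ... | _ , ex″ with complete e′ (Rep-nop R₂ ex″)
  ... | _ , r′ , R₃ =
    _ , go (trans (scan-input R) (positive-≤ᵇ p)) ex (cmd (always-holds R₁) ex′ ⨾ r)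
           (always-holds R₂) ex″ r′ , R₃
  complete (call φ) R@(rep {t₂ = t} e c₁ c₂ c₃ c₄) =
    _ , cmd (always-holds R) (call (subst (λ b → Φω _ b _) (sym (Counts-number {t} c₂)) φ)) ,
    rep e c₁ c₂ c₃ c₄
  complete-while (zero-stop z) R (off , _) with do-nop R
  ... | _ , ex = _ , stop (off z) (always-holds R) ex , Rep-nop R ex
  complete-while (zero-go {s₁ = s₁} nz e e′) R (_ , on) with do-nop R
  ... | _ , ex with complete e (Rep-nop R ex)
  ... | _ , r , R₁ with do-zeroTest e′ R₁
  ... | _ , ex′ with Rep-zeroTest R₁ ex′
  ... | R₂ with do-nop R₂
  ... | _ , ex″ with complete-while e′ (Rep-nop R₂ ex″) (tested-nop {s = s₁} (tested R₁ ex′) ex″)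
  ... | _ , r′ , R₃ = _ , go (on nz) ex (r ⨾ cmd (always-holds R₁) ex′) (always-holds R₂) ex″ r′ ,
        R₃

  ≤ᵇ-positive : ∀ {n} → (1 ≤ᵇ n) ≡ true → ∃[ k ] n ≡ suc k
  ≤ᵇ-positive {suc n} _ = n , refl

  ≤ᵇ-zero : ∀ {n} → (1 ≤ᵇ n) ≡ false → n ≡ 0
  ≤ᵇ-zero {zero} _ = refl

  sound : ∀ P {s m m′} → Rep s m → Run (toProg P) m m′ → ∃[ s′ ] Exec P s s′ × Rep s′ m′
  sound-while : ∀ P {s m m′} → Rep s m →
                (holds m (bit? false) ≡ false → lookup (baire s) zero ≗ 0𝒩) ×
                (holds m (bit? false) ≡ true → ¬ lookup (baire s) zero ≗ 0𝒩) →
                Run (while (bit? false) (toProg P ⨾ cmd zeroTest)) m m′ →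
                ∃[ s′ ] Exec (whileNonzero P) s s′ × Rep s′ m′

  sound skip R skip = _ , skip , R
  sound advance R (cmd _ ex) = _ , advance , Rep-advance R ex
  sound (P ⨾ Q) R (r ⨾ r′) with sound P R r
  ... | _ , e , R₁ with sound Q R₁ r′
  ... | _ , e′ , R₂ = _ , e ⨾ e′ , R₂
  sound (inc c) R (cmd _ ex ⨾ cmd _ ex′) = _ , inc , Rep-inc c R ex ex′
  sound (loop c P) R (stop off _ ex) =
    _ , loop-stop (≤ᵇ-zero (trans (sym (scan-counter c R)) off)) , Rep-nop R ex
  sound (loop c P) R (go on ex (cmd _ ex′ ⨾ r) _ ex″ r′)
    with ≤ᵇ-positive (trans (sym (scan-counter c R)) on)
  ... | _ , p with sound P (Rep-dec c p (Rep-nop R ex) ex′) r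
  ... | _ , e , R₁ with sound (loop c P) (Rep-nop R₁ ex″) r′
  ... | _ , e′ , R₂ = _ , loop-go p e e′ , R₂
  sound (call l) (rep {t₂ = t} e c₁ c₂ c₃ c₄) (cmd _ (call φ)) =
    _ , call (subst (λ b → Φω _ b _) (Counts-number {t} c₂) φ) , rep e c₁ c₂ c₃ c₄
  sound (whileInput P) R (stop off _ ex) =
    _ , input-stop (≤ᵇ-zero (trans (sym (scan-input R)) off)) , Rep-nop R ex
  sound (whileInput P) R (go on ex (cmd _ ex′ ⨾ r) _ ex″ r′)
    with ≤ᵇ-positive (trans (sym (scan-input R)) on)
  ... | _ , p with sound P (Rep-advance (Rep-nop R ex) ex′) r
  ... | _ , e , R₁ with sound (whileInput P) (Rep-nop R₁ ex″) r′
  ... | _ , e′ , R₂ = _ , input-go p e e′ , R₂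
  sound (whileNonzero P) R (cmd _ ex ⨾ r) = sound-while P (Rep-zeroTest R ex) (decided R ex) r

  sound-while P R (z , _) (stop off _ ex) = _ , zero-stop (z off) , Rep-nop R ex
  -- Matching on `act` shows that the jump back leaves the bit alone, so the last test still speaks
  -- about the memory at the loop head.
  sound-while P R (_ , nz) (go on ex (r ⨾ cmd _ ex′) _ ex″@act r′) with sound P (Rep-nop R ex) r
  ... | _ , e , R₁ with sound-while P (Rep-nop (Rep-zeroTest R₁ ex′) ex″) (decided R₁ ex′) r′
  ... | _ , e′ , R₂ = _ , zero-go (nz on) e e′ , R₂

  start : ∀ {p} → Vec ℕ p → Vec 𝒩 q → Store w
  start n x = store (toList n) 0 0 0 (0𝒩 ∷ 0𝒩 ∷ (x ++ᵛ replicateᵛ working 0𝒩))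

  result : ∀ Y → Store w → ⟦ Y ⟧
  result num s = `out s
  result seq s = lookup (baire s) (suc zero)

  output-≡ : ∀ Y {s m} → Rep s m → output Y m ≡ result Y s
  output-≡ num (rep {t₁ = t} _ c _ _ _) = Counts-number {t} c
  output-≡ seq (rep _ _ _ _ _)          = refl

  Rep-start : ∀ {p} (n : Vec ℕ p) x → Rep (start n x) (proj₂ (initial n x))
  Rep-start n x = rep refl Counts-blank Counts-blank Counts-blank Counts-blank

  toMS : ∀ {c d} → Step (Code.programOf always nop (toProg P₀)) c d → c ⟶ d
  toMS (step ap ex) = MS.step ap ex

  fromMS : ∀ {c d} → c ⟶ d → Step (Code.programOf always nop (toProg P₀)) c d
  fromMS (MS.step ap ex) = step ap ex

  exec⇒computes : ∀ {p} Y {n : Vec ℕ p} {x y s} → Exec P₀ (start n x) s → Eq Y (result Y s) y →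
                  Computes Y n x y
  exec⇒computes Y {n} {x} {y} e eq with complete e (Rep-start n x)
  ... | _ , r , R with do-nop R
  ... | _ , ex = _ , gmap id toMS (run⇒halts r (always-holds R) ex) ,
    subst (λ z → Eq Y z y) (sym (output-≡ Y (Rep-nop R ex))) eq

  computes⇒exec : ∀ {p} Y {n : Vec ℕ p} {x y} → Computes Y n x y →
                  ∃[ s ] Exec P₀ (start n x) s × Eq Y (result Y s) y
  computes⇒exec Y {n} {x} {y} (_ , run , eq) with halts⇒run {toProg P₀} (gmap id fromMS run)
  ... | _ , r , _ , ex with sound P₀ (Rep-start n x) r
  ... | _ , e , R = _ , e , subst (λ z → Eq Y z y) (output-≡ Y (Rep-nop R ex)) eq

-- Assignments and indirect slave calls on Baire tapes

module Baire (w : ℕ) where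

  St : Set
  St = Store (suc w)

  Sound : Instr → St → (St → Set) → Set
  Sound P s A = ∀ {s′} → Exec P s s′ → A s′

  Halts : Instr → St → Set
  Halts P s = ∃[ s′ ] Exec P s s′

  record Total (P : Instr) (s : St) (A : St → Set) : Set where
    constructor total
    field
      halts : Halts P s
      sound : Sound P s A

  open Total public

  infixr 20 _⨾ᵗ_

  _⨾ᵗ_ : ∀ {P Q s A B} → Total P s A → (∀ {s′} → A s′ → Total Q s′ B) → Total (P ⨾ Q) s B
  (p ⨾ᵗ q) .halts with halts p
  ... | _ , e with halts (q (sound p e))
  ... | _ , e′ = _ , e ⨾ e′
  (p ⨾ᵗ q) .sound (e ⨾ e′) = sound (q (sound p e)) e′

  seq-sound : ∀ {P Q s B} {A : St → Set} → Sound P s A → (∀ {s′} → A s′ → Sound Q s′ B) →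
              Sound (P ⨾ Q) s B
  seq-sound p q (e ⨾ e′) = q (p e) e′

  seq-halts : ∀ {P Q s} {A : St → Set} → Halts P s → Sound P s A → (∀ {s′} → A s′ → Halts Q s′) →
              Halts (P ⨾ Q) s
  seq-halts (_ , e) p q with q (p e)
  ... | _ , e′ = _ , e ⨾ e′

  weaken : ∀ {P s A B} → Total P s A → (∀ {s′} → A s′ → B s′) → Total P s B
  weaken p f .halts = halts p
  weaken p f .sound e = f (sound p e)

  zeroTape : St → 𝒩
  zeroTape s = lookup (Store.baire s) zero

  while-sound : ∀ {P} (I : St → Set) →
                (∀ {s} → I s → ¬ zeroTape s ≗ 0𝒩 → Sound P s I) →
                ∀ {s} → I s → Sound (whileNonzero P) s (λ s′ → I s′ × zeroTape s′ ≗ 0𝒩)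
  while-sound I body i (zero-stop z)     = i , z
  while-sound I body i (zero-go nz e e′) = while-sound I body (body i nz e) e′

  while-halts : ∀ {P} (I : ℕ → St → Set) → (∀ {s} → I 0 s → zeroTape s ≗ 0𝒩) →
                (∀ {n s} → I (suc n) s → ¬ zeroTape s ≗ 0𝒩 × Halts P s × Sound P s (I n)) →
                ∀ {n s} → I n s → Halts (whileNonzero P) s
  while-halts I stops goes {zero}  i = _ , zero-stop (stops i)
  while-halts I stops goes {suc n} i with goes i
  ... | nz , (_ , e) , snd with while-halts I stops goes (snd e)
  ... | _ , e′ = _ , zero-go nz e e′

  while-total : ∀ {P} (I : ℕ → St → Set) → (∀ {s} → I 0 s → zeroTape s ≗ 0𝒩) →
                (∀ {n s} → I (suc n) s → ¬ zeroTape s ≗ 0𝒩 × Total P s (I n)) →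
                ∀ {n s} → I n s → Total (whileNonzero P) s (I 0)
  while-total {P} I stops goes i .halts =
    while-halts I stops (λ i → proj₁ (goes i) , halts (proj₂ (goes i)) , sound (proj₂ (goes i))) i
  while-total {P} I stops goes {n} i .sound = go n i
    where
    go : ∀ n {s} → I n s → Sound (whileNonzero P) s (I 0)
    go zero    i (zero-stop _)     = i
    go zero    i (zero-go nz _ _)  = ⊥-elim (nz (stops i))
    go (suc n) i (zero-stop z)     = ⊥-elim (proj₁ (goes i) z)
    go (suc n) i (zero-go nz e e′) = go n (sound (proj₂ (goes i)) e) e′

  load : ℕ → Instr
  load zero    = skip
  load (suc n) = inc bb ⨾ load n

  load-total : ∀ n {i o b a ys} → Total (load n) (store i o b a ys) (_≡ store i o (n + b) a ys)
  load-total zero .halts = _ , skip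
  load-total zero .sound skip = refl
  load-total (suc n) {i} {o} {b} {a} {ys} .halts with halts (load-total n {i} {o} {suc b} {a} {ys})
  ... | _ , e = _ , inc ⨾ e
  load-total (suc n) {i} {o} {b} {a} {ys} .sound (inc ⨾ e) =
    trans (sound (load-total n) e) (cong (λ b → store i o b a ys) (+-suc n b))

  unload-total : ∀ {i o} b {a ys} → Total (loop bb skip) (store i o b a ys) (_≡ store i o 0 a ys)
  unload-total zero .halts = _ , loop-stop refl
  unload-total zero .sound (loop-stop refl) = refl
  unload-total (suc b) {a} {ys} .halts with halts (unload-total b {a} {ys})
  ... | _ , e = _ , loop-go refl skip e
  unload-total (suc b) .sound (loop-go refl skip e) = sound (unload-total b) e

  transfer-total : ∀ {i o} a {b ys} →
                   Total (loop acc (inc bb)) (store i o b a ys) (_≡ store i o (a + b) 0 ys)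
  transfer-total zero .halts = _ , loop-stop refl
  transfer-total zero .sound (loop-stop refl) = refl
  transfer-total (suc a) {b} {ys} .halts with halts (transfer-total a {suc b} {ys})
  ... | _ , e = _ , loop-go refl inc e
  transfer-total {i} {o} (suc a) {b} {ys} .sound (loop-go refl inc e) =
    trans (sound (transfer-total a) e) (cong (λ b → store i o b 0 ys) (+-suc a b))

  Term : Set
  Term = PR (2 + w) 1

  value : Term → Vec 𝒩 (2 + w) → 𝒩
  value t ys i = eval t ys (i ∷ [])

  -- A program is loaded by counting the billboard up from 0, so the billboard is emptied again
  -- behind each call.
  assign : ℕ → Term → Instr
  assign l t = load (index t) ⨾ call l ⨾ loop bb skip

  assign-total : ∀ l t {i o a ys} → Total (assign l t) (store i o 0 a ys)
    (λ s → ∃[ z ] z ≗ value t ys × s ≡ store i o 0 a (ys [ clamp (suc w) l ]≔ z))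
  assign-total l t {i} {o} {a} {ys} =
    load-total (index t) ⨾ᵗ λ { refl →
      called ⨾ᵗ λ { (z , e , refl) → weaken (unload-total _) (λ { refl → z , e , refl }) } }
    where
    b : ℕ
    b = index t + 0
    called : Total (call l) (store i o b a ys)
      (λ s → ∃[ z ] z ≗ value t ys × s ≡ store i o b a (ys [ clamp (suc w) l ]≔ z))
    called .halts = _ , call (subst (λ e → Φω ys e (value t ys)) (sym (+-identityʳ (index t)))
      (Φ-index t ys))
    called .sound (call {z = z} φ) = z ,
      (λ j → Φ-unique {x = ys} {index t} (subst (λ e → Φω ys e z) (+-identityʳ (index t)) φ j)
        (Φ-index t ys j)) ,
      refl

  -- Variable k is Baire tape k + 1; tape 0 is the zero-test tape.

  infix 30 _!_

  _!_ : Vec 𝒩 (2 + w) → ℕ → 𝒩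
  (_ ∷ zs) ! k = lookup zs (clamp w k)

  tapeᵗ : ∀ {n} → ℕ → PR (2 + w) n → PR (2 + w) n
  tapeᵗ k t = ask (suc (clamp w k)) t

  eval-tape : ∀ {n} k (t : PR (2 + w) n) ys ρ → eval (tapeᵗ k t) ys ρ ≡ (ys ! k) (eval t ys ρ)
  eval-tape k t (_ ∷ _) ρ = refl

  record Frame (f : ℕ) (ys ys′ : Vec 𝒩 (2 + w)) : Set where
    constructor frame
    field
      kept : ∀ k → k < f → ys′ ! k ≡ ys ! k

  open Frame public

  Frame-refl : ∀ {f ys} → Frame f ys ys
  Frame-refl .kept _ _ = refl

  Frame-trans : ∀ {f g xs ys zs} → f ≤ g → Frame f xs ys → Frame g ys zs → Frame f xs zs
  Frame-trans f≤g F G .kept k k<f = trans (kept G k (<-≤-trans k<f f≤g)) (kept F k k<f)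

  record Set! (k : ℕ) (v : 𝒩) (ys ys′ : Vec 𝒩 (2 + w)) : Set where
    constructor set!
    field
      set-value : ys′ ! k ≗ v
      set-other : ∀ j → j ≤ w → j ≢ k → ys′ ! j ≡ ys ! j
      set-zero  : lookup ys′ zero ≡ lookup ys zero

  open Set! public

  set-total : ∀ k t {i o a ys} → k ≤ w → Total (assign (suc k) t) (store i o 0 a ys)
    (λ s → ∃[ ys′ ] s ≡ store i o 0 a ys′ × Set! k (value t ys) ys ys′)
  set-total k t {i} {o} {a} {y ∷ zs} k≤w = weaken (assign-total (suc k) t)
    λ { (z , e , refl) → y ∷ (zs [ clamp w k ]≔ z) , refl , set!
        (λ j → trans (cong (λ f → f j) (lookup∘update (clamp w k) zs z)) (e j))
        (λ j j≤w j≢k → lookup∘update′ (j≢k ∘ clamp-injective w j≤w k≤w) zs z) refl }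

  record Test! (v : 𝒩) (ys ys′ : Vec 𝒩 (2 + w)) : Set where
    constructor test!
    field
      test-value : lookup ys′ zero ≗ v
      test-other : ∀ j → ys′ ! j ≡ ys ! j

  open Test! public

  test-total : ∀ t {i o a ys} → Total (assign 0 t) (store i o 0 a ys)
    (λ s → ∃[ ys′ ] s ≡ store i o 0 a ys′ × Test! (value t ys) ys ys′)
  test-total t {ys = y ∷ zs} = weaken (assign-total 0 t)
    λ { (z , e , refl) → z ∷ zs , refl , test! e λ _ → refl }

  predᵗ : Term
  predᵗ = ask zero (var #0) ∸ᵗ numᵗ 1

  value-pred : ∀ n ys → lookup ys zero ≗ (λ _ → suc n) → value predᵗ ys ≗ (λ _ → n)
  value-pred n ys e i = trans (eval-∸ ys (i ∷ []) (ask zero (var #0)) (numᵗ 1))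
    (cong₂ _∸_ (e i) (eval-num ys (i ∷ []) 1))

  -- This is how a number gets from a Baire tape to the master, who sees only whether the tape is
  -- zero: the tape holds the number as a constant sequence, which slaves count down while the
  -- register counts up.
  drain : Register → Instr
  drain c = whileNonzero (inc c ⨾ assign 0 predᵗ)

  drain-acc : ∀ n {i o a ys} → lookup ys zero ≗ (λ _ → n) → Total (drain acc) (store i o 0 a ys)
    (λ s → ∃[ ys′ ] s ≡ store i o 0 (n + a) ys′ × (∀ j → ys′ ! j ≡ ys ! j))
  drain-acc n {i} {o} {a} {ys} e =
    weaken (while-total I (λ { (ys′ , _ , refl , e , _) → e }) body {n}
      (ys , a , refl , e , refl , λ _ → refl))
      λ { (ys′ , a′ , refl , _ , refl , fr) → ys′ , refl , fr }
    where
    I : ℕ → St → Set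
    I k s = ∃[ ys′ ] ∃[ a′ ] s ≡ store i o 0 a′ ys′ × lookup ys′ zero ≗ (λ _ → k) × k + a′ ≡ n + a ×
            (∀ j → ys′ ! j ≡ ys ! j)
    body : ∀ {k s} → I (suc k) s →
           ¬ zeroTape s ≗ 0𝒩 × Total (inc acc ⨾ assign 0 predᵗ) s (I k)
    body {k} (ys′ , a′ , refl , e , eq , fr) = (λ z → case trans (sym (e 0)) (z 0) of λ ()) ,
      (inc-total ⨾ᵗ λ { refl → weaken (test-total predᵗ)
        λ { (ys″ , refl , test! v fr′) → ys″ , suc a′ , refl ,
            (λ j → trans (v j) (value-pred k ys′ e j)) , trans (+-suc k a′) eq ,
            λ j → trans (fr′ j) (fr j) } })
      where
      inc-total : Total (inc acc) (store i o 0 a′ ys′) (_≡ store i o 0 (suc a′) ys′)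
      inc-total = total (_ , inc) λ { inc → refl }

  drain-out : ∀ n {i o ys} → lookup ys zero ≗ (λ _ → n) → Total (drain out) (store i o 0 0 ys)
    (λ s → ∃[ ys′ ] s ≡ store i (n + o) 0 0 ys′)
  drain-out n {i} {o} {ys} e =
    weaken (while-total I (λ { (ys′ , _ , refl , e , _) → e }) body {n} (ys , o , refl , e , refl))
      λ { (ys′ , o′ , refl , _ , refl) → ys′ , refl }
    where
    I : ℕ → St → Set
    I k s = ∃[ ys′ ] ∃[ o′ ] s ≡ store i o′ 0 0 ys′ × lookup ys′ zero ≗ (λ _ → k) × k + o′ ≡ n + o
    body : ∀ {k s} → I (suc k) s →
           ¬ zeroTape s ≗ 0𝒩 × Total (inc out ⨾ assign 0 predᵗ) s (I k)
    body {k} (ys′ , o′ , refl , e , eq) = (λ z → case trans (sym (e 0)) (z 0) of λ ()) ,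
      (inc-total ⨾ᵗ λ { refl → weaken (test-total predᵗ)
        λ { (ys″ , refl , test! v fr′) → ys″ , suc o′ , refl ,
            (λ j → trans (v j) (value-pred k ys′ e j)) , trans (+-suc k o′) eq } })
      where
      inc-total : Total (inc out) (store i o′ 0 0 ys′) (_≡ store i (suc o′) 0 0 ys′)
      inc-total = total (_ , inc) λ { inc → refl }

  -- The number is collected in `acc` first, because the slave calls that count down the zero-test
  -- tape occupy the billboard.
  loadVar : ℕ → Instr
  loadVar v = assign 0 (tapeᵗ v zero) ⨾ drain acc ⨾ loop acc (inc bb)

  callVar : ℕ → ℕ → Instr
  callVar k v = loadVar v ⨾ call (suc k) ⨾ loop bb skip

  loadVar-total : ∀ v {i o ys} →
    Total (loadVar v) (store i o 0 0 ys)
      (λ s → ∃[ ys′ ] s ≡ store i o ((ys ! v) 0) 0 ys′ × (∀ j → ys′ ! j ≡ ys ! j))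
  loadVar-total v {i} {o} {ys} = test-total (tapeᵗ v zero) ⨾ᵗ λ { (ys₁ , refl , test! e fr) →
    drain-acc n {ys = ys₁} (λ j → trans (e j) (eval-tape v zero ys (j ∷ []))) ⨾ᵗ
      λ { (ys₂ , refl , fr′) →
    weaken (transfer-total (n + 0)) λ { refl → ys₂ ,
      cong (λ b → store i o b 0 ys₂) (trans (+-identityʳ (n + 0)) (+-identityʳ n)) ,
      λ j → trans (fr′ j) (fr j) } } }
    where
    n : ℕ
    n = (ys ! v) 0

  -- The oracles at the call agree with ys except on the zero-test tape.

  CallPost : List ℕ → ℕ → ℕ → ℕ → Vec 𝒩 (2 + w) → St → Set
  CallPost i o k v ys s = ∃[ xs ] ∃[ z ] ∃[ ys′ ] (∀ j → xs ! j ≡ ys ! j) × Φω xs ((ys ! v) 0) z ×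
    s ≡ store i o 0 0 ys′ × ys′ ! k ≡ z × (∀ j → j ≤ w → j ≢ k → ys′ ! j ≡ ys ! j)

  callVar-sound : ∀ k v {i o ys} → k ≤ w →
                  Sound (callVar k v) (store i o 0 0 ys) (CallPost i o k v ys)
  callVar-sound k v {i} {o} {ys} k≤w =
    seq-sound (sound (loadVar-total v {i} {o} {ys})) λ { (xs , refl , fr) → called xs fr }
    where
    called : ∀ xs → (∀ j → xs ! j ≡ ys ! j) →
             Sound (call (suc k) ⨾ loop bb skip) (store i o ((ys ! v) 0) 0 xs) (CallPost i o k v ys)
    called (y ∷ zs) fr (_⨾_ (call {z = z} φ) e) =
      y ∷ zs , z , y ∷ (zs [ clamp w k ]≔ z) , fr , φ ,
      sound (unload-total ((ys ! v) 0)) e ,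
      lookup∘update (clamp w k) zs z ,
      λ j j≤w j≢k → trans (lookup∘update′ (j≢k ∘ clamp-injective w j≤w k≤w) zs z) (fr j)

  callVar-halts : ∀ k v {i o ys} → (∀ xs → (∀ j → xs ! j ≡ ys ! j) → ∃[ z ] Φω xs ((ys ! v) 0) z) →
                  Halts (callVar k v) (store i o 0 0 ys)
  callVar-halts k v {i} {o} {ys} def =
    seq-halts (halts lv) (sound lv) λ { {s} (xs , refl , fr) →
      case def xs fr of λ { (z , φ) →
        case halts (unload-total ((ys ! v) 0) {0} {xs [ clamp (suc w) (suc k) ]≔ z}) of λ {
          (_ , e) →
          _ , call φ ⨾ e } } }
    where
    lv = loadVar-total v {i} {o} {ys}

-- From partial recursive functions to machines

-- A number is held by a Baire tape as its value at 0.

read : ∀ Y → 𝒩 → ⟦ Y ⟧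
read num z = z 0
read seq z = z

read-cong : ∀ Y {z z′} → z ≗ z′ → Eq Y (read Y z) (read Y z′)
read-cong num e = e 0
read-cong seq e = e

Eq-sym : ∀ Y {y z} → Eq Y y z → Eq Y z y
Eq-sym num e = sym e
Eq-sym seq e = sym ∘ e

module Implementation (w : ℕ) where

  open Baire w public

  Tapes : Set
  Tapes = Vec 𝒩 (2 + w)

  nums : ∀ {p} → Tapes → Vec ℕ p → Vec ℕ p
  nums ys = mapᵛ λ a → (ys ! a) 0

  seqs : ∀ {q} → Tapes → Vec ℕ q → Vec 𝒩 q
  seqs ys = mapᵛ (ys !_)

  -- Billboard and accumulator rest at 0 between programs; they are in use only within an assignment
  -- or an indirect call.
  pure : List ℕ → ℕ → Tapes → St
  pure i o ys = store i o 0 0 ys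

  record Below {n} (as : Vec ℕ n) (F : ℕ) : Set where
    constructor below
    field
      is-below : ∀ i → lookup as i < F

  open Below public

  nums-frame : ∀ {p F ys ys′} (as : Vec ℕ p) → Below as F → Frame F ys ys′ →
    nums ys′ as ≡ nums ys as
  nums-frame as as<F fr = map-cong-lookup _ _ as λ i →
    cong (λ z → z 0) (kept fr _ (is-below as<F i))

  seqs-frame : ∀ {q F ys ys′} (bs : Vec ℕ q) → Below bs F → Frame F ys ys′ →
    seqs ys′ bs ≡ seqs ys bs
  seqs-frame bs bs<F fr = map-cong-lookup _ _ bs λ i → kept fr _ (is-below bs<F i)

  set-frame : ∀ {k v f ys ys′} → k ≤ w → f ≤ k → Set! k v ys ys′ → Frame f ys ys′
  set-frame k≤w f≤k st .kept j j<f =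
    set-other st j (≤-trans (<⇒≤ (<-≤-trans j<f f≤k)) k≤w) (<⇒≢ (<-≤-trans j<f f≤k))

  module _ {p q Y} (f : PFun p q Y) (as : Vec ℕ p) (bs : Vec ℕ q) (F : ℕ) where

    Graph : Tapes → ⟦ Y ⟧ → Set
    Graph ys = graph f (nums ys as) (seqs ys bs)

    record Post (i : List ℕ) (o : ℕ) (ys : Tapes) (s : St) : Set where
      constructor post
      field
        after-tapes : Tapes
        is-pure     : s ≡ pure i o after-tapes
        framed      : Frame F ys after-tapes
        in-graph    : Graph ys (read Y (after-tapes ! F))

    -- Variables from `F` on are scratch space and `F` receives the result. `correct` covers runs
    -- for which no value was known beforehand: halting alone yields a point of the graph.
    record Implements (P : Instr) : Set where
      field
        correct    : ∀ {i o ys} → Sound P (pure i o ys) (Post i o ys)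
        terminates : ∀ {i o ys y} → Graph ys y → Halts P (pure i o ys)

    graph-frame : Below as F → Below bs F → ∀ {ys ys′ y} → Frame F ys ys′ → Graph ys′ y → Graph ys y
    graph-frame as<F bs<F {y = y} fr =
      subst₂ (λ n x → graph f n x y) (nums-frame as as<F fr) (seqs-frame bs bs<F fr)

    graph-frame⁻ : Below as F → Below bs F → ∀ {ys ys′ y} → Frame F ys ys′ → Graph ys y →
      Graph ys′ y
    graph-frame⁻ as<F bs<F {y = y} fr =
      subst₂ (λ n x → graph f n x y) (sym (nums-frame as as<F fr)) (sym (seqs-frame bs bs<F fr))

  open Implements public

  implements-assign : ∀ {p q Y} (f : PFun p q Y) as bs F t → F ≤ w →
    (∀ {ys y} → Eq Y (read Y (value t ys)) y → Graph f as bs F ys y) →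
    Implements f as bs F (assign (suc F) t)
  implements-assign {Y = Y} f as bs F t F≤w g .correct e =
    case sound (set-total F t F≤w) e of λ { (ys′ , refl , st) →
      post ys′ refl (set-frame F≤w ≤-refl st) (g (read-cong Y (sym ∘ set-value st))) }
  implements-assign f as bs F t F≤w g .terminates _ = halts (set-total F t F≤w)

  renamedOracles : ∀ {q} → Vec ℕ q → Vec (Fin (2 + w)) q
  renamedOracles = mapᵛ (suc ∘ clamp w)

  lookup-renamed : ∀ {q} (xs : Tapes) (bs : Vec ℕ q) →
    mapᵛ (lookup xs) (renamedOracles bs) ≡ seqs xs bs
  lookup-renamed (y ∷ zs) bs = sym (map-∘ (lookup (y ∷ zs)) (suc ∘ clamp w) bs)

  -- The translated index waits in variable `F`, which the call then overwrites with its result.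
  -- This is harmless to the oracles, as those of the original program are variables below `F`.
  callProgram : ∀ {q} → ℕ → Vec ℕ q → ℕ → Instr
  callProgram a bs F =
    assign (suc F) (newMachineᵗ (renamedOracles bs) (tapeᵗ a zero)) ⨾ callVar F F

  implements-Ψ : ∀ {q} a (bs : Vec ℕ q) F → F ≤ w → Below bs F →
                 Implements (Ψ q) (a ∷ []) bs F (callProgram a bs F)
  implements-Ψ {q} a bs F F≤w bs<F = λ where
      .correct {i} {o} {ys} → seq-sound {B = Post (Ψ q) (a ∷ []) bs F i o ys}
        (sound (set-total F t {ys = ys} F≤w)) λ { (ys₁ , refl , st) {s} e →
        case callVar-sound F F F≤w e of λ { (xs , z , ys₂ , fr , φ , refl , refl , fr′) →
          post ys₂ refl
          (frame λ k k<F → trans (fr′ k (≤-trans (<⇒≤ k<F) F≤w) (<⇒≢ k<F))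
            (kept (set-frame F≤w ≤-refl st) k k<F))
          λ j → subst (λ x → Φ x ((ys ! a) 0) j (z j)) (oracles xs ys₁ ys fr st)
            (Renaming.Φ-rename⁻ js xs {(ys ! a) 0}
              (subst (λ e → Φ xs e j (z j)) (code ys ys₁ st) (φ j))) } }
      .terminates {i} {o} {ys} {y} φ →
        seq-halts (halts (set-total F t F≤w)) (sound (set-total F t F≤w))
        λ { (ys₁ , refl , st) → callVar-halts F F λ xs fr → y , λ j →
          subst (λ e → Φ xs e j (y j)) (sym (code ys ys₁ st))
            (Renaming.Φ-rename js xs {(ys ! a) 0}
              (subst (λ x → Φ x ((ys ! a) 0) j (y j)) (sym (oracles xs ys₁ ys fr st)) (φ j))) }
    where
    js : Vec (Fin (2 + w)) q
    js = renamedOracles bs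
    t : Term
    t = newMachineᵗ js (tapeᵗ a zero)
    oracles : ∀ xs ys₁ ys → (∀ j → xs ! j ≡ ys₁ ! j) → Set! F (value t ys) ys ys₁ →
              mapᵛ (lookup xs) js ≡ seqs ys bs
    oracles xs ys₁ ys fr st = trans (lookup-renamed xs bs)
      (seqs-frame {ys = ys} {xs} bs bs<F
        (frame λ k k<F → trans (fr k) (kept (set-frame F≤w ≤-refl st) k k<F)))
    code : ∀ ys ys₁ → Set! F (value t ys) ys ys₁ →
           (ys₁ ! F) 0 ≡ Renaming.newMachine js ((ys ! a) 0)
    code ys ys₁ st = trans (set-value st 0) (trans (eval-newMachine js ys (0 ∷ []) (tapeᵗ a zero))
      (cong (Renaming.newMachine js) (eval-tape a zero ys (0 ∷ []))))

  -- A conditional in the guise of a loop of at most one round: the body sets the answer to 0 and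
  -- clears the zero-test tape.
  zeroTestProgram : ℕ → ℕ → Instr
  zeroTestProgram b F = assign 0 (tapeᵗ b (var #0)) ⨾ assign (suc F) (numᵗ 1) ⨾
    whileNonzero (assign (suc F) zero ⨾ assign 0 zero)

  implements-χ : ∀ b F → F ≤ w → b < F → Implements χ [] (b ∷ []) F (zeroTestProgram b F)
  implements-χ b F F≤w b<F = λ where
      .correct {i} {o} {ys} → seq-sound
        (sound (test-total (tapeᵗ b (var #0)))) λ { (ys₁ , refl , te) →
        seq-sound (sound (set-total F (numᵗ 1) F≤w)) λ { (ys₂ , refl , st) e →
          finish te st e } }
      .terminates {i} {o} {ys} {y} g → seq-halts (halts (test-total (tapeᵗ b (var #0))))
        (sound (test-total (tapeᵗ b (var #0)))) λ { (ys₁ , refl , te) →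
        seq-halts (halts (set-total F (numᵗ 1) F≤w))
          (sound (set-total F (numᵗ 1) F≤w)) λ { (ys₂ , refl , st) →
          loops te st g } }
    where
    body-total : ∀ {i o ys} → Total (assign (suc F) zero ⨾ assign 0 zero) (pure i o ys)
      (λ s → ∃[ ys′ ] s ≡ pure i o ys′ × Frame F ys ys′ × lookup ys′ zero ≗ 0𝒩 × ys′ ! F ≗ 0𝒩)
    body-total = set-total F zero F≤w ⨾ᵗ λ { (ys₁ , refl , st) → weaken (test-total zero)
      λ { (ys₂ , refl , te) → ys₂ , refl ,
          (frame λ k k<F → trans (test-other te k) (kept (set-frame F≤w ≤-refl st) k k<F)) ,
            test-value te ,
          λ j → trans (cong (λ f → f j) (test-other te F)) (set-value st j) } }
    tested-tape : ∀ {ys ys₁ ys₂} → Test! (value (tapeᵗ b (var #0)) ys) ys ys₁ →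
                  Set! F (value (numᵗ 1) ys₁) ys₁ ys₂ → lookup ys₂ zero ≗ ys ! b
    tested-tape {ys} te st j = trans (cong (λ f → f j) (set-zero st))
      (trans (test-value te j) (eval-tape b (var #0) ys (j ∷ [])))
    finish : ∀ {i o ys ys₁ ys₂ s} → Test! (value (tapeᵗ b (var #0)) ys) ys ys₁ →
             Set! F (value (numᵗ 1) ys₁) ys₁ ys₂ →
             Exec (whileNonzero (assign (suc F) zero ⨾ assign 0 zero)) (pure i o ys₂) s →
             Post χ [] (b ∷ []) F i o ys s
    finish {ys = ys} {ys₁} {ys₂} te st (zero-stop z) = post ys₂ refl
      (frame λ k k<F → trans (kept (set-frame F≤w ≤-refl st) k k<F) (test-other te k))
      (inj₁ ((λ j → trans (sym (tested-tape te st j)) (z j)) ,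
             trans (set-value st 0) (eval-num ys₁ (0 ∷ []) 1)))
    finish te st (zero-go nz e e′) with sound body-total e
    finish te st (zero-go nz e (zero-stop _)) | ys₃ , refl , fr , z , F≡0 = post ys₃ refl
      (frame λ k k<F → trans (kept fr k k<F)
        (trans (kept (set-frame F≤w ≤-refl st) k k<F) (test-other te k)))
      (inj₂ ((λ z′ → nz λ j → trans (tested-tape te st j) (z′ j)) , F≡0 0))
    finish te st (zero-go nz e (zero-go nz′ _ _)) | ys₃ , refl , fr , z , F≡0 = ⊥-elim (nz′ z)
    loops : ∀ {i o ys ys₁ ys₂ y} → Test! (value (tapeᵗ b (var #0)) ys) ys ys₁ →
            Set! F (value (numᵗ 1) ys₁) ys₁ ys₂ → IsZeroTest (ys ! b) y →
            Halts (whileNonzero (assign (suc F) zero ⨾ assign 0 zero)) (pure i o ys₂)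
    loops te st (inj₁ (z , _)) = _ , zero-stop λ j → trans (tested-tape te st j) (z j)
    loops {ys₂ = ys₂} te st (inj₂ (nz , _)) = case halts (body-total {ys = ys₂}) of λ { (_ , e) →
      case sound (body-total {ys = ys₂}) e of λ { (ys₃ , refl , _ , z , _) →
        _ , zero-go (λ z′ → nz λ j → trans (sym (tested-tape te st j)) (z′ j)) e (zero-stop z) } }

  seqAll : ∀ n → (Fin n → ℕ → Instr) → ℕ → Instr
  seqAll zero    c F = skip
  seqAll (suc n) c F = c zero F ⨾ seqAll n (c ∘ suc) (suc F)

  module _ {p q : ℕ} {Y : Codomain} (as : Vec ℕ p) (bs : Vec ℕ q) where

    record FamilyPost (n : ℕ) (g : Fin n → PFun p q Y) (F : ℕ) (i : List ℕ) (o : ℕ) (ys : Tapes)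
                      (s : St) : Set where
      constructor familyPost
      field
        after-tapes : Tapes
        is-pure     : s ≡ pure i o after-tapes
        framed      : Frame F ys after-tapes
        in-graphs   : ∀ j → Graph (g j) as bs F ys (read Y (after-tapes ! lookup (regs F n) j))

    -- By recursion on `n`, because each further program works one variable higher, beyond the
    -- results already obtained.
    AllImplement : ∀ n → (Fin n → PFun p q Y) → (Fin n → ℕ → Instr) → ℕ → Set
    AllImplement zero    g c F = ⊤
    AllImplement (suc n) g c F =
      Implements (g zero) as bs F (c zero F) × AllImplement n (g ∘ suc) (c ∘ suc) (suc F)

    Below-suc : ∀ {n} {cs : Vec ℕ n} {F} → Below cs F → Below cs (suc F)
    Below-suc cs<F .is-below i = <-trans (is-below cs<F i) (n<1+n _)

    family-correct : ∀ n {g c} F → Below as F → Below bs F → AllImplement n g c F →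
                     ∀ {i o ys} → Sound (seqAll n c F) (pure i o ys) (FamilyPost n g F i o ys)
    family-correct zero F as<F bs<F _ skip = familyPost _ refl Frame-refl λ ()
    family-correct (suc n) {g} {c} F as<F bs<F (impl , impls) {i} {o} {ys} =
      seq-sound {B = FamilyPost (suc n) g F i o ys} (correct impl) λ { (post ys₁ refl fr γ) e →
        case family-correct n (suc F) (Below-suc as<F) (Below-suc bs<F) impls e of
          λ { (familyPost ys₂ refl fr′ γs) →
            familyPost ys₂ refl (Frame-trans (n≤1+n F) fr fr′) λ where
              zero    → subst (λ z → Graph (g zero) as bs F ys (read Y z))
                (sym (kept fr′ F (n<1+n F))) γ
              (suc j) → graph-frame (g (suc j)) as bs F as<F bs<F fr (γs j) } }

    family-terminates : ∀ n {g c} F → Below as F → Below bs F → AllImplement n g c F →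
                        ∀ {i o ys} → (∀ j → ∃[ y ] Graph (g j) as bs F ys y) →
                        Halts (seqAll n c F) (pure i o ys)
    family-terminates zero F as<F bs<F _ _ = _ , skip
    family-terminates (suc n) {g} F as<F bs<F (impl , impls) γ =
      seq-halts (terminates impl (proj₂ (γ zero))) (correct impl) λ { (post ys₁ refl fr _) →
        family-terminates n (suc F) (Below-suc as<F) (Below-suc bs<F) impls
          λ j → proj₁ (γ (suc j)) ,
            graph-frame⁻ (g (suc j)) as bs F as<F bs<F fr (proj₂ (γ (suc j))) }

-- Composition and primitive recursion on Baire tapes

module Loops (w : ℕ) where

  open Implementation w public

  Frame-≤ : ∀ {f g ys ys′} → f ≤ g → Frame g ys ys′ → Frame f ys ys′
  Frame-≤ f≤g fr .kept k k<f = kept fr k (<-≤-trans k<f f≤g)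

  infixr 20 _▹_

  _▹_ : ∀ {f xs ys zs} → Frame f xs ys → Frame f ys zs → Frame f xs zs
  _▹_ = Frame-trans ≤-refl

  test-frame : ∀ {v f ys ys′} → Test! v ys ys′ → Frame f ys ys′
  test-frame te .kept k _ = test-other te k

  module _ {p q p′ q′ Y} (f : PFun p q Y) (g : Fin p → PFun p′ q′ num) (h : Fin q → PFun p′ q′ seq)
           (as : Vec ℕ p′) (bs : Vec ℕ q′) (F : ℕ)
           (cg : Fin p → ℕ → Instr) (ch : Fin q → ℕ → Instr) (P : Instr) where

    private
      F₂ F₃ : ℕ
      F₂ = p + suc F
      F₃ = q + F₂

    -- `F` is kept free for the end. The inner values take the consecutive variables from `suc F`
    -- on, which the outer program reads as its arguments.
    composeProgram : Instr
    composeProgram = seqAll p cg (suc F) ⨾ seqAll q ch F₂ ⨾ P ⨾ assign (suc F) (tapeᵗ F₃ (var #0))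

    module _ (F₃≤w : F₃ ≤ w) (as<F : Below as F) (bs<F : Below bs F)
             (gs : AllImplement as bs p g cg (suc F)) (hs : AllImplement as bs q h ch F₂)
             (fi : Implements f (regs (suc F) p) (regs F₂ q) F₃ P) where

      private
        F<F₂ : F < F₂
        F<F₂ = m≤n+m (suc F) p
        F₂≤F₃ : F₂ ≤ F₃
        F₂≤F₃ = m≤n+m F₂ q
        F≤w : F ≤ w
        F≤w = ≤-trans (<⇒≤ F<F₂) (≤-trans F₂≤F₃ F₃≤w)
        Below-≤ : ∀ {n} {cs : Vec ℕ n} {F′} → F ≤ F′ → Below cs F → Below cs F′
        Below-≤ F≤F′ cs<F .is-below i = <-≤-trans (is-below cs<F i) F≤F′
        as<₁ = Below-≤ (n≤1+n F) as<F
        bs<₁ = Below-≤ (n≤1+n F) bs<F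
        as<₂ = Below-≤ (<⇒≤ F<F₂) as<F
        bs<₂ = Below-≤ (<⇒≤ F<F₂) bs<F

        args : ∀ {ys ys₁ ys₂} → Frame F₂ ys₁ ys₂ → Frame (suc F) ys ys₁ →
               (∀ j → Graph (g j) as bs (suc F) ys (read num (ys₁ ! lookup (regs (suc F) p) j))) →
               (∀ j → Graph (h j) as bs F₂ ys₁ (read seq (ys₂ ! lookup (regs F₂ q) j))) →
               (∀ i → Graph (g i) as bs F ys (lookup (nums ys₂ (regs (suc F) p)) i)) ×
               (∀ j → Graph (h j) as bs F ys (lookup (seqs ys₂ (regs F₂ q)) j))
        args {ys} {ys₁} {ys₂} fr₂ fr₁ γ₁ γ₂ =
          (λ i → subst (Graph (g i) as bs F ys)
            (trans (sym (cong (λ z → z 0) (kept fr₂ _ (regs-< (suc F) p i))))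
                   (sym (lookup-map i (λ a → (ys₂ ! a) 0) (regs (suc F) p)))) (γ₁ i)) ,
          (λ j → subst (Graph (h j) as bs F ys) (sym (lookup-map j (ys₂ !_) (regs F₂ q)))
            (graph-frame (h j) as bs (suc F) as<₁ bs<₁ fr₁ (γ₂ j)))

      implements-compose : Implements (compose f g h) as bs F composeProgram
      implements-compose .correct {i} {o} {ys} =
        seq-sound {B = Post (compose f g h) as bs F i o ys}
          (family-correct as bs p (suc F) as<₁ bs<₁ gs)
          λ { (familyPost ys₁ refl fr₁ γ₁) →
            seq-sound {B = Post (compose f g h) as bs F i o ys}
              (family-correct as bs q F₂ as<₂ bs<₂ hs)
              λ { (familyPost ys₂ refl fr₂ γ₂) →
                seq-sound {B = Post (compose f g h) as bs F i o ys}
                  (correct fi) λ { (post ys₃ refl fr₃ φ) e →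
                  case sound (set-total F (tapeᵗ F₃ (var #0)) F≤w) e of λ { (ys₄ , refl , st) →
                    post ys₄ refl
                      (Frame-≤ (n≤1+n F) fr₁ ▹ Frame-≤ (<⇒≤ F<F₂) fr₂ ▹
                       Frame-≤ (≤-trans (<⇒≤ F<F₂) F₂≤F₃) fr₃ ▹ set-frame F≤w ≤-refl st)
                      ( nums ys₂ (regs (suc F) p) , seqs ys₂ (regs F₂ q)
                      , proj₁ (args fr₂ fr₁ γ₁ γ₂) , proj₂ (args fr₂ fr₁ γ₁ γ₂)
                      , respects f ≋-refl (read-cong Y λ j →
                        sym (trans (set-value st j) (eval-tape F₃ (var #0) ys₃
                        (j ∷ [])))) φ) } } } }
      implements-compose .terminates {i} {o} {ys} (n , x , G , H , γ) =
        seq-halts (family-terminates as bs p (suc F) as<₁ bs<₁ gs λ j → _ , G j)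
                  (family-correct as bs p (suc F) as<₁ bs<₁ gs)
          λ { (familyPost ys₁ refl fr₁ γ₁) →
            seq-halts (family-terminates as bs q F₂ as<₂ bs<₂ hs
                         λ j → _ , graph-frame⁻ (h j) as bs (suc F) as<₁ bs<₁ fr₁ (H j))
                      (family-correct as bs q F₂ as<₂ bs<₂ hs)
              λ { (familyPost ys₂ refl fr₂ γ₂) →
                seq-halts (terminates fi (outer fr₂ fr₁ γ₁ γ₂)) (correct fi)
                  λ { (post ys₃ refl _ _) → halts (set-total F (tapeᵗ F₃ (var #0)) F≤w) } } }
        where
        -- The inner programs leave values of their own; functionality identifies them with the
        -- given `n`, and pointwise with the given `x`.
        outer : ∀ {ys₁ ys₂} → Frame F₂ ys₁ ys₂ → Frame (suc F) ys ys₁ →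
               (∀ j → Graph (g j) as bs (suc F) ys (read num (ys₁ ! lookup (regs (suc F) p) j))) →
               (∀ j → Graph (h j) as bs F₂ ys₁ (read seq (ys₂ ! lookup (regs F₂ q) j))) →
               Graph f (regs (suc F) p) (regs F₂ q) F₃ ys₂ _
        outer {ys₁} {ys₂} fr₂ fr₁ γ₁ γ₂ = subst (λ n → graph f n (seqs ys₂ (regs F₂ q)) _)
          (lookup-ext λ i → functional (g i) (G i) (proj₁ (args fr₂ fr₁ γ₁ γ₂) i))
          (respects f (lookup-≋ λ j → functional (h j) (H j) (proj₂ (args fr₂ fr₁ γ₁ γ₂) j))
            (eqRefl Y) γ)

  -- Loops counting the tape 1 + F down to 0 while tape 2 + F counts up

  constᵗ : ℕ → Term
  constᵗ k = tapeᵗ k zero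

  copyᵗ : ℕ → Term
  copyᵗ k = tapeᵗ k (var #0)

  sucᵗ : ℕ → Term
  sucᵗ k = suc (tapeᵗ k zero)

  value-suc : ∀ k ys j → value (sucᵗ k) ys j ≡ suc ((ys ! k) 0)
  value-suc k ys j = cong suc (eval-tape k zero ys (j ∷ []))

  decᵗ : ℕ → Term
  decᵗ k = tapeᵗ k zero ∸ᵗ numᵗ 1

  value-dec : ∀ k ys j → value (decᵗ k) ys j ≡ (ys ! k) 0 ∸ 1
  value-dec k ys j = trans (eval-∸ ys (j ∷ []) (tapeᵗ k zero) (numᵗ 1))
    (cong₂ _∸_ (eval-tape k zero ys (j ∷ [])) (eval-num ys (j ∷ []) 1))

  at-0 : ∀ {z z′ : 𝒩} → z ≡ z′ → z 0 ≡ z′ 0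
  at-0 = cong λ z → z 0

  module RecursionCode (F : ℕ) where

    -- `assign` numbers the Baire tapes while terms number the variables, so `assign (2 + F)` sets
    -- variable `1 + F`.
    setup : ℕ → Instr
    setup a = assign (2 + F) (constᵗ a) ⨾ assign (3 + F) zero ⨾ assign 0 (constᵗ (1 + F))

    update : Instr
    update = assign (1 + F) (copyᵗ (3 + F)) ⨾ assign (3 + F) (sucᵗ (2 + F)) ⨾
             assign (2 + F) (decᵗ (1 + F)) ⨾ assign 0 (constᵗ (1 + F))

    recProgram : ℕ → Instr → Instr → Instr
    recProgram a P Q = P ⨾ setup a ⨾ whileNonzero (Q ⨾ update)

  module Recursion (F : ℕ) (F≤w : 3 + F ≤ w) where

    open RecursionCode F

    private
      0<1 = n<1+n F
      1<2 = n<1+n (1 + F)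
      2<3 = n<1+n (2 + F)
      0<2 = <-trans 0<1 1<2
      0<3 = <-trans 0<2 2<3
      1<3 = <-trans 1<2 2<3
      2≤w = ≤-trans (n≤1+n (2 + F)) F≤w
      1≤w = ≤-trans (n≤1+n (1 + F)) 2≤w
      0≤w = ≤-trans (n≤1+n F) 1≤w

    record SetUp (a : ℕ) (ys ys′ : Tapes) : Set where
      field
        framed    : Frame (suc F) ys ys′
        remaining : (ys′ ! (1 + F)) 0 ≡ (ys ! a) 0
        counted   : (ys′ ! (2 + F)) 0 ≡ 0
        tested    : lookup ys′ zero ≗ λ _ → (ys ! a) 0

    setup-total : ∀ a {i o ys} → Total (setup a) (pure i o ys)
      (λ s → ∃[ ys′ ] s ≡ pure i o ys′ × SetUp a ys ys′)
    setup-total a {i} {o} {ys} =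
      set-total (1 + F) (constᵗ a) 1≤w ⨾ᵗ λ { (ys₁ , refl , s₁) →
      set-total (2 + F) zero 2≤w ⨾ᵗ λ { (ys₂ , refl , s₂) →
      weaken (test-total (constᵗ (1 + F))) λ { (ys₃ , refl , t) → ys₃ , refl , done s₁ s₂ t } } }
      where
      done : ∀ {ys₁ ys₂ ys₃} → Set! (1 + F) (value (constᵗ a) ys) ys ys₁ →
        Set! (2 + F) (value zero ys₁) ys₁ ys₂ →
             Test! (value (constᵗ (1 + F)) ys₂) ys₂ ys₃ → SetUp a ys ys₃
      done {ys₁} {ys₂} {ys₃} s₁ s₂ t = record
        { framed    = set-frame 1≤w ≤-refl s₁ ▹ set-frame 2≤w (n≤1+n _) s₂ ▹ test-frame t
        ; remaining = trans (at-0 (test-other t (1 + F))) rem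
        ; counted   = trans (at-0 (test-other t (2 + F))) (set-value s₂ 0)
        ; tested    = λ j → trans (test-value t j) (trans (eval-tape (1 + F) zero ys₂ (j ∷ [])) rem)
        }
        where
        rem : (ys₂ ! (1 + F)) 0 ≡ (ys ! a) 0
        rem = trans (at-0 (set-other s₂ (1 + F) 1≤w (<⇒≢ 1<2)))
                    (trans (set-value s₁ 0) (eval-tape a zero ys (0 ∷ [])))

    record Updated (ys ys′ : Tapes) : Set where
      field
        framed    : Frame F ys ys′
        result    : ys′ ! F ≗ ys ! (3 + F)
        remaining : (ys′ ! (1 + F)) 0 ≡ (ys ! (1 + F)) 0 ∸ 1
        counted   : (ys′ ! (2 + F)) 0 ≡ suc ((ys ! (2 + F)) 0)
        tested    : lookup ys′ zero ≗ λ _ → (ys ! (1 + F)) 0 ∸ 1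

    update-total : ∀ {i o ys} → Total update (pure i o ys)
      (λ s → ∃[ ys′ ] s ≡ pure i o ys′ × Updated ys ys′)
    update-total {i} {o} {ys} =
      set-total F (copyᵗ (3 + F)) 0≤w ⨾ᵗ λ { (ys₁ , refl , s₁) →
      set-total (2 + F) (sucᵗ (2 + F)) 2≤w ⨾ᵗ λ { (ys₂ , refl , s₂) →
      set-total (1 + F) (decᵗ (1 + F)) 1≤w ⨾ᵗ λ { (ys₃ , refl , s₃) →
      weaken (test-total (constᵗ (1 + F))) λ { (ys₄ , refl , t) → ys₄ , refl ,
        done s₁ s₂ s₃ t } } } }
      where
      done : ∀ {ys₁ ys₂ ys₃ ys₄} → Set! F (value (copyᵗ (3 + F)) ys) ys ys₁ →
             Set! (2 + F) (value (sucᵗ (2 + F)) ys₁) ys₁ ys₂ →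
             Set! (1 + F) (value (decᵗ (1 + F)) ys₂) ys₂ ys₃ →
             Test! (value (constᵗ (1 + F)) ys₃) ys₃ ys₄ → Updated ys ys₄
      done {ys₁} {ys₂} {ys₃} {ys₄} s₁ s₂ s₃ t = record
        { framed    = set-frame 0≤w ≤-refl s₁ ▹ set-frame 2≤w (<⇒≤ 0<2) s₂ ▹
          set-frame 1≤w (<⇒≤ 0<1) s₃ ▹ test-frame t
        ; result    = λ j → trans (cong (λ z → z j) (trans (test-other t F)
                        (trans (set-other s₃ F 0≤w (<⇒≢ 0<1)) (set-other s₂ F 0≤w (<⇒≢ 0<2)))))
                        (trans (set-value s₁ j) (eval-tape (3 + F) (var #0) ys (j ∷ [])))
        ; remaining = trans (at-0 (test-other t (1 + F))) rem
        ; counted   = trans (at-0 (trans (test-other t (2 + F))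
          (set-other s₃ (2 + F) 2≤w (≢-sym (<⇒≢ 1<2)))))
                        (trans (set-value s₂ 0) (trans (value-suc (2 + F) ys₁ 0)
                          (cong suc (at-0 (set-other s₁ (2 + F) 2≤w (≢-sym (<⇒≢ 0<2)))))))
        ; tested    = λ j → trans (test-value t j) (trans (eval-tape (1 + F) zero ys₃ (j ∷ [])) rem)
        }
        where
        rem : (ys₃ ! (1 + F)) 0 ≡ (ys ! (1 + F)) 0 ∸ 1
        rem = trans (set-value s₃ 0) (trans (value-dec (1 + F) ys₂ 0)
          (cong (_∸ 1) (at-0 (trans (set-other s₂ (1 + F) 1≤w (<⇒≢ 1<2))
            (set-other s₁ (1 + F) 1≤w (≢-sym (<⇒≢ 0<1)))))))

    -- R k v says that v is the value after k rounds.

    module _ {Y} (ys₀ : Tapes) (R : ℕ → ⟦ Y ⟧ → Set) where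

      AtRound : ℕ → Tapes → Set
      AtRound k ys = Frame F ys₀ ys × R k (read Y (ys ! F)) × (ys ! (2 + F)) 0 ≡ k

      record Invariant (i : List ℕ) (o : ℕ) (K n : ℕ) (s : St) : Set where
        constructor invariant
        field
          {round}   : ℕ
          tapes     : Tapes
          is-pure   : s ≡ pure i o tapes
          at-round  : AtRound round tapes
          remaining : (tapes ! (1 + F)) 0 ≡ n
          total-is  : n + round ≡ K
          tested    : lookup tapes zero ≗ λ _ → n

      module _ (Q : Instr) (R-resp : ∀ k {v v′} → Eq Y v v′ → R k v → R k v′)
               (Q-correct : ∀ {k i o ys} → AtRound k ys → Sound Q (pure i o ys)
                  (λ s → ∃[ ys′ ] s ≡ pure i o ys′ × Frame (3 + F) ys ys′ × R (suc k)
                    (read Y (ys′ ! (3 + F))))) where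

        round-correct : ∀ {i o K n s} → Invariant i o K (suc n) s →
          Sound (Q ⨾ update) s (Invariant i o K n)
        round-correct {i} {o} {K} {n} (invariant {k} ys refl at@(fr , r , c) rem tot tst) =
          seq-sound {B = Invariant i o K n} (Q-correct at) λ { (ys₁ , refl , fr₁ , r₁) e →
            case sound update-total e of λ { (ys₂ , refl , u) →
              let open Updated u renaming (remaining to rem′; tested to tst′)
                  n≡ : (ys₁ ! (1 + F)) 0 ∸ 1 ≡ n
                  n≡ = cong (_∸ 1) (trans (at-0 (kept fr₁ (1 + F) 1<3)) rem)
              in invariant ys₂ refl
                (fr ▹ Frame-≤ (<⇒≤ 0<3) fr₁ ▹ framed
                , R-resp (suc k) (read-cong Y (sym ∘ result)) r₁
                , trans counted (cong suc (trans (at-0 (kept fr₁ (2 + F) 2<3)) c)))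
                (trans rem′ n≡) (trans (+-suc n k) tot) (λ j → trans (tst′ j) n≡) } }

        nonzero : ∀ {i o K n s} → Invariant i o K (suc n) s → ¬ zeroTape s ≗ 0𝒩
        nonzero (invariant ys refl _ _ _ tst) z = case trans (sym (tst 0)) (z 0) of λ ()

        rounds-correct : ∀ {i o K n s} → Invariant i o K n s →
                         Sound (whileNonzero (Q ⨾ update)) s (Invariant i o K 0)
        rounds-correct {n = zero}  inv (zero-stop _)    = inv
        rounds-correct {n = zero}  (invariant ys refl _ _ _ tst) (zero-go nz _ _) = ⊥-elim (nz tst)
        rounds-correct {n = suc n} inv (zero-stop z)    = ⊥-elim (nonzero inv z)
        rounds-correct {n = suc n} inv (zero-go _ e e′) = rounds-correct (round-correct inv e) e′

        rounds-terminate : (∀ {k i o ys} → AtRound k ys → (∃[ v ] R (suc k) v) →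
          Halts Q (pure i o ys)) →
          ∀ {i o K} → (∀ k → k < K → ∃[ v ] R (suc k) v) →
          ∀ {n s} → Invariant i o K n s → Halts (whileNonzero (Q ⨾ update)) s
        rounds-terminate Q-halts {i} {o} {K} defined = while-halts (Invariant i o K)
          (λ { (invariant ys refl _ _ _ tst) → tst })
          -- Rounds left and rounds done add up to `K`; with at least one left, `k < K` and the next
          -- value is at hand.
          λ { {n} inv@(invariant {k} ys refl at _ tot _) → nonzero inv ,
              seq-halts (Q-halts at (defined k (subst (k <_) tot (s≤s (m≤n+m k n))))) (Q-correct at)
                (λ { (ys₁ , refl , _) → halts update-total }) ,
              round-correct inv }

    module _ (a : ℕ) (a<F : a < F) where

      private
        started : ∀ {Y ys₀ ys₁ ys₂} (R : ℕ → ⟦ Y ⟧ → Set) {i o} →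
                  Frame F ys₀ ys₁ → R 0 (read Y (ys₁ ! F)) → SetUp a ys₁ ys₂ →
                  Invariant {Y} ys₀ R i o ((ys₀ ! a) 0) ((ys₀ ! a) 0) (pure i o ys₂)
        started {Y} {ys₀} {ys₁} {ys₂} R fr r su = invariant ys₂ refl
          (fr ▹ Frame-≤ (n≤1+n F) framed ,
           subst (λ z → R 0 (read Y z)) (sym (kept framed F (n<1+n F))) r , counted)
          (trans remaining a≡) (+-identityʳ _) (λ j → trans (tested j) a≡)
          where
          open SetUp su
          a≡ : (ys₁ ! a) 0 ≡ (ys₀ ! a) 0
          a≡ = at-0 (kept fr a a<F)

      module _ {p q Y} (G : PFun p q Y) (as : Vec ℕ p) (bs : Vec ℕ q) (P Q : Instr)
               (impl : Implements G as bs F P) (ys₀ : Tapes) (R : ℕ → ⟦ Y ⟧ → Set)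
               (R-resp : ∀ k {v v′} → Eq Y v v′ → R k v → R k v′)
               (R-zero : ∀ {v} → Graph G as bs F ys₀ v → R 0 v)
               (Q-correct : ∀ {k i o ys} → AtRound ys₀ R k ys → Sound Q (pure i o ys)
                  (λ s → ∃[ ys′ ] s ≡ pure i o ys′ × Frame (3 + F) ys ys′ × R (suc k)
                    (read Y (ys′ ! (3 + F)))))
               where

        rec-correct : ∀ {i o s} → Exec (recProgram a P Q) (pure i o ys₀) s →
                      ∃[ ys ] s ≡ pure i o ys × Frame F ys₀ ys × R ((ys₀ ! a) 0) (read Y (ys ! F))
        rec-correct {i} {o} (e ⨾ e₁ ⨾ e₂) with correct impl e
        ... | post ys₁ refl fr γ with sound (setup-total a) e₁
        ... | ys₂ , refl , su
          with rounds-correct ys₀ R Q R-resp Q-correct (started R fr (R-zero γ) su) e₂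
        ... | invariant ys₃ refl (fr₃ , r , _) _ refl _ = ys₃ , refl , fr₃ , r

        rec-terminates : (∀ {k i o ys} → AtRound ys₀ R k ys → (∃[ v ] R (suc k) v) →
          Halts Q (pure i o ys)) →
          (∃[ v ] Graph G as bs F ys₀ v) → (∀ k → k < (ys₀ ! a) 0 → ∃[ v ] R (suc k) v) →
          ∀ {i o} → Halts (recProgram a P Q) (pure i o ys₀)
        rec-terminates Q-halts (_ , γ) defined {i} {o} =
          seq-halts (terminates impl γ) (correct impl) λ { (post ys₁ refl fr γ) →
            seq-halts (halts (setup-total a)) (sound (setup-total a)) λ { (ys₂ , refl , su) →
              rounds-terminate ys₀ R Q R-resp Q-correct Q-halts defined
                (started R fr (R-zero γ) su) } }

-- Minimisation and the translation of partial recursive functions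

module Translation (w : ℕ) where

  open Loops w public

  module Minimisation {p q} (G : PFun (suc p) q num) (as : Vec ℕ p) (bs : Vec ℕ q) (F : ℕ)
    (P : Instr) where

    probe minProgram : Instr
    probe = P ⨾ assign 0 (constᵗ (1 + F))
    minProgram = assign (1 + F) zero ⨾ probe ⨾ whileNonzero (assign (1 + F) (sucᵗ F) ⨾ probe)

    module _ (F≤w : 1 + F ≤ w) (as<F : Below as F) (bs<F : Below bs F)
             (impl : Implements G (F ∷ as) bs (1 + F) P) (i : List ℕ) (o : ℕ) (ys₀ : Tapes) where

      private
        0≤w : F ≤ w
        0≤w = ≤-trans (n≤1+n F) F≤w

      At : ℕ → ℕ → Set
      At k v = graph G (k ∷ nums ys₀ as) (seqs ys₀ bs) v

      Prior : ℕ → Set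
      Prior k = ∀ k′ → k′ < k → ∃[ v ] At k′ (suc v)

      record Probed (k v : ℕ) (s : St) : Set where
        constructor probed
        field
          tapes   : Tapes
          is-pure : s ≡ pure i o tapes
          framed  : Frame F ys₀ tapes
          index-k : (tapes ! F) 0 ≡ k
          value-v : At k v
          tested  : lookup tapes zero ≗ λ _ → v

      graph-at : ∀ {k ys v} → Frame F ys₀ ys → (ys ! F) 0 ≡ k → Graph G (F ∷ as) bs (1 + F) ys v →
        At k v
      graph-at {v = v} fr refl = subst₂ (λ n x → graph G (_ ∷ n) x v) (nums-frame as as<F fr)
        (seqs-frame bs bs<F fr)

      graph-at⁻ : ∀ {k ys v} → Frame F ys₀ ys → (ys ! F) 0 ≡ k → At k v →
        Graph G (F ∷ as) bs (1 + F) ys v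
      graph-at⁻ {v = v} fr refl =
        subst₂ (λ n x → graph G (_ ∷ n) x v) (sym (nums-frame as as<F fr))
          (sym (seqs-frame bs bs<F fr))

      probe-correct : ∀ {k ys} → Frame F ys₀ ys → (ys ! F) 0 ≡ k →
                      Sound probe (pure i o ys) (λ s → ∃[ v ] Probed k v s)
      probe-correct {k} {ys} fr e (x ⨾ x′) with correct impl x
      ... | post ys₁ refl fr₁ γ with sound (test-total (constᵗ (1 + F))) x′
      ... | ys₂ , refl , t = (ys₁ ! (1 + F)) 0 , probed ys₂ refl
        (fr ▹ Frame-≤ (n≤1+n F) fr₁ ▹ test-frame t)
        (trans (at-0 (trans (test-other t F) (kept fr₁ F (n<1+n F)))) e)
        (graph-at fr e γ)
        (λ j → trans (test-value t j) (eval-tape (1 + F) zero ys₁ (j ∷ [])))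

      probe-terminates : ∀ {k ys v} → Frame F ys₀ ys → (ys ! F) 0 ≡ k → At k v →
        Halts probe (pure i o ys)
      probe-terminates fr e γ = seq-halts (terminates impl (graph-at⁻ fr e γ)) (correct impl)
        λ { (post ys₁ refl _ _) → halts (test-total (constᵗ (1 + F))) }

      start-total : Total (assign (1 + F) zero) (pure i o ys₀)
        (λ s → ∃[ ys ] s ≡ pure i o ys × Frame F ys₀ ys × (ys ! F) 0 ≡ 0)
      start-total = weaken (set-total F zero 0≤w) λ { (ys , refl , st) →
        ys , refl , set-frame 0≤w ≤-refl st , set-value st 0 }

      next-total : ∀ {k v s} → Probed k v s → Total (assign (1 + F) (sucᵗ F)) s
        (λ s → ∃[ ys ] s ≡ pure i o ys × Frame F ys₀ ys × (ys ! F) 0 ≡ suc k)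
      next-total (probed ys refl fr e _ _) =
        weaken (set-total F (sucᵗ F) 0≤w) λ { (ys′ , refl , st) →
        ys′ , refl , fr ▹ set-frame 0≤w ≤-refl st ,
        trans (set-value st 0) (trans (value-suc F ys 0) (cong suc e)) }

      nonzero-value : ∀ {k v s} → Probed k v s → ¬ zeroTape s ≗ 0𝒩 → ∃[ u ] At k (suc u)
      nonzero-value {v = zero}  (probed _ refl _ _ _ t) nz = ⊥-elim (nz t)
      nonzero-value {v = suc u} (probed _ refl _ _ γ _) nz = u , γ

      Prior-suc : ∀ {k} → Prior k → (∃[ u ] At k (suc u)) → Prior (suc k)
      Prior-suc {k} pr e k′ (s≤s k′≤k) with m≤n⇒m<n∨m≡n k′≤k
      ... | inj₁ k′<k = pr k′ k′<k
      ... | inj₂ refl = e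

      min-correct : ∀ {s} → Exec minProgram (pure i o ys₀) s → Post (μ G) as bs F i o ys₀ s
      min-correct (e ⨾ e₁ ⨾ e₂) with sound start-total e
      ... | ys₁ , refl , fr , z with probe-correct fr z e₁
      ... | v , pb with while-sound (λ s → ∃[ k ] ∃[ v ] Probed k v s × Prior k) body
            (0 , v , pb , λ _ ()) e₂
        where
        body : ∀ {s} → (∃[ k ] ∃[ v ] Probed k v s × Prior k) → ¬ zeroTape s ≗ 0𝒩 →
               Sound (assign (1 + F) (sucᵗ F) ⨾ probe) s
                 (λ s → ∃[ k ] ∃[ v ] Probed k v s × Prior k)
        body (k , v , pb , pr) nz (x ⨾ x′) with sound (next-total pb) x
        ... | ys , refl , fr , e with probe-correct fr e x′
        ... | v′ , pb′ = suc k , v′ , pb′ , Prior-suc pr (nonzero-value pb nz)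
      ... | (k , zero , probed ys₂ refl fr₂ refl γ t , pr) , z′ = post ys₂ refl fr₂ (γ , pr)
      ... | (k , suc _ , probed ys₂ refl fr₂ refl γ t , pr) ,
            z′ = case trans (sym (t 0)) (z′ 0) of λ ()

      min-terminates : ∀ {K} → graph (μ G) (nums ys₀ as) (seqs ys₀ bs) K →
        Halts minProgram (pure i o ys₀)
      min-terminates {K} (γ₀ , pr) =
        seq-halts (halts start-total) (sound start-total) λ { (ys₁ , refl , fr , z) →
          seq-halts (probe-terminates fr z (proj₂ (defined 0 z≤n)))
            (probe-correct fr z) λ { (v , pb) →
            while-halts I stops goes (0 , v , pb , +-identityʳ K) } }
        where
        defined : ∀ k → k ≤ K → ∃[ v ] At k v
        defined k k≤K with m≤n⇒m<n∨m≡n k≤K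
        ... | inj₁ k<K = _ , proj₂ (pr k k<K)
        ... | inj₂ refl = _ , γ₀
        -- Termination is claimed only where the minimum `K` exists, so the distance from the
        -- candidate to `K` bounds the number of rounds.
        I : ℕ → St → Set
        I n s = ∃[ k ] ∃[ v ] Probed k v s × n + k ≡ K
        stops : ∀ {s} → I 0 s → zeroTape s ≗ 0𝒩
        stops (k , v , probed _ refl _ _ γ t , refl) j = trans (t j) (functional G γ γ₀)
        goes : ∀ {n s} → I (suc n) s →
          ¬ zeroTape s ≗ 0𝒩 × Halts (assign (1 + F) (sucᵗ F) ⨾ probe) s ×
               Sound (assign (1 + F) (sucᵗ F) ⨾ probe) s (I n)
        goes {n} (k , v , pb@(probed _ refl _ _ γ t) , eq) =
          (λ z → case trans (sym (functional G γ (proj₂ (pr k k<K))))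
            (trans (sym (t 0)) (z 0)) of λ ()) ,
          seq-halts (halts (next-total pb)) (sound (next-total pb))
            (λ { (ys , refl , fr , e) → probe-terminates fr e (proj₂ (defined (suc k) k<K)) }) ,
          seq-sound {B = I n} (sound (next-total pb)) λ { (ys , refl , fr , e) x →
            case probe-correct fr e x of λ { (v′ , pb′) → suc k , v′ , pb′ ,
              trans (+-suc n k) eq } }
          where
          k<K : k < K
          k<K = subst (k <_) eq (s≤s (m≤n+m k n))

  comp : ∀ {p q Y} {f : PFun p q Y} → PartialRecursive f → Vec ℕ p → Vec ℕ q → ℕ → Instr
  comp (extensional _ d) as bs F = comp d as bs F
  comp zeroʳ as bs F = assign (1 + F) zero
  comp succʳ (a ∷ []) bs F = assign (1 + F) (sucᵗ a)
  comp (projNumʳ i) as bs F = assign (1 + F) (constᵗ (lookup as i))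
  comp (projSeqʳ j) as bs F = assign (1 + F) (copyᵗ (lookup bs j))
  comp (Ψʳ q) (a ∷ []) bs F = callProgram a bs F
  comp χʳ as (b ∷ []) F = zeroTestProgram b F
  comp (composeʳ {p} {q} {f = f} {g} {h} d dg dh) as bs F =
    composeProgram f g h as bs F (λ i → comp (dg i) as bs) (λ j → comp (dh j) as bs)
      (comp d (regs (suc F) p) (regs (p + suc F) q) (q + (p + suc F)))
  -- In both recursions the step finds the round number in `2 + F` and the previous value in `F`;
  -- the latter is appended last, as `primRecNum` and `primRecSeq` prescribe.
  comp (primRecNumʳ d d′) (a ∷ as) bs F =
    RecursionCode.recProgram F a (comp d as bs F) (comp d′ (2 + F ∷ (as ∷ʳ F)) bs (3 + F))
  comp (primRecSeqʳ d d′) (a ∷ as) bs F =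
    RecursionCode.recProgram F a (comp d as bs F) (comp d′ (2 + F ∷ as) (bs ∷ʳ F) (3 + F))
  comp (μʳ {G = G} _ d) as bs F = Minimisation.minProgram G as bs F (comp d (F ∷ as) bs (1 + F))

allBound : ∀ n → (Fin n → ℕ → ℕ) → ℕ → ℕ
allBound zero    b F = F
allBound (suc n) b F = b zero F ⊔ allBound n (b ∘ suc) (suc F)

-- Lies strictly above every variable that `comp` writes, so it tells how many working tapes the
-- machine must have.
bound : ∀ {p q Y} {f : PFun p q Y} → PartialRecursive f → ℕ → ℕ
bound (extensional _ d) F = bound d F
bound (composeʳ {p} {q} d dg dh) F =
  allBound p (λ i → bound (dg i)) (suc F) ⊔
  (allBound q (λ j → bound (dh j)) (p + suc F) ⊔ bound d (q + (p + suc F)))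
bound (primRecNumʳ d d′) F = bound d F ⊔ bound d′ (3 + F)
bound (primRecSeqʳ d d′) F = bound d F ⊔ bound d′ (3 + F)
bound (μʳ _ d)           F = bound d (1 + F)
bound _                  F = suc F

bound-> : ∀ {p q Y} {f : PFun p q Y} (d : PartialRecursive f) F → F < bound d F
bound-> (extensional _ d)  F = bound-> d F
bound-> (composeʳ {p} {q} d dg dh) F =
  ≤-trans (≤-trans (s≤s (≤-trans (n≤1+n F) (≤-trans (m≤n+m (suc F) p) (m≤n+m (p + suc F) q))))
                   (bound-> d (q + (p + suc F))))
    (≤-trans (m≤n⊔m (allBound q (λ j → bound (dh j)) (p + suc F)) _)
             (m≤n⊔m (allBound p (λ i → bound (dg i)) (suc F)) _))
bound-> (primRecNumʳ d d′) F = ≤-trans (bound-> d F) (m≤m⊔n _ _)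
bound-> (primRecSeqʳ d d′) F = ≤-trans (bound-> d F) (m≤m⊔n _ _)
bound-> (μʳ _ d)           F = ≤-trans (n≤1+n _) (bound-> d (1 + F))
bound-> zeroʳ              F = ≤-refl
bound-> succʳ              F = ≤-refl
bound-> (projNumʳ _)       F = ≤-refl
bound-> (projSeqʳ _)       F = ≤-refl
bound-> (Ψʳ _)             F = ≤-refl
bound-> χʳ                 F = ≤-refl

-- A value at `K` is derived through values at all smaller arguments, and the loop needs each of
-- them to get through its rounds.
rec-defined : ∀ {A : Set} (R : ℕ → A → Set) → (∀ {k v} → R (suc k) v → ∃[ u ] R k u) →
              ∀ K {v} → R K v → ∀ k → k ≤ K → ∃[ u ] R k u
rec-defined R pre K r k k≤K with m≤n⇒m<n∨m≡n k≤K
... | inj₂ refl = _ , r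
rec-defined R pre (suc K) r k k≤K | inj₁ (s≤s k≤K′) = rec-defined R pre K (proj₂ (pre r)) k k≤K′

-- Correctness of the translation

module Correctness (w : ℕ) where

  open Translation w public

  Below-∷ : ∀ {n a} {as : Vec ℕ n} {F} → a < F → Below as F → Below (a ∷ as) F
  Below-∷ a<F as<F .is-below zero    = a<F
  Below-∷ a<F as<F .is-below (suc i) = is-below as<F i

  Below-∷ʳ : ∀ {n a} {as : Vec ℕ n} {F} → Below as F → a < F → Below (as ∷ʳ a) F
  Below-∷ʳ {as = []}     as<F a<F .is-below zero    = a<F
  Below-∷ʳ {as = _ ∷ as} as<F a<F .is-below zero    = is-below as<F zero
  Below-∷ʳ {as = _ ∷ as} as<F a<F .is-below (suc i) =
    is-below (Below-∷ʳ {as = as} (below (is-below as<F ∘ suc)) a<F) i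

  Below-weaken : ∀ {n} {as : Vec ℕ n} {F F′} → F ≤ F′ → Below as F → Below as F′
  Below-weaken F≤F′ as<F .is-below i = <-≤-trans (is-below as<F i) F≤F′

  Below-regs : ∀ F m → Below (regs F m) (m + F)
  Below-regs F m .is-below = regs-< F m

  implements-extensional : ∀ {p q Y} {f g : PFun p q Y} {as bs F P} → f ≐ g →
                           Implements f as bs F P → Implements g as bs F P
  implements-extensional {g = g} {as} {bs} {F} f≐g impl .correct {i} {o} {ys} e =
    case correct impl e of λ
    { (post ys′ eq fr γ) → post ys′ eq fr (Equivalence.to (f≐g (nums ys as) (seqs ys bs) _) γ) }
  implements-extensional f≐g impl .terminates γ = terminates impl (Equivalence.from (f≐g _ _ _) γ)

  allImplement : ∀ {p q Y n} (as : Vec ℕ p) (bs : Vec ℕ q) {g : Fin n → PFun p q Y}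
                 (d : ∀ i → PartialRecursive (g i)) F → Below as F → Below bs F →
                 (∀ i F → Below as F → Below bs F → bound (d i) F ≤ suc w →
                   Implements (g i) as bs F (comp (d i) as bs F)) →
                 allBound n (λ i → bound (d i)) F ≤ suc w →
                 AllImplement as bs n g (λ i → comp (d i) as bs) F
  allImplement {n = zero}  as bs d F as<F bs<F impl ≤w = _
  allImplement {n = suc n} as bs d F as<F bs<F impl ≤w =
    impl zero F as<F bs<F (m⊔n≤o⇒m≤o _ _ ≤w) ,
    allImplement as bs (λ i → d (suc i)) (suc F) (Below-weaken (n≤1+n F) as<F)
      (Below-weaken (n≤1+n F) bs<F)
      (λ i → impl (suc i)) (m⊔n≤o⇒n≤o (bound (d zero) F) _ ≤w)

  bound-≤ : ∀ {p q Y} {f : PFun p q Y} (d : PartialRecursive f) F → bound d F ≤ suc w → F ≤ w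
  bound-≤ d F ≤w = s≤s⁻¹ (≤-trans (bound-> d F) ≤w)

  module _ {p q} {G : PFun p q num} {H : PFun (2 + p) q num} (a : ℕ) (as : Vec ℕ p) (bs : Vec ℕ q)
           (F : ℕ) (F≤w : 3 + F ≤ w) (a<F : a < F) (as<F : Below as F) (bs<F : Below bs F) {P Q}
           (implG : Implements G as bs F P)
           (implH : Implements H (2 + F ∷ (as ∷ʳ F)) bs (3 + F) Q) where

    open Recursion F F≤w

    private
      module _ (ys₀ : Tapes) where

        R : ℕ → ℕ → Set
        R k = PrimRecNum.Rec G H k (nums ys₀ as) (seqs ys₀ bs)

        arguments : ∀ {k ys} → AtRound {num} ys₀ R k ys → ∀ {v} →
          Graph H (2 + F ∷ (as ∷ʳ F)) bs (3 + F) ys v ≡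
          graph H (k ∷ (nums ys₀ as ∷ʳ (ys ! F) 0)) (seqs ys₀ bs) v
        arguments {ys = ys} (fr , r , refl) {v} = cong₂ (λ n x → graph H n x v)
          (cong (_ ∷_) (trans (map-∷ʳ (λ b → (ys ! b) 0) F as)
            (cong (_∷ʳ (ys ! F) 0) (nums-frame as as<F fr))))
          (seqs-frame bs bs<F fr)

        Q-correct : ∀ {k i o ys} → AtRound {num} ys₀ R k ys → Sound Q (pure i o ys)
          (λ s → ∃[ ys′ ] s ≡ pure i o ys′ × Frame (3 + F) ys ys′ × R (suc k) ((ys′ ! (3 + F)) 0))
        Q-correct at@(_ , r , _) e = case correct implH e of λ
          { (post ys′ eq fr γ) → ys′ , eq , fr , _ , r , subst (λ A → A) (arguments at) γ }

        Q-halts : ∀ {k i o ys} → AtRound {num} ys₀ R k ys → (∃[ v ] R (suc k) v) →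
          Halts Q (pure i o ys)
        Q-halts {k} {ys = ys} at@(_ , r , _) (v , u , r′ , γ) = terminates implH
          (subst (λ A → A) (sym (arguments at))
            (subst (λ u → graph H (k ∷ (nums ys₀ as ∷ʳ u)) (seqs ys₀ bs) v)
              (PrimRecNum.Rec-functional G H k r′ r) γ))

    implements-recNum : Implements (primRecNum G H) (a ∷ as) bs F (RecursionCode.recProgram F a P Q)
    implements-recNum .correct {ys = ys₀} e
      with rec-correct a a<F G as bs P Q implG ys₀ (R ys₀) (λ { k refl r → r }) (λ γ → γ)
        (Q-correct ys₀) e
    ... | ys , eq , fr , r = post ys eq fr r
    implements-recNum .terminates {ys = ys₀} γ =
      rec-terminates a a<F G as bs P Q implG ys₀ (R ys₀) (λ { k refl r → r }) (λ γ → γ)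
        (Q-correct ys₀) (Q-halts ys₀)
        (defined 0 z≤n) (λ k → defined (suc k))
      where
      defined : ∀ k → k ≤ (ys₀ ! a) 0 → ∃[ v ] R ys₀ k v
      defined = rec-defined (R ys₀) (λ { (u , r , _) → u , r }) ((ys₀ ! a) 0) γ

  module _ {p q} {G : PFun p q seq} {H : PFun (suc p) (suc q) seq} (a : ℕ) (as : Vec ℕ p)
    (bs : Vec ℕ q)
           (F : ℕ) (F≤w : 3 + F ≤ w) (a<F : a < F) (as<F : Below as F) (bs<F : Below bs F) {P Q}
           (implG : Implements G as bs F P)
           (implH : Implements H (2 + F ∷ as) (bs ∷ʳ F) (3 + F) Q) where

    open Recursion F F≤w

    private
      module _ (ys₀ : Tapes) where

        R : ℕ → 𝒩 → Set
        R k = PrimRecSeq.Rec G H k (nums ys₀ as) (seqs ys₀ bs)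

        R-resp : ∀ k {v v′} → v ≗ v′ → R k v → R k v′
        R-resp k e = PrimRecSeq.Rec-respects G H k ≋-refl e

        arguments : ∀ {k ys} → AtRound {seq} ys₀ R k ys → ∀ {v} →
          Graph H (2 + F ∷ as) (bs ∷ʳ F) (3 + F) ys v ≡
          graph H (k ∷ nums ys₀ as) (seqs ys₀ bs ∷ʳ ys ! F) v
        arguments {ys = ys} (fr , r , refl) {v} = cong₂ (λ n x → graph H n x v)
          (cong (_ ∷_) (nums-frame as as<F fr))
          (trans (map-∷ʳ (ys !_) F bs) (cong (_∷ʳ ys ! F) (seqs-frame bs bs<F fr)))

        Q-correct : ∀ {k i o ys} → AtRound {seq} ys₀ R k ys → Sound Q (pure i o ys)
          (λ s → ∃[ ys′ ] s ≡ pure i o ys′ × Frame (3 + F) ys ys′ × R (suc k) (ys′ ! (3 + F)))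
        Q-correct at@(_ , r , _) e = case correct implH e of λ
          { (post ys′ eq fr γ) → ys′ , eq , fr , _ , r , subst (λ A → A) (arguments at) γ }

        Q-halts : ∀ {k i o ys} → AtRound {seq} ys₀ R k ys → (∃[ v ] R (suc k) v) →
          Halts Q (pure i o ys)
        Q-halts {k} {ys = ys} at@(_ , r , _) (v , u , r′ , γ) = terminates implH
          (subst (λ A → A) (sym (arguments at))
            -- The sequence on tape `F` agrees with the given previous value only pointwise, so `H`
            -- has to respect the difference.
            (respects H (≋-snoc ≋-refl (PrimRecSeq.Rec-functional G H k r′ r)) (λ _ → refl) γ))

    implements-recSeq : Implements (primRecSeq G H) (a ∷ as) bs F (RecursionCode.recProgram F a P Q)
    implements-recSeq .correct {ys = ys₀} e
      with rec-correct a a<F G as bs P Q implG ys₀ (R ys₀) (R-resp ys₀) (λ γ → γ) (Q-correct ys₀) e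
    ... | ys , eq , fr , r = post ys eq fr r
    implements-recSeq .terminates {ys = ys₀} γ =
      rec-terminates a a<F G as bs P Q implG ys₀ (R ys₀) (R-resp ys₀) (λ γ → γ) (Q-correct ys₀)
        (Q-halts ys₀)
        (defined 0 z≤n) (λ k → defined (suc k))
      where
      defined : ∀ k → k ≤ (ys₀ ! a) 0 → ∃[ v ] R ys₀ k v
      defined = rec-defined (R ys₀) (λ { (u , r , _) → u , r }) ((ys₀ ! a) 0) γ

  comp-implements : ∀ {p q Y} {f : PFun p q Y} (d : PartialRecursive f) as bs F → Below as F →
    Below bs F →
                    bound d F ≤ suc w → Implements f as bs F (comp d as bs F)
  comp-implements (extensional f≐g d) as bs F as<F bs<F ≤w =
    implements-extensional f≐g (comp-implements d as bs F as<F bs<F ≤w)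
  comp-implements zeroʳ as bs F as<F bs<F ≤w =
    implements-assign zeroFun as bs F zero (s≤s⁻¹ ≤w) sym
  comp-implements succʳ (a ∷ []) bs F as<F bs<F ≤w =
    implements-assign succFun (a ∷ []) bs F (sucᵗ a) (s≤s⁻¹ ≤w)
      λ { {ys} refl → value-suc a ys 0 }
  comp-implements (projNumʳ i) as bs F as<F bs<F ≤w =
    implements-assign (projNum i) as bs F (constᵗ (lookup as i)) (s≤s⁻¹ ≤w)
      λ { {ys} refl → trans (eval-tape (lookup as i) zero ys (0 ∷ []))
        (sym (lookup-map i (λ a → (ys ! a) 0) as)) }
  comp-implements (projSeqʳ j) as bs F as<F bs<F ≤w =
    implements-assign (projSeq j) as bs F (copyᵗ (lookup bs j)) (s≤s⁻¹ ≤w)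
      λ {ys} e k → trans (sym (e k)) (trans (eval-tape (lookup bs j) (var #0) ys (k ∷ []))
        (cong (λ z → z k) (sym (lookup-map j (ys !_) bs))))
  comp-implements (Ψʳ q) (a ∷ []) bs F as<F bs<F ≤w = implements-Ψ a bs F (s≤s⁻¹ ≤w) bs<F
  comp-implements χʳ [] (b ∷ []) F as<F bs<F ≤w = implements-χ b F (s≤s⁻¹ ≤w) (is-below bs<F zero)
  comp-implements (composeʳ {p} {q} {f = f} {g} {h} d dg dh) as bs F as<F bs<F ≤w =
    implements-compose f g h as bs F _ _ _ (bound-≤ d _ ≤w″) as<F bs<F
      (allImplement as bs dg (suc F) (Below-weaken (n≤1+n F) as<F) (Below-weaken (n≤1+n F) bs<F)
        (λ i → comp-implements (dg i) as bs) (m⊔n≤o⇒m≤o _ _ ≤w))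
      (allImplement as bs dh (p + suc F) (Below-weaken F≤ as<F) (Below-weaken F≤ bs<F)
        (λ j → comp-implements (dh j) as bs) (m⊔n≤o⇒m≤o _ _ ≤w′))
      (comp-implements d _ _ _ (Below-weaken (m≤n+m (p + suc F) q) (Below-regs (suc F) p))
        (Below-regs (p + suc F) q) ≤w″)
    where
    F≤ : F ≤ p + suc F
    F≤ = ≤-trans (n≤1+n F) (m≤n+m (suc F) p)
    ≤w′ = m⊔n≤o⇒n≤o (allBound p (λ i → bound (dg i)) (suc F)) _ ≤w
    ≤w″ = m⊔n≤o⇒n≤o (allBound q (λ j → bound (dh j)) (p + suc F)) _ ≤w′
  comp-implements (primRecNumʳ d d′) (a ∷ as) bs F as<F bs<F ≤w =
    implements-recNum a as bs F (bound-≤ d′ (3 + F) ≤w′) (is-below as<F zero) as<F′ bs<F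
      (comp-implements d as bs F as<F′ bs<F (m⊔n≤o⇒m≤o _ _ ≤w))
      (comp-implements d′ _ bs (3 + F)
        (Below-∷ (n<1+n _) (Below-∷ʳ (Below-weaken (m≤n+m F 3) as<F′) (m≤n+m (suc F) 2)))
        (Below-weaken (m≤n+m F 3) bs<F) ≤w′)
    where
    as<F′ = below (is-below as<F ∘ suc)
    ≤w′ = m⊔n≤o⇒n≤o (bound d F) _ ≤w
  comp-implements (primRecSeqʳ d d′) (a ∷ as) bs F as<F bs<F ≤w =
    implements-recSeq a as bs F (bound-≤ d′ (3 + F) ≤w′) (is-below as<F zero) as<F′ bs<F
      (comp-implements d as bs F as<F′ bs<F (m⊔n≤o⇒m≤o _ _ ≤w))
      (comp-implements d′ _ _ (3 + F)
        (Below-∷ (n<1+n _) (Below-weaken (m≤n+m F 3) as<F′))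
        (Below-∷ʳ (Below-weaken (m≤n+m F 3) bs<F) (m≤n+m (suc F) 2)) ≤w′)
    where
    as<F′ = below (is-below as<F ∘ suc)
    ≤w′ = m⊔n≤o⇒n≤o (bound d F) _ ≤w
  comp-implements (μʳ {G = G} _ d) as bs F as<F bs<F ≤w = λ where
      .correct {i} {o} {ys} → min-correct F≤w as<F bs<F impl i o ys
      .terminates {i} {o} {ys} → min-terminates F≤w as<F bs<F impl i o ys
    where
    F≤w = bound-≤ d (1 + F) ≤w
    impl = comp-implements d (F ∷ as) bs (1 + F) (Below-∷ (n<1+n F) (Below-weaken (n≤1+n F) as<F))
             (Below-weaken (n≤1+n F) bs<F) ≤w
    open Minimisation G as bs F (comp d (F ∷ as) bs (1 + F))

-- The complete machine: input, computation, output

clamp-toℕ : ∀ {w} (i : Fin (suc w)) → clamp w (toℕ i) ≡ i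
clamp-toℕ {zero}  zero    = refl
clamp-toℕ {suc w} zero    = refl
clamp-toℕ {suc w} (suc i) = cong suc (clamp-toℕ i)

lookup-regs : ∀ f m i → lookup (regs f m) i ≡ toℕ i + f
lookup-regs f (suc m) zero    = refl
lookup-regs f (suc m) (suc i) = trans (lookup-regs (suc f) m i) (+-suc (toℕ i) f)

module _ {p q Y} {f : PFun p q Y} (d : PartialRecursive f) where

  private
    -- Variable 0 is the output Baire tape, variables 1 to `q` are the input tapes and the next `p`
    -- receive the numerical inputs. So `p + (1 + q)` is the first free variable.
    F working : ℕ
    F = p + (1 + q)
    working = bound d F

  open Correctness (q + working)

  private
    as : Vec ℕ p
    as = regs (1 + q) p
    bs : Vec ℕ q
    bs = regs 1 q
    F≤w : F ≤ q + working
    F≤w = ≤-trans (<⇒≤ (bound-> d F)) (m≤n+m working q)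

    as<F : Below as F
    as<F = Below-regs (1 + q) p

    bs<F : Below bs F
    bs<F = Below-weaken (≤-trans (≤-reflexive (+-comm q 1)) (m≤n+m (1 + q) p)) (Below-regs 1 q)

  -- Slaves see Baire tapes only, so the numerical inputs are carried over stroke by stroke;
  -- `advance` passes the blank behind each block.
  readInputs : ℕ → ℕ → Instr
  readInputs zero    k = skip
  readInputs (suc n) k =
    assign (suc k) zero ⨾ whileInput (assign (suc k) (sucᵗ k)) ⨾ advance ⨾ readInputs n (suc k)

  private
    w = q + working

  count-total : ∀ {k} → k ≤ w → ∀ m {ns o c ys} → (ys ! k) 0 ≡ c →
    Total (whileInput (assign (suc k) (sucᵗ k))) (pure (m ∷ ns) o ys)
      (λ s → ∃[ ys′ ] s ≡ pure (0 ∷ ns) o ys′ × Frame k ys ys′ × (ys′ ! k) 0 ≡ m + c)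
  count-total {k} k≤w zero {ns} {o} {c} {ys} e = total (_ , input-stop refl)
    λ { (input-stop _) → ys , refl , Frame-refl , e }
  count-total {k} k≤w (suc m) {ns} {o} {c} {ys} e = total
    (case halts st of λ { (_ , x) → case sound st x of λ { (ys₁ , refl , s₁) →
      case halts (next ys₁ s₁) of λ { (_ , x′) → _ , input-go refl x x′ } } })
    λ { (input-go refl x x′) → case sound st x of λ { (ys₁ , refl , s₁) →
      case sound (next ys₁ s₁) x′ of
      λ { (ys₂ , refl , fr , e₂) → ys₂ , refl , set-frame k≤w ≤-refl s₁ ▹ fr ,
        trans e₂ (+-suc m c) } } }
    where
    st = set-total k (sucᵗ k) {m ∷ ns} {o} {0} {ys} k≤w
    next : ∀ ys₁ → Set! k (value (sucᵗ k) ys) ys ys₁ → _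
    next ys₁ s₁ = count-total k≤w m {ns} {o} {suc c} {ys₁}
      (trans (set-value s₁ 0) (trans (value-suc k ys 0) (cong suc e)))

  advance-total : ∀ {ns o ys} → Total advance (pure (0 ∷ ns) o ys) (_≡ pure ns o ys)
  advance-total = total (_ , advance) λ { advance → refl }

  readInputs-total : ∀ {n} k (v : Vec ℕ n) {o ys} → n + k ≤ suc w →
    Total (readInputs n k) (pure (toList v) o ys)
      (λ s → ∃[ ys′ ] s ≡ pure [] o ys′ × Frame k ys ys′ × nums ys′ (regs k n) ≡ v)
  readInputs-total k [] ≤w = total (_ , skip) λ { skip → _ , refl , Frame-refl , refl }
  readInputs-total {suc n} k (m ∷ v) {o} {ys} ≤w =
    set-total k zero k≤w ⨾ᵗ λ { (ys₁ , refl , s₁) →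
    count-total k≤w m (set-value s₁ 0) ⨾ᵗ λ { (ys₂ , refl , fr₂ , e₂) →
    advance-total ⨾ᵗ λ { refl →
    weaken (readInputs-total (suc k) v (≤-trans (≤-reflexive (+-suc n k)) ≤w)) λ {
      (ys₃ , refl , fr₃ , e₃) →
      ys₃ , refl , set-frame k≤w ≤-refl s₁ ▹ fr₂ ▹ Frame-≤ (n≤1+n k) fr₃ ,
      cong₂ _∷_ (trans (at-0 (kept fr₃ k (n<1+n k))) (trans e₂ (+-identityʳ m))) e₃ } } } }
    where
    k≤w : k ≤ w
    k≤w = s≤s⁻¹ (≤-trans (s≤s (m≤n+m k n)) ≤w)

  -- A number can reach the master only through the zero-test tape; a sequence is copied to Baire
  -- tape 1, the output tape.
  epilogue : Codomain → Instr
  epilogue num = assign 0 (constᵗ F) ⨾ drain out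
  epilogue seq = assign 1 (copyᵗ F)

  mainProgram : Instr
  mainProgram = readInputs p (1 + q) ⨾ comp d as bs F ⨾ epilogue Y

  open Master q working mainProgram using (start; result; exec⇒computes; computes⇒exec)

  private
    startTapes : Vec 𝒩 q → Tapes
    startTapes x = 0𝒩 ∷ 0𝒩 ∷ (x ++ᵛ replicateᵛ working 0𝒩)

    seqs-start : ∀ x → seqs (startTapes x) bs ≡ x
    seqs-start x = trans (sym (tabulate∘lookup _))
      (trans (tabulate-cong pointwise) (tabulate∘lookup x))
      where
      pointwise : ∀ j → lookup (seqs (startTapes x) bs) j ≡ lookup x j
      pointwise j = trans (lookup-map j (startTapes x !_) bs)
        (trans (cong (λ i → lookup (0𝒩 ∷ (x ++ᵛ replicateᵛ working 0𝒩)) i) index≡)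
               (lookup-++ˡ x (replicateᵛ working 0𝒩) j))
        where
        index≡ : clamp w (lookup bs j) ≡ suc (j ↑ˡ working)
        index≡ = trans (cong (clamp w) (trans (lookup-regs 1 q j)
          (trans (+-comm (toℕ j) 1) (cong suc (sym (toℕ-↑ˡ j working))))))
            (clamp-toℕ (suc (j ↑ˡ working)))

    epilogue-total : ∀ Y {ys} → Total (epilogue Y) (pure [] 0 ys)
      (λ s → Eq Y (result Y s) (read Y (ys ! F)))
    epilogue-total num {ys} = test-total (constᵗ F) ⨾ᵗ λ { (ys₁ , refl , t) →
      weaken (drain-out ((ys ! F) 0) λ j → trans (test-value t j) (eval-tape F zero ys (j ∷ [])))
        λ { (ys₂ , refl) → +-identityʳ _ } }
    epilogue-total seq {ys} = weaken
      (set-total 0 (copyᵗ F) z≤n) λ { {s} (_ ∷ z ∷ zs , refl , st) j →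
      trans (cong (λ i → lookup (z ∷ zs) i j) (sym (clamp-toℕ zero)))
            (trans (set-value st j) (eval-tape F (var #0) ys (j ∷ []))) }

    impl : Implements f as bs F (comp d as bs F)
    impl = comp-implements d as bs F as<F bs<F (≤-trans (m≤n+m working q) (n≤1+n _))

    read-total : ∀ (n : Vec ℕ p) x → Total (readInputs p (1 + q)) (start n x)
      (λ s → ∃[ ys ] s ≡ pure [] 0 ys × (∀ y → graph f n x y → Graph f as bs F ys y) ×
                     (∀ y → Graph f as bs F ys y → graph f n x y))
    read-total n x = weaken (readInputs-total (1 + q) n (≤-trans F≤w (n≤1+n w))) λ {
      (ys , refl , fr , refl) →
      ys , refl ,
      (λ y → subst (λ x → graph f n x y) (sym (seqs≡ ys fr))) ,
        (λ y → subst (λ x → graph f n x y) (seqs≡ ys fr)) }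
      where
      seqs≡ : ∀ ys → Frame (1 + q) (startTapes x) ys → seqs ys bs ≡ x
      seqs≡ ys fr = trans (seqs-frame {ys = startTapes x} bs
        (Below-weaken (≤-reflexive (+-comm q 1)) (Below-regs 1 q)) fr) (seqs-start x)

    main-correct : ∀ {n x s} → Exec mainProgram (start n x) s → graph f n x (result Y s)
    main-correct {n} {x} (e ⨾ e₁ ⨾ e₂) with sound (read-total n x) e
    ... | ys , refl , _ , from with correct impl e₁
    ... | post ys₁ refl _ γ = respects f ≋-refl (Eq-sym Y (sound (epilogue-total Y) e₂)) (from _ γ)

    main-terminates : ∀ {n x y} → graph f n x y → Halts mainProgram (start n x)
    main-terminates {n} {x} γ = seq-halts (halts (read-total n x))
      (sound (read-total n x)) λ { (ys , refl , to , _) →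
      seq-halts (terminates impl (to _ γ))
        (correct impl) λ { (post ys₁ refl _ _) → halts (epilogue-total Y) } }

  recursive⇒computable : MSComputable f
  recursive⇒computable = MasterCode.machineOf q working mainProgram , λ n x y → mk⇔
    (λ γ → case main-terminates γ of λ { (_ , e) →
      exec⇒computes Y e (functional f (main-correct e) γ) })
    (λ c → case computes⇒exec Y c of λ { (_ , e , eq) → respects f ≋-refl eq (main-correct e) })

-- From machines to partial recursive functions

Eq-trans : ∀ Y {x y z} → Eq Y x y → Eq Y y z → Eq Y x z
Eq-trans num e e′ = trans e e′
Eq-trans seq e e′ i = trans (e i) (e′ i)

-- For total functions `φ` the graph can be handled through values. These are compared up to `Eq`,
-- so composition may pass on any pointwise equal sequence.
record Realises {p q} Y (φ : Vec ℕ p → Vec 𝒩 q → ⟦ Y ⟧) : Set₁ where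
  field
    {pfun}    : PFun p q Y
    recursive : PartialRecursive pfun
    sound     : ∀ {n x y} → graph pfun n x y → Eq Y y (φ n x)
    complete  : ∀ n x → graph pfun n x (φ n x)

open Realises public

complete-Eq : ∀ {p q Y φ} (r : Realises {p} {q} Y φ) {n x y} → Eq Y (φ n x) y → graph (pfun r) n x y
complete-Eq r e = respects (pfun r) ≋-refl e (complete r _ _)

lookup-tabulate-≗ : ∀ {q} (h : Fin q → 𝒩) j → lookup (tabulate h) j ≗ h j
lookup-tabulate-≗ h j i = cong (λ f → f i) (lookup∘tabulate h j)

projNum-realised : ∀ {p q} (i : Fin p) → Realises {p} {q} num (λ n x → lookup n i)
projNum-realised i = record { recursive = projNumʳ i ; sound = id ; complete = λ _ _ → refl }

projSeq-realised : ∀ {p q} (j : Fin q) → Realises {p} {q} seq (λ n x → lookup x j)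
projSeq-realised j = record { recursive = projSeqʳ j ; sound = id ; complete = λ _ _ _ → refl }

-- The constant 0 is obtained from μ, because χ yields a number from a
-- sequence only where it is decided whether the sequence is 0.

zero-realised : ∀ {p q} → 1 ≤ p + q → Realises {p} {q} num (λ _ _ → 0)
zero-realised 1≤ = record
  { recursive = μʳ 1≤ (composeʳ {g = λ _ → projNum zero} {h = λ ()} zeroʳ (λ _ → projNumʳ zero)
    (λ ()))
  ; sound     = λ { {y = zero} _ → refl ; {y = suc y} (_ , before) →
    case before 0 (s≤s z≤n) of λ { (_ , _ , _ , _ , _ , ()) } }
  ; complete  = λ n x → (0 ∷ [] , [] , (λ { zero → refl }) , (λ ()) , refl) , λ _ () }

suc-realised : ∀ {p q φ} → Realises {p} {q} num φ → Realises {p} {q} num (λ n x → suc (φ n x))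
suc-realised r = record
  { recursive = composeʳ {g = λ _ → pfun r} {h = λ ()} succʳ (λ _ → recursive r) (λ ())
  ; sound     = λ { (k ∷ [] , _ , e , _ , refl) → cong suc (sound r (e zero)) }
  ; complete  = λ n x → _ ∷ [] , [] , (λ { zero → complete r n x }) , (λ ()) , refl }

const-realised : ∀ {p q} → 1 ≤ p + q → ∀ c → Realises {p} {q} num (λ _ _ → c)
const-realised 1≤ zero    = zero-realised 1≤
const-realised 1≤ (suc c) = suc-realised (const-realised 1≤ c)

-- The slave program of `t` has a fixed index, so the term becomes `Ψ` applied to a constant number.
term-realised : ∀ {p q r} → 1 ≤ p + q → (t : PR r 1) {h : Fin r → Vec ℕ p → Vec 𝒩 q → 𝒩} →
                (∀ j → Realises seq (h j)) →
                Realises {p} {q} seq (λ n x i → eval t (tabulate λ j → h j n x) (i ∷ []))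
term-realised {r = r} 1≤ t {h} hs = record
  { recursive = composeʳ {g = λ _ → pfun e} {h = λ j → pfun (hs j)} (Ψʳ r) (λ _ → recursive e)
    (λ j → recursive (hs j))
  ; sound     = λ { {n} {x} {y} (k ∷ [] , xs , es , hyps , φ) i →
      Φ-unique {x = tabulate λ j → h j n x} {index t}
        (Φ-cong {e = index t} (lookup-≋ λ j i →
          trans (sound (hs j) (hyps j) i) (sym (lookup-tabulate-≗ _ j i)))
          (subst (λ e → Φ xs e i (y i)) (sound e (es zero)) (φ i)))
        (Φ-index t (tabulate λ j → h j n x) i) }
  ; complete  = λ n x → index t ∷ [] , tabulate (λ j → h j n x) , (λ { zero → complete e n x }) ,
      (λ j → complete-Eq (hs j) λ i → sym (lookup-tabulate-≗ _ j i)) ,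
      Φ-index t (tabulate λ j → h j n x) }
  where
  e = const-realised 1≤ (index t)

compose-realised : ∀ {p q p′ q′ Y} {φ : Vec ℕ p → Vec 𝒩 q → ⟦ Y ⟧} →
  (∀ {n x x′} → x ≋ x′ → Eq Y (φ n x) (φ n x′)) →
  {g : Fin p → Vec ℕ p′ → Vec 𝒩 q′ → ℕ} {h : Fin q → Vec ℕ p′ → Vec 𝒩 q′ → 𝒩} →
  Realises Y φ → (∀ i → Realises num (g i)) → (∀ j → Realises seq (h j)) →
  Realises Y (λ n x → φ (tabulate λ i → g i n x) (tabulate λ j → h j n x))
compose-realised {Y = Y} {φ} resp {g} {h} r gs hs = record
  { recursive = composeʳ {g = λ i → pfun (gs i)} {h = λ j → pfun (hs j)} (recursive r)
    (λ i → recursive (gs i)) (λ j → recursive (hs j))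
  ; sound     = λ { {n} {x} {y} (m , z , G , H , γ) → Eq-trans Y
      (subst (λ m → Eq Y y (φ m z)) (lookup-ext λ i →
        trans (sound (gs i) (G i)) (sym (lookup∘tabulate _ i))) (sound r γ))
      (resp (lookup-≋ λ j i → trans (sound (hs j) (H j) i) (sym (lookup-tabulate-≗ _ j i)))) }
  ; complete  = λ n x → tabulate (λ i → g i n x) , tabulate (λ j → h j n x) ,
      (λ i → complete-Eq (gs i) (sym (lookup∘tabulate _ i))) ,
      (λ j → complete-Eq (hs j) λ i → sym (lookup-tabulate-≗ _ j i)) , complete r _ _ }

lookup-∷ʳ-last : ∀ {A : Set} {n} (xs : Vec A n) y → lookup (xs ∷ʳ y) (fromℕ n) ≡ y
lookup-∷ʳ-last []       y = refl
lookup-∷ʳ-last (_ ∷ xs) y = lookup-∷ʳ-last xs y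

-- Terms receive their data through oracles, so a number has to enter as a constant sequence.
-- Recursion with values in 𝒩 produces it by adding 1 everywhere in each round.
constSeq : ∀ {p q} → 1 ≤ p + q → Realises {suc p} {q} seq (λ n x _ → head n)
constSeq {p} {q} 1≤ = record
  { recursive = primRecSeqʳ (recursive base) (recursive next)
  ; sound     = λ { {k ∷ n} γ → sound-rec k γ }
  ; complete  = λ { (k ∷ n) x → complete-rec k } }
  where
  base : Realises {p} {q} seq (λ _ _ _ → 0)
  base = term-realised {r = 0} 1≤ zero {λ ()} λ ()
  next : Realises {suc p} {suc q} seq (λ n x i → suc (lookup x (fromℕ q) i))
  next = term-realised {r = 1} (s≤s z≤n) (suc (ask zero (var #0))) λ _ → projSeq-realised (fromℕ q)
  sound-rec : ∀ k {n x y} → PrimRecSeq.Rec (pfun base) (pfun next) k n x y → y ≗ λ _ → k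
  sound-rec zero    γ i = sound base γ i
  sound-rec (suc k) {x = x} (u , r , γ) i =
    trans (sound next γ i) (cong suc
      (trans (cong (λ f → f i) (lookup-∷ʳ-last x u)) (sound-rec k r i)))
  complete-rec : ∀ k {n x} → PrimRecSeq.Rec (pfun base) (pfun next) k n x (λ _ → k)
  complete-rec zero        = complete base _ _
  complete-rec (suc k) {x = x} = _ , complete-rec k ,
    complete-Eq next (λ i → cong (λ f → suc (f i)) (lookup-∷ʳ-last x (λ _ → k)))

-- The way from sequences back to numbers. On the constant sequence with value `φ n x 0` the answer
-- of `χ` is decided, and it is 0 exactly when this value is nonzero; so `μ` stops at the first
-- nonzero value.
module Search {p q} (1≤ : 1 ≤ p + q) {φ : Vec ℕ (suc p) → Vec 𝒩 q → 𝒩} (r : Realises seq φ) where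

  private
    constant : Realises {suc p} {q} seq (λ n x _ → φ n x 0)
    constant = term-realised {r = 1} (s≤s z≤n) (ask zero zero) λ _ → r

    G : PFun (suc p) q num
    G = compose χ (λ ()) (λ _ → pfun constant)

  search : PFun p q num
  search = μ G

  search-recursive : PartialRecursive search
  search-recursive = μʳ 1≤ (composeʳ {g = λ ()} {h = λ _ → pfun constant} χʳ (λ ())
    (λ _ → recursive constant))

  Found : Vec ℕ p → Vec 𝒩 q → ℕ → Set
  Found n x k = (∃[ v ] φ (k ∷ n) x 0 ≡ suc v) × (∀ j → j < k → φ (j ∷ n) x 0 ≡ 0)

  private
    G-zero : ∀ {n x} → graph G n x 0 → ∃[ v ] φ n x 0 ≡ suc v
    G-zero {n} {x} (_ , z ∷ [] , _ , H , inj₁ (_ , ()))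
    G-zero {n} {x} (_ , z ∷ [] , _ , H , inj₂ (nz , _)) with φ n x 0 in eq
    ... | zero  = ⊥-elim (nz λ i → trans (sound constant (H zero) i) eq)
    ... | suc v = v , refl

    G-suc : ∀ {n x v} → graph G n x (suc v) → φ n x 0 ≡ 0
    G-suc (_ , z ∷ [] , _ , H , inj₁ (e , _)) = trans (sym (sound constant (H zero) 0)) (e 0)
    G-suc (_ , z ∷ [] , _ , H , inj₂ (_ , ()))

    zero-G : ∀ {n x v} → φ n x 0 ≡ suc v → graph G n x 0
    zero-G {n} {x} e = [] , (λ _ → φ n x 0) ∷ [] , (λ ()) , (λ { zero → complete constant n x }) ,
      inj₂ ((λ z → case trans (sym e) (z 0) of λ ()) , refl)

    suc-G : ∀ {n x} → φ n x 0 ≡ 0 → graph G n x 1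
    suc-G {n} {x} e = [] , (λ _ → φ n x 0) ∷ [] , (λ ()) , (λ { zero → complete constant n x }) ,
      inj₁ ((λ _ → e) , refl)

  search-sound : ∀ {n x k} → graph search n x k → Found n x k
  search-sound (γ , before) = G-zero γ , λ j j<k → G-suc (proj₂ (before j j<k))

  search-complete : ∀ {n x k} → Found n x k → graph search n x k
  search-complete ((_ , e) , before) = zero-G e , λ j j<k → 0 , suc-G (before j j<k)

-- The number is found by guessing: the search compares 0, 1, 2, ... with it, each guess being
-- passed to the comparing term as a constant sequence.
head-realised : ∀ {p q φ} → 1 ≤ p + q → (∀ n {x x′} → x ≋ x′ → φ n x ≗ φ n x′) →
  Realises {p} {q} seq φ →
                Realises {p} {q} num (λ n x → φ n x 0)
head-realised {p} {q} {φ} 1≤ resp r = record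
  { recursive = search-recursive
  ; sound     = λ { {n} {x} {k} γ → found-value n x k (proj₁ (search-sound γ)) }
  ; complete  = λ n x → search-complete
    ((0 , trans (guess-≡ n x _) (cong bit (≡ᵇ-refl (φ n x 0)))) ,
      λ j j<k → trans (guess-≡ n x j) (cong bit (≢⇒≡ᵇ-false (<⇒≢ j<k)))) }
  where
  weakened : Realises {suc p} {q} seq
    (λ n x → φ (tabulate (λ i → lookup n (suc i))) (tabulate (lookup x)))
  weakened = compose-realised {φ = φ} (λ {n} → resp n) r
    (λ i → projNum-realised (suc i)) projSeq-realised
  guess : PR 2 1
  guess = ask zero zero ≡ᵗ ask (suc zero) zero
  guesses : ∀ j → Realises {suc p} {q} seq
    (λ n x → lookup ((λ _ → head n) ∷ φ (tabulate (λ i → lookup n (suc i)))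
    (tabulate (lookup x)) ∷ []) j)
  guesses zero       = constSeq 1≤
  guesses (suc zero) = weakened
  open Search 1≤ (term-realised (s≤s z≤n) guess guesses)
  guess-≡ : ∀ n x k → eval guess
    (tabulate λ j → lookup ((λ _ → k) ∷ φ (tabulate (λ i → lookup (k ∷ n) (suc i)))
    (tabulate (lookup x)) ∷ []) j) (0 ∷ []) ≡
            bit (k ≡ᵇ φ n x 0)
  guess-≡ n x k = trans (eval-≡ _ (0 ∷ []) (ask zero zero) (ask (suc zero) zero))
    (cong (λ v → bit (k ≡ᵇ v)) (cong₂ (λ n x → φ n x 0) (tabulate∘lookup n) (tabulate∘lookup x)))
  found-value : ∀ n x k → (∃[ v ] _ ≡ suc v) → k ≡ φ n x 0
  found-value n x k (v , e) with trans (sym (guess-≡ n x k)) e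
  ... | e′ with k ≡ᵇ φ n x 0 in eq
  ... | true = ≡ᵇ⇒≡ k _ (subst T (sym eq) _)
  found-value n x k (v , e) | () | false

-- Configurations coded as sequences

cell : List ℕ → ℕ → ℕ
-- Beyond the list the tape is blank, as for `first`, so the ends of the lists leave no trace in a
-- code.
cell []      i       = 0
cell (s ∷ l) zero    = s
cell (s ∷ l) (suc i) = cell l i

cell-first : ∀ l → cell l 0 ≡ first l
cell-first []      = refl
cell-first (_ ∷ _) = refl

cell-drop : ∀ l i → cell (drop 1 l) i ≡ cell l (suc i)
cell-drop []      i = refl
cell-drop (_ ∷ _) i = refl

tapeAt : ∀ {k} → Vec Tape k → ℕ → Tape
tapeAt []       i       = blank
tapeAt (t ∷ ts) zero    = t
tapeAt (t ∷ ts) (suc i) = tapeAt ts i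

baireAt : ∀ {r} → Vec 𝒩 r → ℕ → 𝒩
baireAt []       i       = 0𝒩
baireAt (y ∷ ys) zero    = y
baireAt (y ∷ ys) (suc i) = baireAt ys i

tapeAt-toℕ : ∀ {k} (ts : Vec Tape k) j → tapeAt ts (toℕ j) ≡ lookup ts j
tapeAt-toℕ (t ∷ ts) zero    = refl
tapeAt-toℕ (t ∷ ts) (suc j) = tapeAt-toℕ ts j

baireAt-toℕ : ∀ {r} (ys : Vec 𝒩 r) j → baireAt ys (toℕ j) ≡ lookup ys j
baireAt-toℕ (y ∷ ys) zero    = refl
baireAt-toℕ (y ∷ ys) (suc j) = baireAt-toℕ ys j

tapeAt-update : ∀ {k} (ts : Vec Tape k) j f i →
                tapeAt (ts [ j ]%= f) i ≡ (if i ≡ᵇ toℕ j then f (tapeAt ts i) else tapeAt ts i)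
tapeAt-update (t ∷ ts) zero    f zero    = refl
tapeAt-update (t ∷ ts) zero    f (suc i) = refl
tapeAt-update (t ∷ ts) (suc j) f zero    = refl
tapeAt-update (t ∷ ts) (suc j) f (suc i) = tapeAt-update ts j f i

baireAt-update : ∀ {r} (ys : Vec 𝒩 r) j z i →
                 baireAt (ys [ j ]≔ z) i ≡ (if i ≡ᵇ toℕ j then z else baireAt ys i)
baireAt-update (y ∷ ys) zero    z zero    = refl
baireAt-update (y ∷ ys) zero    z (suc i) = refl
baireAt-update (y ∷ ys) (suc j) z zero    = refl
baireAt-update (y ∷ ys) (suc j) z (suc i) = baireAt-update ys j z i

-- Reads the position n of a sequence as n = (a, (t, i)).

decodedᵗ : ∀ {r} → PR r 3 → PR r 1
decodedᵗ t = app t (fstᵗ (var #0) ∷ fstᵗ (sndᵗ (var #0)) ∷ sndᵗ (sndᵗ (var #0)) ∷ [])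

eval-decoded : ∀ {r} (f : PR r 3) xs a t i →
               eval (decodedᵗ f) xs (pair a (pair t i) ∷ []) ≡ eval f xs (a ∷ t ∷ i ∷ [])
eval-decoded f xs a t i = cong (eval f xs)
  (cong₂ _∷_ (trans (eval-fst xs ρ (var #0)) (cong proj₁ (unpair-pair a (pair t i))))
    (cong₂ _∷_ (trans (eval-fst xs ρ (sndᵗ (var #0)))
                      (trans (cong fst snd≡) (cong proj₁ (unpair-pair t i))))
      (cong (_∷ []) (trans (eval-snd xs ρ (sndᵗ (var #0)))
                           (trans (cong snd snd≡) (cong proj₂ (unpair-pair t i)))))))
  where
  ρ : Vec ℕ 1
  ρ = pair a (pair t i) ∷ []
  snd≡ : eval (sndᵗ (var #0)) xs ρ ≡ pair t i
  snd≡ = trans (eval-snd xs ρ (var #0)) (cong proj₂ (unpair-pair a (pair t i)))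

module Encoding {q : ℕ} (M : MSMachine q) where

  open MS M hiding (bit) public

  MC = MasterCommand #tapes #baire
  MT = MasterTest #tapes
  MR = Rule MT MC

  -- A configuration is coded in one sequence, at position (a, (t, i)): for
  -- a = 0 the state and the bit, for a = 1 and a = 2 the cells of master
  -- tape t before and after the head, for a = 3 the Baire tape t.

  component : Config → ℕ → ℕ → ℕ → ℕ
  component (s , m) 0 0       i = s
  component (s , m) 0 1       i = bit (Memory.bit m)
  component (s , m) 1 t       i = cell (before (tapeAt (tapes m) t)) i
  component (s , m) 2 t       i = cell (after (tapeAt (tapes m) t)) i
  component (s , m) 3 t       i = baireAt (baire m) t i
  component (s , m) _ t       i = 0

  -- Only the entries matter, so any sequence pointwise equal to a code is a code again.
  record Encodes (u : 𝒩) (c : Config) : Set where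
    constructor encodes
    field
      decode : ∀ a t i → u (pair a (pair t i)) ≡ component c a t i

  open Encodes public

  infix 30 _at_

  oldᵗ : ∀ {r n} → PR (suc r) n → PR (suc r) n → PR (suc r) n → PR (suc r) n
  oldᵗ a t i = ask zero (pairᵗ a (pairᵗ t i))

  stateᵗ : ∀ {r n} → PR (suc r) n
  stateᵗ = oldᵗ (numᵗ 0) (numᵗ 0) (numᵗ 0)

  testᵗ : ∀ {r n} → MT → PR (suc r) n
  testᵗ (scan t s) = oldᵗ (numᵗ 2) (numᵗ (toℕ t)) (numᵗ 0) ≡ᵗ numᵗ s
  testᵗ (bit? b)   = oldᵗ (numᵗ 0) (numᵗ 1) (numᵗ 0) ≡ᵗ numᵗ (bit b)

  matchᵗ : ∀ {r n} → MR → PR (suc r) n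
  matchᵗ ρ = (numᵗ (from ρ) ≡ᵗ stateᵗ) ∧ᵗ testᵗ (test ρ)

  -- Kept generic in `k`, because the same choice of a rule yields the next entry and also tells
  -- whether a step calls a slave or tests for zero.
  selectᵗ : ∀ {r n} → (MR → PR (suc r) n) → PR (suc r) n → List MR → PR (suc r) n
  selectᵗ k d []       = d
  selectᵗ k d (ρ ∷ ρs) = ifᵗ matchᵗ ρ then k ρ else selectᵗ k d ρs

  ruleCaseᵗ : ∀ {r n} → (MR → PR (suc r) n) → PR (suc r) n → PR (suc r) n
  ruleCaseᵗ k d = ifᵗ stateᵗ then selectᵗ k d program else d

  _at_ : ℕ → ℕ → PR 3 3
  a at t = (var #0 ≡ᵗ numᵗ a) ∧ᵗ (var #1 ≡ᵗ numᵗ t)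

  same : PR 3 3
  same = oldᵗ (var #0) (var #1) (var #2)

  -- The variables are the coordinates a, t, i of one entry of the next code. Oracle 0 is the
  -- present code, oracle 1 the answer of the slave and oracle 2 the test result.
  nextᵗ : MC → PR 3 3
  nextᵗ (act t (write s)) =
    ifᵗ 2 at toℕ t then (ifᵗ var #2 then oldᵗ (numᵗ 2) (var #1) (var #2) else numᵗ s) else same
  nextᵗ (act t left) =
    ifᵗ 1 at toℕ t then oldᵗ (numᵗ 1) (var #1) (suc (var #2)) else
    (ifᵗ 2 at toℕ t then
      (ifᵗ var #2 then oldᵗ (numᵗ 2) (var #1) (var #2 ∸ᵗ numᵗ 1) else oldᵗ (numᵗ 1) (var #1)
        (numᵗ 0))
     else same)
  nextᵗ (act t right) =
    ifᵗ 1 at toℕ t then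
      (ifᵗ var #2 then oldᵗ (numᵗ 1) (var #1) (var #2 ∸ᵗ numᵗ 1) else oldᵗ (numᵗ 2) (var #1)
        (numᵗ 0))
    else (ifᵗ 2 at toℕ t then oldᵗ (numᵗ 2) (var #1) (suc (var #2)) else same)
  nextᵗ (call l)  = ifᵗ 3 at toℕ l then ask #1 (var #2) else same
  nextᵗ zeroTest  = ifᵗ 0 at 1 then ask #2 zero else same

  nextRuleᵗ : MR → PR 3 3
  nextRuleᵗ ρ = ifᵗ 0 at 0 then numᵗ (to ρ) else nextᵗ (command ρ)

  -- The next configuration from the current one, the value of the slave
  -- call and the result of the zero test.

  stepᵗ : PR 3 1
  stepᵗ = decodedᵗ (ruleCaseᵗ nextRuleᵗ same)

  -- Every command is handed both a slave's answer and a test result, in keeping with strict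
  -- composition, where both are always evaluated.
  effect : MC → Memory → 𝒩 → Bool → Memory
  effect (act t a) (memory ts ys b) z β = memory (ts [ t ]%= perform a) ys b
  effect (call l)  (memory ts ys b) z β = memory ts (ys [ l ]≔ z) b
  effect zeroTest  (memory ts ys b) z β = memory ts ys β

  module _ {u : 𝒩} {s : ℕ} {m : Memory} (enc : Encodes u (s , m)) where

    private
      C : ℕ → ℕ → ℕ → ℕ
      C = component (s , m)

    module _ {r n} (xs : Vec 𝒩 r) (ρ : Vec ℕ n) where

      eval-old : ∀ a t i → eval (oldᵗ a t i) (u ∷ xs) ρ ≡
                 C (eval a (u ∷ xs) ρ) (eval t (u ∷ xs) ρ) (eval i (u ∷ xs) ρ)
      eval-old a t i = trans (cong u (trans (eval-pair (u ∷ xs) ρ a (pairᵗ t i))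
        (cong (pair _) (eval-pair (u ∷ xs) ρ t i)))) (decode enc _ _ _)

      eval-old-≡ : ∀ a t i {a′ t′ i′} → eval a (u ∷ xs) ρ ≡ a′ → eval t (u ∷ xs) ρ ≡ t′ →
                   eval i (u ∷ xs) ρ ≡ i′ → eval (oldᵗ a t i) (u ∷ xs) ρ ≡ C a′ t′ i′
      eval-old-≡ a t i refl refl refl = eval-old a t i

      private
        num≡ : ∀ k → eval (numᵗ k) (u ∷ xs) ρ ≡ k
        num≡ = eval-num (u ∷ xs) ρ

      eval-state : eval stateᵗ (u ∷ xs) ρ ≡ s
      eval-state = eval-old-≡ (numᵗ 0) (numᵗ 0) (numᵗ 0) (num≡ 0) (num≡ 0) (num≡ 0)

      eval-test : ∀ t → eval (testᵗ t) (u ∷ xs) ρ ≡ bit (holds m t)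
      eval-test (scan t v) = trans (eval-≡ (u ∷ xs) ρ _ (numᵗ v)) (cong bit (cong₂ _≡ᵇ_
        (trans (eval-old-≡ (numᵗ 2) (numᵗ (toℕ t)) (numᵗ 0) (num≡ 2) (num≡ (toℕ t)) (num≡ 0))
          (trans (cell-first (after (tapeAt (tapes m) (toℕ t))))
            (cong scanned (tapeAt-toℕ (tapes m) t)))) (num≡ v)))
      eval-test (bit? b) = trans (eval-≡ (u ∷ xs) ρ _ (numᵗ (bit b))) (cong bit (trans (cong₂ _≡ᵇ_
        (eval-old-≡ (numᵗ 0) (numᵗ 1) (numᵗ 0) (num≡ 0) (num≡ 1) (num≡ 0)) (num≡ (bit b)))
        (bits (Memory.bit m) b)))
        where
        bits : ∀ b b′ → (bit b ≡ᵇ bit b′) ≡ does (b ≟ᵇ b′)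
        bits false false = refl
        bits false true  = refl
        bits true  false = refl
        bits true  true  = refl

      eval-match : ∀ σ → eval (matchᵗ σ) (u ∷ xs) ρ ≡ bit ((from σ ≡ᵇ s) ∧ holds m (test σ))
      eval-match σ = eval-∧ (u ∷ xs) ρ _ (testᵗ (test σ))
        (trans (eval-≡ (u ∷ xs) ρ (numᵗ (from σ)) stateᵗ)
          (cong bit (cong₂ _≡ᵇ_ (num≡ (from σ)) eval-state))) (eval-test (test σ))

      chosen : (MR → PR (suc r) n) → PR (suc r) n → Maybe MR → PR (suc r) n
      chosen k d (just σ) = k σ
      chosen k d nothing  = d

    module _ {r n} (xs : Vec 𝒩 r) (ρ : Vec ℕ n) where

      eval-select : ∀ {s′} → s ≡ suc s′ → ∀ k d σs → eval (selectᵗ k d σs) (u ∷ xs) ρ ≡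
                    eval (chosen xs ρ k d (applicable (holds m) s σs)) (u ∷ xs) ρ
      eval-select refl k d [] = refl
      eval-select refl k d (σ ∷ σs)
        with (from σ ≡ᵇ s) ∧ holds m (test σ) | eval-match xs ρ σ
      ... | true  | e = eval-if (u ∷ xs) ρ (matchᵗ σ) (k σ) _ {true} e
      ... | false | e = trans (eval-if (u ∷ xs) ρ (matchᵗ σ) (k σ) _ {false} e)
            (eval-select refl k d σs)

      eval-ruleCase : ∀ k d → eval (ruleCaseᵗ k d) (u ∷ xs) ρ ≡
                      eval (chosen xs ρ k d (applicable (holds m) s program)) (u ∷ xs) ρ
      eval-ruleCase k d = go s refl
        where
        go : ∀ s′ → s ≡ s′ → eval (ruleCaseᵗ k d) (u ∷ xs) ρ ≡
             eval (chosen xs ρ k d (applicable (holds m) s program)) (u ∷ xs) ρ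
        go zero refl = eval-if-zero (u ∷ xs) ρ stateᵗ _ d (eval-state xs ρ)
        go (suc s′) e = trans (eval-if-suc (u ∷ xs) ρ stateᵗ _ d (trans (eval-state xs ρ) e))
                              (eval-select e k d program)

    module _ (z w : 𝒩) (a t i : ℕ) where

      private
        xs : Vec 𝒩 3
        xs = u ∷ z ∷ w ∷ []
        ρ : Vec ℕ 3
        ρ = a ∷ t ∷ i ∷ []

      eval-at : ∀ b v → eval (b at v) xs ρ ≡ bit ((a ≡ᵇ b) ∧ (t ≡ᵇ v))
      eval-at b v = eval-∧ xs ρ (var #0 ≡ᵗ numᵗ b) (var #1 ≡ᵗ numᵗ v)
        (trans (eval-≡ xs ρ (var #0) (numᵗ b)) (cong (λ c → bit (a ≡ᵇ c)) (eval-num xs ρ b)))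
        (trans (eval-≡ xs ρ (var #1) (numᵗ v)) (cong (λ c → bit (t ≡ᵇ c)) (eval-num xs ρ v)))

      eval-same : eval same xs ρ ≡ C a t i
      eval-same = eval-old (z ∷ w ∷ []) ρ (var #0) (var #1) (var #2)

      if-at : ∀ b v k d {k′ d′} → eval k xs ρ ≡ k′ → eval d xs ρ ≡ d′ →
              eval (ifᵗ b at v then k else d) xs ρ ≡ (if (a ≡ᵇ b) ∧ (t ≡ᵇ v) then k′ else d′)
      if-at b v k d refl refl = eval-if xs ρ (b at v) k d {(a ≡ᵇ b) ∧ (t ≡ᵇ v)} (eval-at b v)

      by-index : ∀ k d {d′} (f : ℕ → ℕ) → (∀ j → i ≡ suc j → eval k xs ρ ≡ f j) → eval d xs ρ ≡ d′ →
                 eval (ifᵗ var #2 then k else d) xs ρ ≡ natrec d′ (λ j _ → f j) i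
      by-index k d f ek ed = go i refl
        where
        go : ∀ i′ → i ≡ i′ → eval (ifᵗ var #2 then k else d) xs ρ ≡ natrec _ (λ j _ → f j) i′
        go zero    e = trans (eval-if-zero xs ρ (var #2) k d e) ed
        go (suc j) e = trans (eval-if-suc xs ρ (var #2) k d e) (ek j e)

      eval-cell : ∀ b k {j} → eval k xs ρ ≡ j → eval (oldᵗ (numᵗ b) (var #1) k) xs ρ ≡ C b t j
      eval-cell b k e = eval-old-≡ (z ∷ w ∷ []) ρ (numᵗ b) (var #1) k (eval-num xs ρ b) refl e

      eval-pred : ∀ j → i ≡ suc j → eval (var #2 ∸ᵗ numᵗ 1) xs ρ ≡ j
      eval-pred j e = trans (eval-∸ xs ρ (var #2) (numᵗ 1)) (cong₂ _∸_ e (eval-num xs ρ 1))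

    eval-next : ∀ c z w β a t i → (c ≡ zeroTest → w 0 ≡ bit β) →
               eval (nextᵗ c) (u ∷ z ∷ w ∷ []) (a ∷ t ∷ i ∷ []) ≡ component
                 (s , effect c m z β) a t i
    eval-next (act t₀ (write v)) z w β a t i _ = trans
      (if-at z w a t i 2 (toℕ t₀) _ same
        (by-index z w a t i _ (numᵗ v) (λ j → C 2 t (suc j))
          (λ { j refl → eval-cell z w a t i 2 (var #2) refl }) (eval-num _ (a ∷ t ∷ i ∷ []) v))
        (eval-same z w a t i))
      (cells m a t i)
      where
      cells : ∀ m a t i → (if (a ≡ᵇ 2) ∧ (t ≡ᵇ toℕ t₀)
                           then natrec v (λ j _ → component (s , m) 2 t (suc j)) i else component
                             (s , m) a t i) ≡
              component (s , effect (act t₀ (write v)) m z β) a t i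
      cells (memory ts ys b) 0 0 i = refl
      cells (memory ts ys b) 0 1 i = refl
      cells (memory ts ys b) 0 (suc (suc t)) i = refl
      cells (memory ts ys b) 1 t i rewrite tapeAt-update ts t₀
        (perform (write v)) t with t ≡ᵇ toℕ t₀
      ... | true  = refl
      ... | false = refl
      cells (memory ts ys b) 2 t i rewrite tapeAt-update ts t₀
        (perform (write v)) t with t ≡ᵇ toℕ t₀
      cells (memory ts ys b) 2 t zero    | true  = refl
      cells (memory ts ys b) 2 t (suc i) | true  = sym (cell-drop (after (tapeAt ts t)) i)
      ... | false = refl
      cells (memory ts ys b) 3 t i = refl
      cells (memory ts ys b) (suc (suc (suc (suc a)))) t i = refl
    eval-next (act t₀ left) z w β a t i _ = trans
      (if-at z w a t i 1 (toℕ t₀) _ _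
        (eval-cell z w a t i 1 (suc (var #2)) refl)
        (if-at z w a t i 2 (toℕ t₀) _ same
          (by-index z w a t i _ _ (λ j → C 2 t j)
            (λ j e → eval-cell z w a t i 2 (var #2 ∸ᵗ numᵗ 1) (eval-pred z w a t i j e))
            (eval-cell z w a t i 1 (numᵗ 0) (eval-num _ (a ∷ t ∷ i ∷ []) 0)))
          (eval-same z w a t i)))
      (cells m a t i)
      where
      cells : ∀ m a t i → (if (a ≡ᵇ 1) ∧ (t ≡ᵇ toℕ t₀) then component (s , m) 1 t (suc i) else
                           if (a ≡ᵇ 2) ∧ (t ≡ᵇ toℕ t₀)
                           then natrec (component (s , m) 1 t 0) (λ j _ → component (s , m) 2 t j) i
                           else component (s , m) a t i) ≡
              component (s , effect (act t₀ left) m z β) a t i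
      cells (memory ts ys b) 0 0 i = refl
      cells (memory ts ys b) 0 1 i = refl
      cells (memory ts ys b) 0 (suc (suc t)) i = refl
      cells (memory ts ys b) 1 t i rewrite tapeAt-update ts t₀
        (perform left) t with t ≡ᵇ toℕ t₀ | tapeAt ts t
      ... | true  | tape []      _ = refl
      ... | true  | tape (_ ∷ _) _ = refl
      ... | false | _ = refl
      cells (memory ts ys b) 2 t i rewrite tapeAt-update ts t₀
        (perform left) t with t ≡ᵇ toℕ t₀ | tapeAt ts t
      cells (memory ts ys b) 2 t zero    | true | tape []      _ = refl
      cells (memory ts ys b) 2 t (suc i) | true | tape []      _ = refl
      cells (memory ts ys b) 2 t zero    | true | tape (_ ∷ _) _ = refl
      cells (memory ts ys b) 2 t (suc i) | true | tape (_ ∷ _) _ = refl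
      ... | false | _ = refl
      cells (memory ts ys b) 3 t i = refl
      cells (memory ts ys b) (suc (suc (suc (suc a)))) t i = refl
    eval-next (act t₀ right) z w β a t i _ = trans
      (if-at z w a t i 1 (toℕ t₀) _ _
        (by-index z w a t i _ _ (λ j → C 1 t j)
          (λ j e → eval-cell z w a t i 1 (var #2 ∸ᵗ numᵗ 1) (eval-pred z w a t i j e))
          (eval-cell z w a t i 2 (numᵗ 0) (eval-num _ (a ∷ t ∷ i ∷ []) 0)))
        (if-at z w a t i 2 (toℕ t₀) _ same
          (eval-cell z w a t i 2 (suc (var #2)) refl)
          (eval-same z w a t i)))
      (cells m a t i)
      where
      cells : ∀ m a t i → (if (a ≡ᵇ 1) ∧ (t ≡ᵇ toℕ t₀)
                           then natrec (component (s , m) 2 t 0)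
                             (λ j _ → component (s , m) 1 t j) i else
                           if (a ≡ᵇ 2) ∧ (t ≡ᵇ toℕ t₀) then component (s , m) 2 t (suc i)
                           else component (s , m) a t i) ≡
              component (s , effect (act t₀ right) m z β) a t i
      cells (memory ts ys b) 0 0 i = refl
      cells (memory ts ys b) 0 1 i = refl
      cells (memory ts ys b) 0 (suc (suc t)) i = refl
      cells (memory ts ys b) 1 t i rewrite tapeAt-update ts t₀ (perform right) t with t ≡ᵇ toℕ t₀
      cells (memory ts ys b) 1 t zero    | true  = cell-first (after (tapeAt ts t))
      cells (memory ts ys b) 1 t (suc i) | true  = refl
      ... | false = refl
      cells (memory ts ys b) 2 t i rewrite tapeAt-update ts t₀ (perform right) t with t ≡ᵇ toℕ t₀
      ... | true  = sym (cell-drop (after (tapeAt ts t)) i)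
      ... | false = refl
      cells (memory ts ys b) 3 t i = refl
      cells (memory ts ys b) (suc (suc (suc (suc a)))) t i = refl
    eval-next (call l) z w β a t i _ = trans
      (if-at z w a t i 3 (toℕ l) (ask #1 (var #2)) same refl (eval-same z w a t i))
      (cells m a t i)
      where
      cells : ∀ m a t i → (if (a ≡ᵇ 3) ∧ (t ≡ᵇ toℕ l) then z i else component (s , m) a t i) ≡
              component (s , effect (call l) m z β) a t i
      cells (memory ts ys b) 0 0 i = refl
      cells (memory ts ys b) 0 1 i = refl
      cells (memory ts ys b) 0 (suc (suc t)) i = refl
      cells (memory ts ys b) 1 t i = refl
      cells (memory ts ys b) 2 t i = refl
      cells (memory ts ys b) 3 t i rewrite baireAt-update ys l z t with t ≡ᵇ toℕ l
      ... | true  = refl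
      ... | false = refl
      cells (memory ts ys b) (suc (suc (suc (suc a)))) t i = refl
    eval-next zeroTest z w β a t i wβ = trans
      (if-at z w a t i 0 1 (ask #2 zero) same (wβ refl) (eval-same z w a t i))
      (cells m a t i)
      where
      cells : ∀ m a t i → (if (a ≡ᵇ 0) ∧ (t ≡ᵇ 1) then bit β else component (s , m) a t i) ≡
              component (s , effect zeroTest m z β) a t i
      cells (memory ts ys b) 0 0 i = refl
      cells (memory ts ys b) 0 1 i = refl
      cells (memory ts ys b) 0 (suc (suc t)) i = refl
      cells (memory ts ys b) 1 t i = refl
      cells (memory ts ys b) 2 t i = refl
      cells (memory ts ys b) 3 t i = refl
      cells (memory ts ys b) (suc (suc (suc (suc a)))) t i = refl

    eval-nextRule : ∀ σ z w β a t i → (command σ ≡ zeroTest → w 0 ≡ bit β) →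
                   eval (nextRuleᵗ σ) (u ∷ z ∷ w ∷ []) (a ∷ t ∷ i ∷ []) ≡
                   component (to σ , effect (command σ) m z β) a t i
    eval-nextRule σ z w β a t i wβ = trans
      (if-at z w a t i 0 0 (numᵗ (to σ)) (nextᵗ (command σ)) (eval-num _ (a ∷ t ∷ i ∷ []) (to σ))
        (eval-next (command σ) z w β a t i wβ)) (header a t)
      where
      header : ∀ a t → (if (a ≡ᵇ 0) ∧ (t ≡ᵇ 0) then to σ else component
        (s , effect (command σ) m z β) a t i) ≡
               component (to σ , effect (command σ) m z β) a t i
      header 0 0             = refl
      header 0 1             = refl
      header 0 (suc (suc t)) = refl
      header 1 t             = refl
      header 2 t             = refl
      header 3 t             = refl
      header (suc (suc (suc (suc a)))) t = refl

    -- Where no rule applies the configuration is repeated. A machine stuck in a nonzero state thus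
    -- never shows state 0, and the search for its halting time diverges as it should.
    next : 𝒩 → Bool → Maybe MR → Config
    next z β (just σ) = to σ , effect (command σ) m z β
    next z β nothing  = s , m

    eval-step : ∀ {u′} z w β → u′ ≗ (λ n → eval stepᵗ (u ∷ z ∷ w ∷ []) (n ∷ [])) →
                (∀ {σ} → applicable (holds m) s program ≡ just σ → command σ ≡ zeroTest →
                  w 0 ≡ bit β) →
                Encodes u′ (next z β (applicable (holds m) s program))
    eval-step {u′} z w β u′≡ wβ .decode a t i = trans (u′≡ (pair a (pair t i)))
      (trans (eval-decoded (ruleCaseᵗ nextRuleᵗ same) xs a t i)
        (trans (eval-ruleCase (z ∷ w ∷ []) (a ∷ t ∷ i ∷ []) nextRuleᵗ same)
          (go (applicable (holds m) s program) refl)))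
      where
      xs : Vec 𝒩 3
      xs = u ∷ z ∷ w ∷ []
      go : ∀ r → applicable (holds m) s program ≡ r →
           eval (chosen (z ∷ w ∷ []) (a ∷ t ∷ i ∷ []) nextRuleᵗ same r) xs
             (a ∷ t ∷ i ∷ []) ≡ component (next z β r) a t i
      go (just σ) e = eval-nextRule σ z w β a t i (wβ e)
      go nothing  e = eval-same z w a t i

-- One step as a partial recursive function

block-cell : ∀ l → (cell l (block l) ≡ᵇ 1) ≡ false
block-cell []                 = refl
block-cell (0 ∷ l)            = refl
block-cell (1 ∷ l)            = block-cell l
block-cell (suc (suc _) ∷ l)  = refl

block-below : ∀ l {j} → j < block l → cell l j ≡ 1
block-below (1 ∷ l) {zero}  _         = refl
block-below (1 ∷ l) {suc j} (s≤s j<b) = block-below l j<b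

-- The number on a tape is the first position without a stroke, so a search can determine it.
block-unique : ∀ l k → (cell l k ≡ᵇ 1) ≡ false → (∀ j → j < k → (cell l j ≡ᵇ 1) ≡ true) →
  k ≡ block l
block-unique l k e earlier with <-cmp k (block l)
... | tri≈ _ k≡b _ = k≡b
... | tri< k<b _ _ = case trans (sym (cong (_≡ᵇ 1) (block-below l k<b))) e of λ ()
... | tri> _ _ b<k = case trans (sym (earlier _ b<k)) (block-cell l) of λ ()

unstroked : ∀ {b v} → (if b then 0 else 1) ≡ suc v → b ≡ false
unstroked {false} _ = refl

stroked : ∀ {b} → (if b then 0 else 1) ≡ 0 → b ≡ true
stroked {true} _ = refl

bit-suc : ∀ {b v} → bit b ≡ suc v → b ≡ true
bit-suc {true} _ = refl

bit-zero : ∀ {b} → bit b ≡ 0 → b ≡ false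
bit-zero {false} _ = refl

noNum : ∀ {p q} → Fin 0 → PFun p q num
noNum ()

module StepFunction {q : ℕ} (M : MSMachine q) where

  open Encoding M public

  Encodes-≗ : ∀ {u u′ c} → u′ ≗ u → Encodes u c → Encodes u′ c
  Encodes-≗ e enc .decode a t i = trans (e _) (decode enc a t i)

  isCall isZeroTest : MC → Bool
  isCall (call _) = true
  isCall _        = false
  isZeroTest zeroTest = true
  isZeroTest _        = false

  onCommand : (MC → Bool) → Maybe MR → Bool
  onCommand P (just σ) = P (command σ)
  onCommand P nothing  = false

  onCommandᵗ : ∀ {r n} → (MC → Bool) → PR (suc r) n
  onCommandᵗ P = ruleCaseᵗ (λ σ → numᵗ (bit (P (command σ)))) (numᵗ 0)

  eval-onCommand : ∀ {u s m} (enc : Encodes u (s , m)) {r n} (xs : Vec 𝒩 r) (ρ : Vec ℕ n) P →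
                   eval (onCommandᵗ P) (u ∷ xs) ρ ≡ bit
                     (onCommand P (applicable (holds m) s program))
  eval-onCommand {u} {s} {m} enc xs ρ P =
    trans (eval-ruleCase enc xs ρ _ (numᵗ 0)) (go (applicable (holds m) s program))
    where
    go : ∀ o → eval (chosen enc xs ρ (λ σ → numᵗ (bit (P (command σ)))) (numᵗ 0) o)
      (u ∷ xs) ρ ≡ bit (onCommand P o)
    go (just σ) = eval-num (u ∷ xs) ρ (bit (P (command σ)))
    go nothing  = eval-num (u ∷ xs) ρ 0

  -- Ψ must also be defined when no slave is called; it is then applied to
  -- a program that computes the zero sequence.

  idle : ℕ
  idle = index {#baire} zero

  unstrokedᵗ : Fin #tapes → PR 2 1
  unstrokedᵗ j = ifᵗ oldᵗ (numᵗ 2) (numᵗ (toℕ j)) (ask #1 zero) ≡ᵗ numᵗ 1 then numᵗ 0 else numᵗ 1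

  -- One search must deliver the index for `Ψ` in every case, so the term itself chooses between
  -- looking for the end of the billboard's block and looking for `idle`.
  codeᵗ : PR 2 1
  codeᵗ = ifᵗ onCommandᵗ isCall then unstrokedᵗ billboard else (ask #1 zero ≡ᵗ numᵗ idle)

  codeArguments : Fin 2 → Vec ℕ 1 → Vec 𝒩 1 → 𝒩
  codeArguments zero       n x = lookup x zero
  codeArguments (suc zero) n x = λ _ → head n

  codeArguments-realised : ∀ j → Realises seq (codeArguments j)
  codeArguments-realised zero       = projSeq-realised zero
  codeArguments-realised (suc zero) = constSeq (s≤s z≤n)

  module CodeSearch = Search {0} {1} (s≤s z≤n)
    (term-realised (s≤s z≤n) codeᵗ codeArguments-realised)

  module _ {u s m} (enc : Encodes u (s , m)) where

    private
      o : Maybe MR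
      o = applicable (holds m) s program
      bill : List ℕ
      bill = after (lookup (tapes m) billboard)

    eval-unstroked : ∀ j k → eval (unstrokedᵗ j) (u ∷ (λ _ → k) ∷ []) (0 ∷ []) ≡
                     (if cell (after (lookup (tapes m) j)) k ≡ᵇ 1 then 0 else 1)
    eval-unstroked j k = trans
      (eval-if xs ρ _ (numᵗ 0) (numᵗ 1) (trans (eval-≡ xs ρ _ (numᵗ 1)) (cong bit (cong₂ _≡ᵇ_
        (trans (eval-old-≡ enc ((λ _ → k) ∷ []) ρ (numᵗ 2) (numᵗ (toℕ j)) (ask #1 zero)
                 (eval-num xs ρ 2) (eval-num xs ρ (toℕ j)) refl)
               (cong (λ t → cell (after t) k) (tapeAt-toℕ (tapes m) j)))
        (eval-num xs ρ 1)))))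
      (cong₂ (if_then_else_ (cell (after (lookup (tapes m) j)) k ≡ᵇ 1)) (eval-num xs ρ 0)
        (eval-num xs ρ 1))
      where
      xs : Vec 𝒩 2
      xs = u ∷ (λ _ → k) ∷ []
      ρ : Vec ℕ 1
      ρ = 0 ∷ []

    eval-code : ∀ k → eval codeᵗ (u ∷ (λ _ → k) ∷ []) (0 ∷ []) ≡
                (if onCommand isCall o then (if cell bill k ≡ᵇ 1 then 0 else 1) else bit
                  (k ≡ᵇ idle))
    eval-code k = trans (eval-if xs ρ _ (unstrokedᵗ billboard) _
      (eval-onCommand enc ((λ _ → k) ∷ []) ρ isCall))
      (cong₂ (if_then_else_ (onCommand isCall o)) (eval-unstroked billboard k)
        (trans (eval-≡ xs ρ (ask #1 zero) (numᵗ idle))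
          (cong (λ e → bit (k ≡ᵇ e)) (eval-num xs ρ idle))))
      where
      xs : Vec 𝒩 2
      xs = u ∷ (λ _ → k) ∷ []
      ρ : Vec ℕ 1
      ρ = 0 ∷ []

    code : ℕ
    code = if onCommand isCall o then block bill else idle

    code-sound : ∀ {k} → graph CodeSearch.search [] (u ∷ []) k → k ≡ code
    code-sound {k} γ with CodeSearch.search-sound γ
    ... | (v , found) , earlier with onCommand isCall o | trans (sym (eval-code k)) found |
          (λ j j<k → trans (sym (eval-code j)) (earlier j j<k))
    ... | false | e | _ = ≡ᵇ⇒≡ k idle (subst T (sym (bit-suc e)) _)
    ... | true  | e | b = block-unique bill k (unstroked e) λ j j<k → stroked (b j j<k)

    code-complete : graph CodeSearch.search [] (u ∷ []) code
    code-complete = CodeSearch.search-complete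
      ((0 , trans (eval-code code) found) , λ j j<k → trans (eval-code j) (earlier j j<k))
      where
      found : (if onCommand isCall o then (if cell bill code ≡ᵇ 1 then 0 else 1) else bit
        (code ≡ᵇ idle)) ≡ 1
      found with onCommand isCall o
      ... | true  rewrite block-cell bill = refl
      ... | false rewrite ≡ᵇ-refl idle    = refl
      earlier : ∀ j → j < code →
               (if onCommand isCall o then (if cell bill j ≡ᵇ 1 then 0 else 1) else bit
                 (j ≡ᵇ idle)) ≡ 0
      earlier j j<k with onCommand isCall o
      ... | true  rewrite block-below bill j<k        = refl
      ... | false rewrite ≢⇒≡ᵇ-false (<⇒≢ j<k) = refl

  tapeTermᵗ : Fin #baire → PR 1 1
  tapeTermᵗ l = oldᵗ (numᵗ 3) (numᵗ (toℕ l)) (var #0)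

  slaveTape : (l : Fin #baire) → Realises {0} {1} seq _
  slaveTape l = term-realised (s≤s z≤n) (tapeTermᵗ l) (λ j → projSeq-realised j)

  -- χ is applied to the zero sequence unless the zero test is carried out,
  -- since χ is not known to be defined elsewhere.

  guardᵗ : PR 1 1
  guardᵗ = ifᵗ onCommandᵗ isZeroTest then tapeTermᵗ zero else numᵗ 0

  guard : Realises {0} {1} seq _
  guard = term-realised (s≤s z≤n) guardᵗ (λ j → projSeq-realised j)

  constantly : Realises {1} {1} seq (λ n _ _ → head n)
  constantly = constSeq (s≤s z≤n)

  slaveFun testSeqFun stepFun : PFun 0 1 seq
  testFun : PFun 0 1 num
  slaveFun = compose (Ψ #baire) (λ _ → CodeSearch.search) (λ l → pfun (slaveTape l))
  testFun = compose χ noNum (λ _ → pfun guard)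
  -- The result of `χ` is a number and has to become a sequence before `stepᵗ` can read it.
  testSeqFun = compose (pfun constantly) (λ _ → testFun) (λ j → projSeq j)

  stepArguments : Fin 3 → PFun 0 1 seq
  stepArguments zero             = projSeq zero
  stepArguments (suc zero)       = slaveFun
  stepArguments (suc (suc zero)) = testSeqFun

  stepTerm : Realises {0} {3} seq _
  stepTerm = term-realised (s≤s z≤n) stepᵗ (λ j → projSeq-realised j)

  stepFun = compose (pfun stepTerm) noNum stepArguments

  step-recursive : PartialRecursive stepFun
  step-recursive = composeʳ {g = noNum} {h = stepArguments} (recursive stepTerm) (λ ()) λ where
    zero             → projSeqʳ zero
    (suc zero)       → composeʳ {g = λ _ → CodeSearch.search} {h = λ l → pfun (slaveTape l)}
                         (Ψʳ #baire) (λ _ → CodeSearch.search-recursive)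
                           (λ l → recursive (slaveTape l))
    (suc (suc zero)) → composeʳ {g = λ _ → testFun} {h = λ j → projSeq j} (recursive constantly)
      (λ _ → composeʳ {g = noNum} {h = λ _ → pfun guard} χʳ (λ ()) (λ _ → recursive guard))
        (λ j → projSeqʳ j)

  module _ {u s m} (enc : Encodes u (s , m)) where

    private
      o : Maybe MR
      o = applicable (holds m) s program

    slaveTape-≗ : ∀ l → (λ i → eval (tapeTermᵗ l) (u ∷ []) (i ∷ [])) ≗ lookup (baire m) l
    slaveTape-≗ l i = trans
      (eval-old-≡ enc [] (i ∷ []) (numᵗ 3) (numᵗ (toℕ l)) (var #0) (eval-num _ (i ∷ []) 3)
        (eval-num _ (i ∷ []) (toℕ l)) refl)
      (cong (λ f → f i) (baireAt-toℕ (baire m) l))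

    slave-sound : ∀ {z} → graph slaveFun [] (u ∷ []) z → Φω (baire m) (code enc) z
    slave-sound {z} (k ∷ [] , xs , K , X , φ) i =
      subst (λ e → Φ (baire m) e i (z i)) (code-sound enc (K zero))
        (Φ-cong {e = k} (lookup-≋ λ l j → trans (sound (slaveTape l) (X l) j) (slaveTape-≗ l j))
          (φ i))

    slave-complete : ∀ {z} → Φω (baire m) (code enc) z → graph slaveFun [] (u ∷ []) z
    slave-complete φ = code enc ∷ [] , baire m , (λ { zero → code-complete enc }) ,
      (λ l → complete-Eq (slaveTape l) (slaveTape-≗ l)) , φ

    guard-≗ : (λ i → eval guardᵗ (u ∷ []) (i ∷ [])) ≗
      (if onCommand isZeroTest o then lookup (baire m) zero else 0𝒩)
    guard-≗ i = trans (eval-if (u ∷ []) (i ∷ []) _ (tapeTermᵗ zero) (numᵗ 0)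
      (eval-onCommand enc [] (i ∷ []) isZeroTest))
      (trans (cong₂ (if_then_else_ (onCommand isZeroTest o)) (slaveTape-≗ zero i)
        (eval-num _ (i ∷ []) 0))
             (pointwise (onCommand isZeroTest o)))
      where
      pointwise : ∀ b → (if b then lookup (baire m) zero i else 0) ≡
        (if b then lookup (baire m) zero else 0𝒩) i
      pointwise true  = refl
      pointwise false = refl

    IsBit : Bool → Set
    IsBit β = IsZeroTest (if onCommand isZeroTest o then lookup (baire m) zero else 0𝒩) (bit β)

    -- The bit is taken from the graph of `χ`, whose two cases record the outcome; it could not be
    -- computed from the tape.
    test-sound : ∀ {w} → graph testSeqFun [] (u ∷ []) w → ∃[ β ] IsBit β × w ≗ λ _ → bit β
    test-sound {w} (v ∷ [] , xs , V , _ , c) with V zero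
    ... | _ , g ∷ [] , _ , G , χg with sound guard (G zero)
    ... | g≗ with respects χ {n = []} ((λ i → trans (g≗ i) (guard-≗ i)) ∷ []) refl χg
    ... | inj₁ (z , refl)  = true  , inj₁ (z , refl)  , sound constantly {1 ∷ []} {xs} c
    ... | inj₂ (nz , refl) = false , inj₂ (nz , refl) , sound constantly {0 ∷ []} {xs} c

    test-complete : ∀ {β} → IsBit β → graph testSeqFun [] (u ∷ []) (λ _ → bit β)
    test-complete {β} t = bit β ∷ [] , u ∷ [] ,
      (λ { zero → [] , _ ∷ [] , (λ ()) , (λ { zero → complete guard [] (u ∷ []) }) ,
           respects χ {n = []} ((λ i → sym (guard-≗ i)) ∷ []) refl t }) ,
      (λ { zero _ → refl }) , complete constantly (bit β ∷ []) (u ∷ [])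

    step-graph-sound : ∀ {u′} → graph stepFun [] (u ∷ []) u′ →
      ∃[ z ] ∃[ β ] Φω (baire m) (code enc) z × IsBit β × Encodes u′ (next enc z β o)
    step-graph-sound {u′} (_ , x₀ ∷ z ∷ w ∷ [] , _ , H , γ) with test-sound (H (suc (suc zero)))
    ... | β , t , w≡ = z , β , slave-sound (H (suc zero)) , t ,
      subst (Encodes u′) (next-≡ o) (eval-step enc₀ z w β (sound stepTerm γ) λ _ _ → w≡ 0)
      where
      -- The projection hands on some sequence pointwise equal to `u`, which is still a code.
      enc₀ : Encodes x₀ (s , m)
      enc₀ = Encodes-≗ (H zero) enc
      next-≡ : ∀ o → next enc₀ z β o ≡ next enc z β o
      next-≡ (just _) = refl
      next-≡ nothing  = refl

    step-graph-complete : ∀ {z β} → Φω (baire m) (code enc) z → IsBit β →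
      ∃[ u′ ] graph stepFun [] (u ∷ []) u′ × Encodes u′ (next enc z β o)
    step-graph-complete {z} {β} φ t = _ ,
      ([] , u ∷ z ∷ (λ _ → bit β) ∷ [] , (λ ()) ,
       (λ { zero _ → refl ; (suc zero) → slave-complete φ ; (suc (suc zero)) → test-complete t }) ,
       complete stepTerm [] (u ∷ z ∷ (λ _ → bit β) ∷ [])) ,
      eval-step enc z (λ _ → bit β) β (λ _ → refl) λ _ _ → refl

-- The initial configuration as a term

eval-cong  : ∀ {q n} (t : PR q n) {x x′ : Vec 𝒩 q} ρ → x ≋ x′ → eval t x ρ ≡ eval t x′ ρ
evals-cong : ∀ {q m n} (ts : Vec (PR q n) m) {x x′ : Vec 𝒩 q} ρ → x ≋ x′ →
  evals ts x ρ ≡ evals ts x′ ρ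

eval-cong (var i)    ρ e = refl
eval-cong zero       ρ e = refl
eval-cong (suc t)    ρ e = cong suc (eval-cong t ρ e)
eval-cong (ask j t) {x} {x′} ρ e = trans (cong (lookup x j) (eval-cong t ρ e))
  (Pointwise.lookup e j _)
eval-cong (app t ts) {x} {x′} ρ e = trans (cong (eval t x) (evals-cong ts ρ e))
  (eval-cong t (evals ts x′ ρ) e)
eval-cong (rec b s)  (k ∷ ρ) e = natrec-cong (eval-cong b ρ e) (λ i a → eval-cong s (i ∷ a ∷ ρ) e) k

evals-cong []       ρ e = refl
evals-cong (t ∷ ts) ρ e = cong₂ _∷_ (eval-cong t ρ e) (evals-cong ts ρ e)

-- Position `i` lies within the first block if i < N, on the blank behind it if i = N, and otherwise
-- in the remaining blocks, `suc N` places further on.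
strokesᵗ : ∀ {r n k} → Vec (PR r n) k → PR r n → PR r n
strokesᵗ []       i = numᵗ 0
strokesᵗ (N ∷ Ns) i =
  ifᵗ N ∸ᵗ i then numᵗ 1 else (ifᵗ i ∸ᵗ N then strokesᵗ Ns (i ∸ᵗ suc N) else numᵗ 0)

cell-strokes : ∀ N l i → natrec (natrec 0 (λ _ _ → cell l (i ∸ suc N)) (i ∸ N)) (λ _ _ → 1)
  (N ∸ i) ≡
               cell (replicate N 1 ++ 0 ∷ l) i
cell-strokes zero    l zero    = refl
cell-strokes zero    l (suc i) = refl
cell-strokes (suc N) l zero    = refl
cell-strokes (suc N) l (suc i) = cell-strokes N l i

eval-strokes : ∀ {r n k} (x : Vec 𝒩 r) (ρ : Vec ℕ n) (Ns : Vec (PR r n) k) (ns : Vec ℕ k) i →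
               (∀ j → eval (lookup Ns j) x ρ ≡ lookup ns j) →
               eval (strokesᵗ Ns i) x ρ ≡ cell (strokes (toList ns)) (eval i x ρ)
eval-strokes x ρ []       []       i e = eval-num x ρ 0
eval-strokes x ρ (N ∷ Ns) (n ∷ ns) i e = trans (eval-if-natrec x ρ (N ∸ᵗ i) (numᵗ 1) inner)
  (trans (cong₂ (λ b c → natrec b (λ _ _ → eval (numᵗ 1) x ρ) c) inner≡
                (trans (eval-∸ x ρ N i) (cong (_∸ i′) (e zero))))
    (trans (natrec-cong refl (λ _ _ → eval-num x ρ 1) (n ∸ i′))
      (cell-strokes n (strokes (toList ns)) i′)))
  where
  i′ : ℕ
  i′ = eval i x ρ
  rest inner : PR _ _
  rest = strokesᵗ Ns (i ∸ᵗ suc N)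
  inner = ifᵗ i ∸ᵗ N then rest else numᵗ 0
  rest≡ : eval rest x ρ ≡ cell (strokes (toList ns)) (i′ ∸ suc n)
  rest≡ = trans (eval-strokes x ρ Ns ns (i ∸ᵗ suc N) (e ∘ suc))
    (cong (cell (strokes (toList ns)))
      (trans (eval-∸ x ρ i (suc N)) (cong (λ m → i′ ∸ suc m) (e zero))))
  inner≡ : eval inner x ρ ≡ natrec 0 (λ _ _ → cell (strokes (toList ns)) (i′ ∸ suc n)) (i′ ∸ n)
  inner≡ = trans (eval-if-natrec x ρ (i ∸ᵗ N) rest (numᵗ 0))
    (trans (cong (natrec _ _) (trans (eval-∸ x ρ i N) (cong (i′ ∸_) (e zero))))
      (natrec-cong (eval-num x ρ 0) (λ _ _ → rest≡) (i′ ∸ n)))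

baireᵗ : ∀ {r n k} → Vec (Fin r) k → PR r n → PR r n → PR r n
baireᵗ []       t i = numᵗ 0
baireᵗ (j ∷ js) t i = ifᵗ t then baireᵗ js (t ∸ᵗ numᵗ 1) i else ask j i

eval-baire : ∀ {r n k} (x : Vec 𝒩 r) (ρ : Vec ℕ n) (js : Vec (Fin r) k) (ys : Vec 𝒩 k) t i →
             (∀ j → lookup x (lookup js j) ≗ lookup ys j) →
             eval (baireᵗ js t i) x ρ ≡ baireAt ys (eval t x ρ) (eval i x ρ)
eval-baire x ρ []       []       t i e = eval-num x ρ 0
eval-baire x ρ (j ∷ js) (y ∷ ys) t i e = go (eval t x ρ) refl
  where
  go : ∀ t′ → eval t x ρ ≡ t′ → eval (baireᵗ (j ∷ js) t i) x ρ ≡ baireAt (y ∷ ys) t′ (eval i x ρ)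
  go zero     et = trans (eval-if-zero x ρ t _ (ask j i) et) (e zero (eval i x ρ))
  go (suc t′) et = trans (eval-if-suc x ρ t _ (ask j i) et)
    (trans (eval-baire x ρ js ys (t ∸ᵗ numᵗ 1) i (e ∘ suc))
      (cong (λ t → baireAt ys t (eval i x ρ))
        (trans (eval-∸ x ρ t (numᵗ 1)) (cong₂ _∸_ et (eval-num x ρ 1)))))

baireAt-zeros : ∀ m t i → baireAt (replicateᵛ m 0𝒩) t i ≡ 0
baireAt-zeros zero    t       i = refl
baireAt-zeros (suc m) zero    i = refl
baireAt-zeros (suc m) (suc t) i = baireAt-zeros m t i

baireAt-++ : ∀ {k} (ys : Vec 𝒩 k) m t i → baireAt (ys ++ᵛ replicateᵛ m 0𝒩) t i ≡ baireAt ys t i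
baireAt-++ []       m t       i = baireAt-zeros m t i
baireAt-++ (y ∷ ys) m zero    i = refl
baireAt-++ (y ∷ ys) m (suc t) i = baireAt-++ ys m t i

tapeAt-blanks : ∀ m t → tapeAt (replicateᵛ m blank) t ≡ blank
tapeAt-blanks zero    t       = refl
tapeAt-blanks (suc m) zero    = refl
tapeAt-blanks (suc m) (suc t) = tapeAt-blanks m t

module Iteration {p q : ℕ} (1≤ : 1 ≤ p + q) (M : MSMachine q) where

  open StepFunction M public

  -- A slave's only numerical argument is the position asked for, so the input numbers join the
  -- input sequences as constant oracles.
  inputSeq : Fin (p + q) → Vec ℕ p → Vec 𝒩 q → 𝒩
  inputSeq j n x with splitAt p j
  ... | inj₁ i = λ _ → lookup n i
  ... | inj₂ i = lookup x i

  inputSeq-realised : ∀ j → Realises seq (inputSeq j)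
  inputSeq-realised j with splitAt p j
  ... | inj₁ i = compose-realised {φ = λ n _ _ → head n} (λ _ _ → refl)
    {g = λ { zero n _ → lookup n i ; (suc k) n _ → lookup n k }} {h = λ k n x → lookup x k}
      (constSeq 1≤)
    (λ { zero → projNum-realised i ; (suc k) → projNum-realised k }) projSeq-realised
  ... | inj₂ i = projSeq-realised i

  initialᵗ₃ : PR (p + q) 3
  initialᵗ₃ =
    ifᵗ (var #0 ≡ᵗ numᵗ 0) ∧ᵗ (var #1 ≡ᵗ numᵗ 0) then numᵗ 1 else
    (ifᵗ (var #0 ≡ᵗ numᵗ 2) ∧ᵗ (var #1 ≡ᵗ numᵗ 0) then strokesᵗ (tabulate λ i → ask (i ↑ˡ q) zero)
      (var #2) else
    (ifᵗ var #0 ≡ᵗ numᵗ 3 then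
      -- Baire tapes 0 and 1, for the zero test and the output, start as zero; the inputs begin with
      -- tape 2.
      (ifᵗ var #1 ∸ᵗ numᵗ 1 then baireᵗ (tabulate (p ↑ʳ_)) (var #1 ∸ᵗ numᵗ 2) (var #2) else numᵗ 0)
     else numᵗ 0))

  initialSeq : Realises {p} {q} seq
    (λ n x i → eval (decodedᵗ initialᵗ₃) (tabulate λ j → inputSeq j n x) (i ∷ []))
  initialSeq = term-realised 1≤ (decodedᵗ initialᵗ₃) inputSeq-realised

  initial-encoded : ∀ {u} n x → graph (pfun initialSeq) n x u → Encodes u (initial n x)
  initial-encoded {u} n x γ .decode a t i =
    trans (sound initialSeq γ (pair a (pair t i))) (trans (eval-decoded initialᵗ₃ xs a t i)
      (trans (eval-if xs ρ _ (numᵗ 1) _ (both 0 0)) (trans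
        (cong₂ (if_then_else_ ((a ≡ᵇ 0) ∧ (t ≡ᵇ 0))) (eval-num xs ρ 1)
          (trans (eval-if xs ρ _ _ _ (both 2 0)) (cong₂ (if_then_else_ ((a ≡ᵇ 2) ∧ (t ≡ᵇ 0)))
            (eval-strokes xs ρ (tabulate λ i → ask (i ↑ˡ q) zero) n (var #2) numbers)
            (trans (eval-if xs ρ (var #0 ≡ᵗ numᵗ 3) _ (numᵗ 0) (one 3))
              (cong₂ (if_then_else_ (a ≡ᵇ 3))
              (trans (eval-if-natrec xs ρ (var #1 ∸ᵗ numᵗ 1) _ (numᵗ 0))
                (trans (cong₂ (λ b c → natrec b
                  (λ _ _ → eval (baireᵗ (tabulate (p ↑ʳ_)) (var #1 ∸ᵗ numᵗ 2) (var #2)) xs ρ) c)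
                          (eval-num xs ρ 0) (minus 1))
                       (natrec-cong refl (λ _ _ → trans
                         (eval-baire xs ρ (tabulate (p ↑ʳ_)) x (var #1 ∸ᵗ numᵗ 2)
                         (var #2) sequences)
                          (cong (λ t → baireAt x t i) (minus 2))) (t ∸ 1))))
              (eval-num xs ρ 0))))))
        (cells a t))))
    where
    xs : Vec 𝒩 (p + q)
    xs = tabulate λ j → inputSeq j n x
    ρ : Vec ℕ 3
    ρ = a ∷ t ∷ i ∷ []
    one : ∀ c → eval (var #0 ≡ᵗ numᵗ c) xs ρ ≡ bit (a ≡ᵇ c)
    one c = trans (eval-≡ xs ρ (var #0) (numᵗ c)) (cong (λ c → bit (a ≡ᵇ c)) (eval-num xs ρ c))
    both : ∀ c d → eval ((var #0 ≡ᵗ numᵗ c) ∧ᵗ (var #1 ≡ᵗ numᵗ d)) xs ρ ≡ bit ((a ≡ᵇ c) ∧ (t ≡ᵇ d))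
    both c d = eval-∧ xs ρ (var #0 ≡ᵗ numᵗ c) (var #1 ≡ᵗ numᵗ d) (one c)
      (trans (eval-≡ xs ρ (var #1) (numᵗ d)) (cong (λ c → bit (t ≡ᵇ c)) (eval-num xs ρ d)))
    minus : ∀ c → eval (var #1 ∸ᵗ numᵗ c) xs ρ ≡ t ∸ c
    minus c = trans (eval-∸ xs ρ (var #1) (numᵗ c)) (cong (t ∸_) (eval-num xs ρ c))
    numbers : ∀ j → eval (lookup (tabulate λ i → ask (i ↑ˡ q) zero) j) xs ρ ≡ lookup n j
    numbers j rewrite lookup∘tabulate {A = PR (p + q) 3} (λ i → ask (i ↑ˡ q) zero) j
                    | lookup∘tabulate (λ j → inputSeq j n x) (j ↑ˡ q) | splitAt-↑ˡ p j q = refl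
    sequences : ∀ j → lookup xs (lookup (tabulate (p ↑ʳ_)) j) ≗ lookup x j
    sequences j k rewrite lookup∘tabulate (p ↑ʳ_) j
                        | lookup∘tabulate (λ j → inputSeq j n x) (p ↑ʳ j) | splitAt-↑ʳ p q j = refl
    cells : ∀ a t → (if (a ≡ᵇ 0) ∧ (t ≡ᵇ 0) then 1 else if (a ≡ᵇ 2) ∧ (t ≡ᵇ 0) then cell
      (strokes (toList n)) i else
                     if a ≡ᵇ 3 then natrec 0 (λ _ _ → baireAt x (t ∸ 2) i)
                       (t ∸ 1) else 0) ≡ component (initial n x) a t i
    cells 0 0 = refl
    cells 0 1 = refl
    cells 0 (suc (suc t)) = refl
    cells 1 0 = refl
    cells 1 (suc t) rewrite tapeAt-blanks (2 + extra) t = refl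
    cells 2 0 = refl
    cells 2 (suc t) rewrite tapeAt-blanks (2 + extra) t = refl
    cells 3 0 = refl
    cells 3 1 = refl
    cells 3 (suc (suc t)) = sym (baireAt-++ x working t i)
    cells (suc (suc (suc (suc a)))) t = refl

-- Iterating the step up to the halting time

empty : ∀ {A : Set} (v : Vec A 0) → v ≡ []
empty [] = refl

module Simulation {p q : ℕ} (1≤ : 1 ≤ p + q) (M : MSMachine q) where

  open Iteration {p} {q} 1≤ M public

  executes : ∀ {s m z β u} (enc : Encodes u (s , m)) {σ} → applicable (holds m) s program ≡ just σ →
             Φω (baire m) (code enc) z → IsBit enc β →
               Executes (command σ) m (effect (command σ) m z β)
  executes {s} {m} {z} {β} enc {σ} e φ t = go (command σ) refl
    where
    code≡ : ∀ o → applicable (holds m) s program ≡ o →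
            code enc ≡ (if onCommand isCall o then block
              (after (lookup (tapes m) billboard)) else idle)
    code≡ _ refl = refl
    bit≡ : ∀ o → applicable (holds m) s program ≡ o →
           IsZeroTest (if onCommand isZeroTest o then lookup (baire m) zero else 0𝒩) (bit β)
    bit≡ _ refl = t
    zero-tested : IsZeroTest (lookup (baire m) zero) (bit β) →
      Executes zeroTest m (effect zeroTest m z β)
    zero-tested (inj₁ (y , b)) rewrite bit-suc b = zeroTestYes y
    zero-tested (inj₂ (n , b)) rewrite bit-zero b = zeroTestNo n
    go : ∀ c → command σ ≡ c → Executes c m (effect c m z β)
    go (act j a) _  = act
    go (call l) c≡ = call (λ i → subst (λ e → Φ (baire m) e i (z i))
      (trans (code≡ (just σ) e) (cong
        (λ c → if isCall c then block (after (lookup (tapes m) billboard)) else idle) c≡)) (φ i))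
    go zeroTest c≡ = zero-tested (subst
      (λ c → IsZeroTest (if isZeroTest c then lookup (baire m) zero else 0𝒩) (bit β)) c≡
      (bit≡ (just σ) e))

  -- Stated with `Star` so that zero machine steps can account for a repeated configuration.
  step-sound : ∀ {u u′ s m} → Encodes u (s , m) → graph stepFun [] (u ∷ []) u′ →
               ∃[ c ] Star _⟶_ (s , m) c × Encodes u′ c
  step-sound {s = s} {m} enc γ with step-graph-sound enc γ
  ... | z , β , φ , t , enc′ = go (applicable (holds m) s program) refl enc′
    where
    go : ∀ o → applicable (holds m) s program ≡ o → Encodes _ (next enc z β o) →
      ∃[ c ] Star _⟶_ (s , m) c × Encodes _ c
    go (just σ) e enc′ = _ , step e (executes enc e φ t) ◅ ε , enc′
    go nothing  e enc′ = _ , ε , enc′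

  step-inputs : ∀ {u s m} (enc : Encodes u (s , m)) {σ m′} →
    applicable (holds m) s program ≡ just σ →
                Executes (command σ) m m′ →
                ∃[ z ] ∃[ β ] Φω (baire m) (code enc) z × IsBit enc β × m′ ≡ effect
                  (command σ) m z β
  step-inputs {s = s} {m} enc {σ} e ex = go (command σ) refl ex
    where
    Goal : Maybe MR → MC → Memory → Set
    Goal o c m′ = ∃[ z ] ∃[ β ] Φω (baire m)
      (if onCommand isCall o then block (after (lookup (tapes m) billboard)) else idle) z ×
      IsZeroTest (if onCommand isZeroTest o then lookup (baire m) zero else 0𝒩)
        (bit β) × m′ ≡ effect c m z β
    Goal′ : MC → Memory → Set
    Goal′ c m′ = ∃[ z ] ∃[ β ] Φω (baire m)
      (if isCall c then block (after (lookup (tapes m) billboard)) else idle) z ×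
      IsZeroTest (if isZeroTest c then lookup (baire m) zero else 0𝒩) (bit β) × m′ ≡ effect c m z β
    idles : Φω (baire m) idle 0𝒩
    idles = Φ-index zero (baire m)
    zeros : IsZeroTest 0𝒩 1
    zeros = inj₁ ((λ _ → refl) , refl)
    by-command : ∀ {m′} c → Executes c m m′ → Goal′ c m′
    -- Without a slave call the sequence is that of `idle`; without a zero test `χ` sees the zero
    -- sequence, whence the bit `true`.
    by-command (act _ _) act             = 0𝒩 , true , idles , zeros , refl
    by-command (call _)  (call {z = z} φ) = z , true , φ , zeros , refl
    by-command zeroTest  (zeroTestYes y) = 0𝒩 , true , idles , inj₁ (y , refl) , refl
    by-command zeroTest  (zeroTestNo n)  = 0𝒩 , false , idles , inj₂ (n , refl) , refl
    go : ∀ {m′} c → command σ ≡ c → Executes c m m′ → Goal (applicable (holds m) s program) c m′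
    go {m′} c refl ex = subst (λ o → Goal o (command σ) m′) (sym e) (by-command (command σ) ex)

  step-complete : ∀ {u c c′} → Encodes u c → c ⟶ c′ →
    ∃[ u′ ] graph stepFun [] (u ∷ []) u′ × Encodes u′ c′
  step-complete {u} enc (step {s = s} {m} {ρ = σ} e ex) with step-inputs enc e ex
  ... | z , β , φ , t , refl with step-graph-complete enc φ t
  ... | u′ , γ , enc′ = u′ , γ , subst (λ o → Encodes u′ (next enc z β o)) e enc′

  -- F (k , n ; x) encodes the configuration after k steps.

  stepLast : PFun (suc p) (suc q) seq
  stepLast = compose stepFun noNum (λ _ → projSeq (fromℕ q))

  F : PFun (suc p) q seq
  F = primRecSeq (pfun initialSeq) stepLast

  F-recursive : PartialRecursive F
  F-recursive = primRecSeqʳ (recursive initialSeq)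
    (composeʳ {g = noNum} {h = λ _ → projSeq (fromℕ q)} step-recursive (λ ())
      (λ _ → projSeqʳ (fromℕ q)))

  Reaches : Vec ℕ p → Vec 𝒩 q → ℕ → 𝒩 → Set
  Reaches n x k u = PrimRecSeq.Rec (pfun initialSeq) stepLast k n x u

  reaches-sound : ∀ k {n x u} → Reaches n x k u → ∃[ c ] Star _⟶_ (initial n x) c × Encodes u c
  reaches-sound zero {n} {x} γ = _ , ε , initial-encoded n x γ
  reaches-sound (suc k) {x = x} (v , r , (_ , v′ ∷ [] , _ , e , γ)) with reaches-sound k r
  ... | c , run , enc with step-sound
        (Encodes-≗ (λ i → trans (e zero i) (cong (λ f → f i) (lookup-∷ʳ-last x v))) enc)
                             (subst (λ m → graph stepFun m (v′ ∷ []) _) (empty _) γ)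
  ... | c′ , run′ , enc′ = c′ , run ◅◅ run′ , enc′

  -- `μ` requires a defined and nonzero state at every earlier time, so these are collected along
  -- the run.
  RunsFor : Vec ℕ p → Vec 𝒩 q → ℕ → Set
  RunsFor n x k = ∀ j → j < k → ∃[ u ] ∃[ s ] ∃[ m ] Reaches n x j u × Encodes u (suc s , m)

  reaches-complete : ∀ {n x c d} k {u} → Star _⟶_ c d → Reaches n x k u → Encodes u c →
    RunsFor n x k →
                     ∃[ k′ ] ∃[ u′ ] Reaches n x k′ u′ × Encodes u′ d × RunsFor n x k′
  reaches-complete k ε r enc runs = k , _ , r , enc , runs
  reaches-complete {n} {x} k {u} (_◅_ {i = c} st run) r enc runs with step-complete enc st
  ... | u′ , γ , enc′ = reaches-complete (suc k) run
    (u , r , ([] , u ∷ [] , (λ ()) , (λ { zero i → cong (λ f → f i) (sym (lookup-∷ʳ-last x u)) }) ,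
      γ)) enc′ (runs′ c st enc)
    where
    runs′ : ∀ c {c′} → c ⟶ c′ → Encodes u c → RunsFor n x (suc k)
    -- State 0 has no rules, so a configuration that makes a step is not halted and time `k` joins
    -- the earlier ones.
    runs′ (zero , m)  (step () _) enc
    runs′ (suc s , m) _ enc j (s≤s j≤k) with m≤n⇒m<n∨m≡n j≤k
    ... | inj₁ j<k  = runs j j<k
    ... | inj₂ refl = u , s , m , r , enc

  stateSeq : Realises {0} {1} seq (λ n x i → eval stateᵗ (tabulate λ j → lookup x j) (i ∷ []))
  stateSeq = term-realised (s≤s z≤n) stateᵗ projSeq-realised

  stateNum : Realises {0} {1} num (λ n x → eval stateᵗ (tabulate λ j → lookup x j) (0 ∷ []))
  stateNum = head-realised (s≤s z≤n)
    (λ n {x} {x′} x≋x′ i → eval-cong stateᵗ {tabulate (lookup x)} {tabulate (lookup x′)} (i ∷ [])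
    (lookup-≋ λ j k →
    trans (lookup-tabulate-≗ (lookup x) j k)
      (trans (Pointwise.lookup x≋x′ j k) (sym (lookup-tabulate-≗ (lookup x′) j k))))) stateSeq

  state-sound : ∀ {u s m k} → Encodes u (s , m) → graph (pfun stateNum) [] (u ∷ []) k → k ≡ s
  state-sound enc γ = trans (sound stateNum γ) (eval-state enc [] (0 ∷ []))

  state-complete : ∀ {u s m} → Encodes u (s , m) → graph (pfun stateNum) [] (u ∷ []) s
  state-complete enc = complete-Eq stateNum (eval-state enc [] (0 ∷ []))

  stateAfter : PFun (suc p) q num
  stateAfter = compose (pfun stateNum) noNum (λ _ → F)

  haltingTime : PFun p q num
  haltingTime = μ stateAfter

  haltingNums : Fin (suc p) → PFun p q num
  haltingNums zero    = haltingTime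
  haltingNums (suc i) = projNum i

  haltingF : PFun p q seq
  haltingF = compose F haltingNums projSeq

  haltingNums-recursive : ∀ i → PartialRecursive (haltingNums i)
  haltingNums-recursive zero =
    μʳ 1≤ (composeʳ {f = pfun stateNum} {g = noNum} {h = λ _ → F} (recursive stateNum) (λ ())
      (λ _ → F-recursive))
  haltingNums-recursive (suc i) = projNumʳ i

  haltingF-recursive : PartialRecursive haltingF
  haltingF-recursive = composeʳ {f = F} {g = haltingNums} {h =
    projSeq} F-recursive haltingNums-recursive projSeqʳ

  haltingF-sound : ∀ {n x u} → graph haltingF n x u →
                   ∃[ m ] Star _⟶_ (initial n x) (0 , m) × Encodes u (0 , m)
  haltingF-sound {n} {x} {u} (k ∷ n′ , x′ , K , X , r) with K zero
  ... | (v , u₁ ∷ [] , _ , R₁ , st) , _ = conclude (reaches-sound k r₀)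
    where
    r₀ : Reaches n x k u
    r₀ = subst (λ n → Reaches n x k u) (lookup-ext (λ i → K (suc i)))
      (PrimRecSeq.Rec-respects (pfun initialSeq) stepLast k (lookup-≋ X) (λ _ → refl) r)
    conclude : (∃[ c ] Star _⟶_ (initial n x) c × Encodes u c) →
               ∃[ m ] Star _⟶_ (initial n x) (0 , m) × Encodes u (0 , m)
    conclude ((s , m) , run , enc) =
      m , subst (λ s → Star _⟶_ _ (s , m)) s≡0 run , subst (λ s → Encodes u (s , m)) s≡0 enc
      where
      s≡0 : s ≡ 0
      -- The search found state 0 in its own copy of the configuration at time `k`; functionality of
      -- the recursion carries this over to `u`.
      s≡0 = sym (state-sound
        (Encodes-≗ (PrimRecSeq.Rec-functional (pfun initialSeq) stepLast k (R₁ zero) r₀) enc)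
        (subst (λ v → graph (pfun stateNum) v (u₁ ∷ []) 0) (empty v) st))

  haltingF-complete : ∀ {n x m} → Star _⟶_ (initial n x) (0 , m) →
    ∃[ u ] graph haltingF n x u × Encodes u (0 , m)
  haltingF-complete {n} {x} run
    with reaches-complete 0 run (complete initialSeq n x)
      (initial-encoded n x (complete initialSeq n x)) (λ _ ())
  ... | k , u , r , enc , runs = u ,
        (k ∷ n , x , (λ { zero → time ; (suc i) → refl }) , (λ _ _ → refl) , r) , enc
    where
    time : graph haltingTime n x k
    time = ([] , u ∷ [] , (λ ()) , (λ { zero → r }) , state-complete enc) , λ j j<k →
      case runs j j<k of λ { (u′ , s , m , r′ , enc′) →
        s , [] , u′ ∷ [] , (λ ()) , (λ { zero → r′ }) , state-complete enc′ }

  module OutputSearch = Search {0} {1} (s≤s z≤n)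
    (term-realised (s≤s z≤n) (unstrokedᵗ outputTape) codeArguments-realised)

  outputFun : ∀ Y → PFun 0 1 Y
  outputFun num = OutputSearch.search
  outputFun seq = pfun (slaveTape outputBaire)

  output-recursive : ∀ Y → PartialRecursive (outputFun Y)
  output-recursive num = OutputSearch.search-recursive
  output-recursive seq = recursive (slaveTape outputBaire)

  output-sound : ∀ Y {u s m y} → Encodes u (s , m) → graph (outputFun Y) [] (u ∷ []) y →
    Eq Y (output Y m) y
  output-sound num {m = m} {y} enc γ with OutputSearch.search-sound γ
  ... | (v , found) , earlier = sym (block-unique (after (lookup (tapes m) outputTape)) y
      (unstroked (trans (sym (eval-unstroked enc outputTape y)) found))
      λ j j<y → stroked (trans (sym (eval-unstroked enc outputTape j)) (earlier j j<y)))
  output-sound seq enc γ i = sym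
    (trans (sound (slaveTape outputBaire) γ i) (slaveTape-≗ enc outputBaire i))

  output-complete : ∀ Y {u s m} → Encodes u (s , m) → graph (outputFun Y) [] (u ∷ []) (output Y m)
  output-complete num {m = m} enc = OutputSearch.search-complete
    ( (0 , trans (eval-unstroked enc outputTape _)
      (cong (λ b → if b then 0 else 1) (block-cell (after (lookup (tapes m) outputTape)))))
    , λ j j<b → trans (eval-unstroked enc outputTape j)
        (cong (λ v → if v ≡ᵇ 1 then 0 else 1)
          (block-below (after (lookup (tapes m) outputTape)) j<b)))
  output-complete seq enc = complete-Eq (slaveTape outputBaire) (slaveTape-≗ enc outputBaire)

  computed : ∀ Y → PFun p q Y
  computed Y = compose (outputFun Y) noNum (λ _ → haltingF)

  computed-recursive : ∀ Y → PartialRecursive (computed Y)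
  computed-recursive Y = composeʳ {g = noNum} {h = λ _ → haltingF} (output-recursive Y) (λ ())
    (λ _ → haltingF-recursive)

  computed-sound : ∀ Y {n x y} → graph (computed Y) n x y → Computes Y n x y
  computed-sound Y (v , u ∷ [] , _ , H , γ) with haltingF-sound (H zero)
  ... | m , run , enc = m , run ,
        output-sound Y enc (subst (λ v → graph (outputFun Y) v (u ∷ []) _) (empty v) γ)

  computed-complete : ∀ Y {n x y} → Computes Y n x y → graph (computed Y) n x y
  computed-complete Y (m , run , e) with haltingF-complete run
  ... | u , H , enc = [] , u ∷ [] , (λ ()) , (λ { zero → H }) ,
    respects (outputFun Y) ≋-refl e (output-complete Y enc)

computable⇒recursive : ∀ {p q Y} → 1 ≤ p + q → (f : PFun p q Y) → MSComputable f →
  PartialRecursive f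
computable⇒recursive {p} {q} {Y} 1≤ f (M , f⇔M) = extensional
  (λ n x y → mk⇔ (Equivalence.from (f⇔M n x y) ∘ computed-sound Y)
                 (computed-complete Y ∘ Equivalence.to (f⇔M n x y)))
  (computed-recursive Y)
  where open Simulation {p} {q} 1≤ M

theorem2p14 : ∀ (p q : ℕ) (Y : Codomain) → 1 ≤ p + q →
    (f : PFun p q Y) → MSComputable f ⇔ PartialRecursive f
theorem2p14 p q Y 1≤ f = mk⇔ (computable⇒recursive 1≤ f) recursive⇒computable
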